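{- Let $V$ be a positive integer divisible by $4$, and write the prime factorization of $V/4$ as $$\frac{V}{4} = 3^{m}\, p_1^{k_1} p_2^{k_2}\cdots p_r^{k_r}\, q_1^{\ell_1} q_2^{\ell_2}\cdots q_s^{\ell_s},$$ where $p_1,\dots,p_r$ are distinct primes with $p_i \equiv 1 \pmod 3$, $q_1,\dots,q_s$ are distinct primes with $q_j\equiv 2 \pmod 3$, $m\ge 0$, and all $k_i\ge 1$, $\ell_j\ge 1$. If some exponent $\ell_j$ is odd, then the number of trihexes with $V$ vertices is $$\frac13\left(\frac{3^{m+1}-1}{3-1}\prod_{i=1}^{r}\frac{p_i^{k_i+1}-1}{p_i-1}\prod_{j=1}^{s}\frac{q_j^{\ell_j+1}-1}{q_j-1}\right).$$ If all exponents $\ell_j$ are even, then the number of trihexes with $V$ vertices is $$\frac13\left(\frac{3^{m+1}-1}{3-1}\prod_{i=1}^{r}\frac{p_i^{k_i+1}-1}{p_i-1}\prod_{j=1}^{s}\frac{q_j^{\ell_j+1}-1}{q_j-1}\right)+\frac23\prod_{i=1}^{r}(k_i+1).$$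
   Context: A trihex is a 3-regular graph embedded in the plane (equivalently, in the sphere) all of whose faces, including the unbounded one, have exactly 3 or exactly 6 sides. Two trihexes are counted as the same if they are isomorphic as graphs via an isomorphism induced by an orientation-preserving homeomorphism of the plane; in particular, a trihex and its mirror image are counted as distinct unless such a homeomorphism exists. Every trihex has exactly four triangular faces. Known background: every trihex arises as the quotient of the regular hexagonal tiling of the plane (hexagons in vertical columns) by the group generated by the $180^\circ$ rotations about the centers of a set of "special" hexagons whose centers form the vertices of a parallelogram lattice; the quotient is a sphere, special hexagons cover the triangles, other hexagons cover hexagonal faces. Such a trihex is described by a signature $(s,b,f)$ of integers with $s\ge 0$, $b\ge0$, $0\le f\le s$ (spine length, number of belt columns between adjacent spine columns, and offset), and has $V=4(s+1)(b+1)$ vertices. Every such triple is a signature of exactly one trihex, and each trihex has exactly three signatures (one for each of the three column directions of the hexagonal tiling), which are either pairwise distinct or all identical. -}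

module Defs where

open import Data.Nat using (ℕ; zero; suc; _+_; _*_; _∸_; _^_; _≤_; _<_)
open import Data.Nat.DivMod using (_/_; _%_)
open import Data.Nat.Primality using (Prime)
open import Data.Fin using (Fin)
open import Data.Fin.Properties using (_≟_)
open import Data.List using (List; []; _∷_; map; allFin; filter; length)
open import Data.List.Relation.Unary.All using (All)
open import Data.List.Relation.Unary.Any using (Any)
open import Data.List.Relation.Unary.Unique.Propositional using (Unique)
open import Data.Product using (Σ; _×_; _,_; proj₁; proj₂; ∃)
open import Data.Sum using (_⊎_)
open import Function.Bundles using (_↔_; Inverse)
open import Relation.Nullary using (¬_)
open import Relation.Nullary.Decidable using (¬?)
open import Relation.Binary.PropositionalEquality using (_≡_; _≢_)
open import Relation.Binary.Construct.Closure.ReflexiveTransitive using (Star)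

-- Trihexes as combinatorial maps (rotation systems) on the sphere.
--
-- A cubic map with V vertices has 3V darts (half-edges), here Fin (3 * V).
--   σ : rotation of darts around their vertex (counterclockwise);
--       every σ-orbit has size exactly 3 (σ³ = id, no fixed points).
--   α : the edge involution (fixed-point free): pairs the two half-edges
--       of an edge.
--   φ = σ ∘ α : face permutation; its orbits are the faces, and the size
--       of an orbit is the number of sides of the face.
-- Connectedness: the group ⟨σ, α⟩ acts transitively on darts.
-- Genus 0 (embedding in the sphere): Euler formula V - E + F = 2.

Dart : ℕ → Set
Dart V = Fin (3 * V)

Orbit3 : {A : Set} → (A → A) → A → Set
Orbit3 φ x = (φ (φ (φ x)) ≡ x) × (φ x ≢ x)

Orbit6 : {A : Set} → (A → A) → A → Set
Orbit6 φ x = (φ (φ (φ (φ (φ (φ x))))) ≡ x) × (φ (φ (φ x)) ≢ x) × (φ (φ x) ≢ x)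

-- number of darts x with φ³ x = x (darts on triangular faces, given the
-- face-size condition below)
n3 : ∀ {V} → (Dart V → Dart V) → ℕ
n3 {V} φ = length (filter (λ x → φ (φ (φ x)) ≟ x) (allFin (3 * V)))

-- number of darts x with φ³ x ≠ x (darts on hexagonal faces)
n6 : ∀ {V} → (Dart V → Dart V) → ℕ
n6 {V} φ = length (filter (λ x → ¬? (φ (φ (φ x)) ≟ x)) (allFin (3 * V)))

data Step {A : Set} (σ α : A → A) : A → A → Set where
  σ-step : ∀ x → Step σ α x (σ x)
  α-step : ∀ x → Step σ α x (α x)

record Trihex (V : ℕ) : Set where
  field
    σ : Dart V → Dart V
    α : Dart V → Dart V
    σ-cube  : ∀ x → σ (σ (σ x)) ≡ x
    σ-fix   : ∀ x → σ x ≢ x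
    α-invol : ∀ x → α (α x) ≡ x
    α-fix   : ∀ x → α x ≢ x
    faces   : ∀ x → Orbit3 (λ y → σ (α y)) x ⊎ Orbit6 (λ y → σ (α y)) x
    connected : ∀ x y → Star (Step σ α) x y
    -- Euler: V - E + F = 2 with E = 3V/2 and
    -- F = n3/3 + n6/6, i.e. 6F = 2·n3 + n6 ; equivalently 3(V + 4) = 2·n3 + n6
    euler   : 3 * (V + 4) ≡ 2 * n3 {V} (λ y → σ (α y)) + n6 {V} (λ y → σ (α y))

open Trihex

-- Isomorphism induced by an orientation-preserving homeomorphism:
-- a bijection of darts commuting with σ and α.
Iso : ∀ {V} → Trihex V → Trihex V → Set
Iso {V} T U =
  Σ (Dart V ↔ Dart V) λ f →
    (∀ x → Inverse.to f (σ T x) ≡ σ U (Inverse.to f x)) ×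
    (∀ x → Inverse.to f (α T x) ≡ α U (Inverse.to f x))

NumTrihexes : ℕ → ℕ → Set
NumTrihexes V N =
  Σ (Fin N → Trihex V) λ ts →
    (∀ i j → Iso (ts i) (ts j) → i ≡ j) ×
    (∀ T → ∃ λ i → Iso T (ts i))

prodℕ : List ℕ → ℕ
prodℕ []       = 1
prodℕ (x ∷ xs) = x * prodℕ xs

-- (p^(k+1) - 1) / (p - 1), for p ≥ 2 (value for p < 2 irrelevant)
geomQ : ℕ → ℕ → ℕ
geomQ zero k          = 0
geomQ (suc zero) k    = 0
geomQ (suc (suc p)) k = (suc (suc p) ^ suc k ∸ 1) / suc p

PrimePowers : ℕ → List (ℕ × ℕ) → Set
PrimePowers r ps =
  Unique (map proj₁ ps) ×
  All (λ pk → Prime (proj₁ pk) × (proj₁ pk % 3 ≡ r) × (1 ≤ proj₂ pk)) ps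

powProd : List (ℕ × ℕ) → ℕ
powProd ps = prodℕ (map (λ pk → proj₁ pk ^ proj₂ pk) ps)

geomProd : List (ℕ × ℕ) → ℕ
geomProd ps = prodℕ (map (λ pk → geomQ (proj₁ pk) (proj₂ pk)) ps)

divCount : List (ℕ × ℕ) → ℕ
divCount ps = prodℕ (map (λ pk → suc (proj₂ pk)) ps)

{-# OPTIONS --safe #-}
module Submission where

-- Let Λ = ℤ[ζ], ζ = exp(πi/3), be the lattice of hexagon centres.  In a trihex,
-- the relations σ³ = α² = φ⁶ = 1 turn the words φ³α, φ²αφ, φαφ² into commuting
-- translations by 1, ζ, ζ², so that unrolling from a dart x on a triangle maps
-- the darts of the hexagonal tiling onto those of the trihex.  As σ, α, φ and φ²
-- have no fixed darts, the deck group consists of translations and of half-turns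
-- about hexagon centres, hence it is {±1} ⋉ 2M for a sublattice M of Λ, of index
-- V/4.  Replacing x by φ x replaces M by ζ⁻¹M, so trihexes with V vertices
-- correspond to orbits of the order-three action of ζ on sublattices of index
-- n = V/4, and
--
--   3 · #trihexes = #sublattices + 2 · #(sublattices closed under ζ).
--
-- The sublattices, in Hermite normal form, number σ(n).  Those closed under ζ are
-- c⟨e , ζ + b⟩ with c²e = n and e ∣ b² + b + 1.  Both counts are multiplicative.
-- The roots of b² + b + 1 modulo a prime p are the fixed points of the order-three
-- map x ↦ -1/(1+x) on the p - 2 residues other than 0 and -1, which settles their
-- number modulo 3; Hensel lifting handles the powers of p ≡ 1 (mod 3).

-- Two obstacles shape the proof. A trihex comes as permutations of a finite set, with no covering
-- plane, so the covering is built algebraically: a map on Λ is pinned down by its value at 0 and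
-- its behaviour under the steps 1 and ζ, and this uniqueness carries the work with unrolling. And
-- the half-turn about 0 is available only if the base dart lies on a triangle; Euler's formula
-- supplies such a dart, since hexagons alone would close up to a torus. The lattice is of the form
-- 2M because a half-turn about the midpoint of an edge would give a dart fixed by α. Folding the
-- six sides of a hexagon by half-turns leaves three darts for each class of Λ/2M, so 3V = 3 · 4 ·
-- [Λ : M], whence the index V/4. Another triangle as base changes nothing, because translations
-- commute, and φ³ acts as -1, which preserves every lattice. So the action has order three although
-- ζ has order six, and orbits have one or three elements: 1 + 2 = 3 explains the factor 2.

-- Counting by enumeration, and orbits of a map of order three.

module Counting where

  open import Data.Nat using (ℕ; suc; _+_; _*_; _≤_; _<_; z≤n; s≤s)
  open import Data.Nat.Properties using (≤-antisym; ≤-reflexive; ≤-trans; suc-injective; m≤n+m)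
  open import Data.Nat.Tactic.RingSolver using (solve-∀)
  open import Data.List using (List; []; _∷_; _++_; map; length; filter; cartesianProduct; upTo; lookup)
  open import Data.List.Properties using (length-++; length-map; length-upTo; filter-accept; filter-reject)
  open import Data.List.Membership.Propositional using (_∈_; _∉_)
  open import Data.List.Membership.Propositional.Properties using (∈-∃++; ∈-++⁺ˡ; ∈-++⁺ʳ; ∈-++⁻; ∈-upTo⁺; ∈-upTo⁻; ∈-cartesianProduct⁺; ∈-cartesianProduct⁻; ∈-filter⁺; ∈-filter⁻)
  open import Data.List.Relation.Unary.Any using (here; there)
  open import Data.List.Relation.Unary.All as All using (All; []; _∷_)
  open import Data.List.Relation.Unary.AllPairs using ([]; _∷_)
  open import Data.List.Relation.Unary.Unique.Propositional using (Unique)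
  import Data.List.Relation.Unary.Unique.Propositional.Properties as Unique
  open import Data.List.Relation.Binary.Permutation.Propositional using (_↭_; ↭-trans; ↭-sym; ↭-prep; ↭⇒↭ₛ)
  open import Data.List.Relation.Binary.Permutation.Propositional.Properties using (shift; ↭-length; ∈-resp-↭; filter-↭)
  import Data.List.Relation.Binary.Permutation.Setoid.Properties as PermₛProps
  open import Data.Product using (Σ; ∃; _×_; _,_; proj₁; proj₂)
  open import Data.Sum using (_⊎_; inj₁; inj₂; [_,_]′)
  open import Data.Empty using (⊥; ⊥-elim)
  open import Function using (_∘_)
  open import Relation.Nullary using (¬_; Dec; yes; no)
  open import Relation.Unary using (Decidable)
  open import Relation.Binary.PropositionalEquality using (_≡_; _≢_; refl; sym; trans; cong; cong₂; subst; setoid)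

  private
    variable
      A B : Set

  Unique-resp-↭ : {xs ys : List A} → xs ↭ ys → Unique xs → Unique ys
  Unique-resp-↭ {A} p = PermₛProps.Unique-resp-↭ (setoid A) (↭⇒↭ₛ p)

  extract : {x : A} {xs : List A} → x ∈ xs → ∃ λ ys → xs ↭ x ∷ ys
  extract {x = x} x∈xs with ∈-∃++ x∈xs
  ... | ys , zs , refl = ys ++ zs , shift x ys zs

  ∈-tail : {x y : A} {xs : List A} → x ≢ y → x ∈ y ∷ xs → x ∈ xs
  ∈-tail x≢y (here eq)  = ⊥-elim (x≢y eq)
  ∈-tail x≢y (there x∈) = x∈

  head∉tail : {x : A} {xs : List A} → Unique (x ∷ xs) → x ∉ xs
  head∉tail (px ∷ _) x∈ = All.lookup px x∈ refl

  length-⊆ : {xs ys : List A} → Unique xs → (∀ {x} → x ∈ xs → x ∈ ys) → length xs ≤ length ys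
  length-⊆ {xs = []} _ _ = z≤n
  length-⊆ {xs = x ∷ xs} u@(_ ∷ uxs) sub with extract (sub (here refl))
  ... | ys′ , perm = ≤-trans (s≤s (length-⊆ uxs sub′)) (≤-reflexive (sym (↭-length perm)))
    where
    sub′ : ∀ {z} → z ∈ xs → z ∈ ys′
    sub′ z∈ = ∈-tail (λ { refl → head∉tail u z∈ }) (∈-resp-↭ perm (sub (there z∈)))

  -- Card P n says that exactly n elements satisfy P.  The elements are listed
  -- rather than packed in a Σ-type, so that no proof irrelevance of P is needed.
  record Card (P : A → Set) (n : ℕ) : Set where
    constructor card
    field
      elements : List A
      unique   : Unique elements
      sound    : ∀ {x} → x ∈ elements → P x
      complete : ∀ {x} → P x → x ∈ elements
      size     : length elements ≡ n

  open Card public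

  Card-unique : {P : A → Set} {m n : ℕ} → Card P m → Card P n → m ≡ n
  Card-unique c d = trans (sym (size c)) (trans (≤-antisym
    (length-⊆ (unique c) (complete d ∘ sound c)) (length-⊆ (unique d) (complete c ∘ sound d))) (size d))

  Card-cong : {P : A → Set} {m n : ℕ} → m ≡ n → Card P m → Card P n
  Card-cong refl c = c

  module _ {P : A → Set} {Q : B → Set} (R : A → B → Set)
    (to   : ∀ x → P x → ∃ λ y → Q y × R x y)
    (from : ∀ y → Q y → ∃ λ x → P x × R x y)
    (functional : ∀ x y y′ → P x → Q y → Q y′ → R x y → R x y′ → y ≡ y′)
    (injective  : ∀ x x′ y → P x → P x′ → Q y → R x y → R x′ y → x ≡ x′)
    where

    private
      image : (xs : List A) → (∀ {x} → x ∈ xs → P x) → List B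
      image []       _ = []
      image (x ∷ xs) s = proj₁ (to x (s (here refl))) ∷ image xs (s ∘ there)

      image-size : ∀ xs (s : ∀ {x} → x ∈ xs → P x) → length (image xs s) ≡ length xs
      image-size []       s = refl
      image-size (x ∷ xs) s = cong suc (image-size xs (s ∘ there))

      image⁻ : ∀ xs (s : ∀ {x} → x ∈ xs → P x) {y} → y ∈ image xs s → ∃ λ x → x ∈ xs × Q y × R x y
      image⁻ (x ∷ xs) s (here refl) = x , here refl , proj₂ (to x (s (here refl)))
      image⁻ (x ∷ xs) s (there y∈) with image⁻ xs (s ∘ there) y∈
      ... | x′ , x′∈ , q , r = x′ , there x′∈ , q , r

      image⁺ : ∀ xs (s : ∀ {x} → x ∈ xs → P x) {x y} → x ∈ xs → Q y → R x y → y ∈ image xs s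
      image⁺ (x ∷ xs) s (here refl) q r with to x (s (here refl))
      ... | y′ , q′ , r′ = here (functional x _ _ (s (here refl)) q q′ r r′)
      image⁺ (x ∷ xs) s (there x∈) q r = there (image⁺ xs (s ∘ there) x∈ q r)

      image-unique : ∀ xs (s : ∀ {x} → x ∈ xs → P x) → Unique xs → Unique (image xs s)
      image-unique []       s _ = []
      image-unique (x ∷ xs) s u@(_ ∷ uxs) =
        All.tabulate new ∷ image-unique xs (s ∘ there) uxs
        where
        new : ∀ {y} → y ∈ image xs (s ∘ there) → proj₁ (to x (s (here refl))) ≢ y
        new y∈ refl with image⁻ xs (s ∘ there) y∈
        ... | x′ , x′∈ , q , r
          with injective x x′ _ (s (here refl)) (s (there x′∈)) q (proj₂ (proj₂ (to x (s (here refl))))) r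
        ... | refl = head∉tail u x′∈

    -- The correspondence is a relation and not a function because `to` may depend on the proof of
    -- `P x`; `functional` makes its value independent of that proof, and `from` shows that the
    -- image exhausts `Q`.
    Card-bij : {n : ℕ} → Card P n → Card Q n
    Card-bij (card xs u s c eq) = card (image xs s) (image-unique xs s u)
      (λ y∈ → proj₁ (proj₂ (proj₂ (image⁻ xs s y∈))))
      (λ q → let x , p , r = from _ q in image⁺ xs s (c p) q r)
      (trans (image-size xs s) eq)

  Card-⇔ : {P Q : A → Set} {n : ℕ} → (∀ {x} → P x → Q x) → (∀ {x} → Q x → P x) → Card P n → Card Q n
  Card-⇔ f g = Card-bij _≡_ (λ x p → x , f p , refl) (λ y q → y , g q , refl)
    (λ { _ _ _ _ _ _ refl refl → refl }) (λ { _ _ _ _ _ _ refl refl → refl })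

  Card-∅ : {P : A → Set} → (∀ {x} → ¬ P x) → Card P 0
  Card-∅ ¬p = card [] [] (λ ()) (λ p → ⊥-elim (¬p p)) refl

  Card-singleton : (a : A) → Card (_≡ a) 1
  Card-singleton a = card (a ∷ []) ([] ∷ []) (λ { (here eq) → eq }) here refl

  Card-< : ∀ n → Card (_< n) n
  Card-< n = card (upTo n) (Unique.upTo⁺ n) ∈-upTo⁻ ∈-upTo⁺ (length-upTo n)

  Card-⊎ : {P Q : A → Set} {m n : ℕ} → (∀ {x} → P x → Q x → ⊥) →
           Card P m → Card Q n → Card (λ x → P x ⊎ Q x) (m + n)
  Card-⊎ disj (card xs u s c e) (card ys v t d f) = card (xs ++ ys)
    (Unique.++⁺ u v (λ (x∈ , y∈) → disj (s x∈) (t y∈)))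
    (λ z∈ → [ inj₁ ∘ s , inj₂ ∘ t ]′ (∈-++⁻ xs z∈))
    [ ∈-++⁺ˡ ∘ c , ∈-++⁺ʳ xs ∘ d ]′
    (trans (length-++ xs) (cong₂ _+_ e f))

  length-cartesianProduct : (xs : List A) (ys : List B) → length (cartesianProduct xs ys) ≡ length xs * length ys
  length-cartesianProduct []       ys = refl
  length-cartesianProduct (x ∷ xs) ys = trans (length-++ (map (x ,_) ys))
    (cong₂ _+_ (length-map (x ,_) ys) (length-cartesianProduct xs ys))

  Card-× : {P : A → Set} {Q : B → Set} {m n : ℕ} →
           Card P m → Card Q n → Card (λ (x , y) → P x × Q y) (m * n)
  Card-× (card xs u s c e) (card ys v t d f) = card (cartesianProduct xs ys)
    (Unique.cartesianProduct⁺ u v)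
    (λ z∈ → let x∈ , y∈ = ∈-cartesianProduct⁻ xs ys z∈ in s x∈ , t y∈)
    (λ (p , q) → ∈-cartesianProduct⁺ (c p) (d q))
    (trans (length-cartesianProduct xs ys) (cong₂ _*_ e f))

  Card-filter : {P Q : A → Set} {n : ℕ} → Decidable Q → Card P n → ∃ λ k → Card (λ x → P x × Q x) k
  Card-filter Q? (card xs u s c e) = _ , card (filter Q? xs) (Unique.filter⁺ Q? u)
    (λ x∈ → let x∈xs , q = ∈-filter⁻ Q? x∈ in s x∈xs , q)
    (λ (p , q) → ∈-filter⁺ Q? (c p) q) refl

  record Representatives (f : A → A) (l : List A) : Set where
    constructor representatives
    field
      reps         : List A
      reps-unique  : Unique reps
      reps-⊆       : ∀ {x} → x ∈ reps → x ∈ l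
      reps-separate : ∀ {x y} → x ∈ reps → y ∈ reps → y ≡ f x ⊎ y ≡ f (f x) → x ≡ y
      reps-meet    : ∀ {x} → x ∈ l → ∃ λ y → y ∈ reps × (x ≡ y ⊎ x ≡ f y ⊎ x ≡ f (f y))

  open Representatives public

  module OrderThree (_≟_ : (x y : A) → Dec (x ≡ y)) (f : A → A) where

    fixed : List A → ℕ
    fixed l = length (filter (λ x → f x ≟ x) l)

    -- Burnside's count for a group of order three: a free orbit adds 3 to both sides, a fixed point
    -- adds 3 on the left and 1 + 2 on the right.
    OrbitCount : List A → Set
    OrbitCount l = Σ (Representatives f l) λ r → 3 * length (reps r) ≡ length l + 2 * fixed l

    OrbitCount-resp-↭ : ∀ {l l′} → l ↭ l′ → OrbitCount l → OrbitCount l′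
    OrbitCount-resp-↭ p (representatives rs u sub sep meet , eq) =
      representatives rs u (∈-resp-↭ p ∘ sub) sep (meet ∘ ∈-resp-↭ (↭-sym p)) ,
      trans eq (cong₂ (λ x y → x + 2 * y) (↭-length p) (↭-length (filter-↭ _ p)))

    record Closed (l : List A) : Set where
      constructor closed
      field
        distinct : Unique l
        f-∈      : ∀ {x} → x ∈ l → f x ∈ l
        f-cube   : ∀ {x} → x ∈ l → f (f (f x)) ≡ x

    open Closed

    Closed-resp-↭ : ∀ {l l′} → l ↭ l′ → Closed l → Closed l′
    Closed-resp-↭ p (closed u c3 q) = closed (Unique-resp-↭ p u)
      (∈-resp-↭ p ∘ c3 ∘ ∈-resp-↭ (↭-sym p)) (q ∘ ∈-resp-↭ (↭-sym p))

    f-injective : ∀ {l x y} → Closed l → x ∈ l → y ∈ l → f x ≡ f y → x ≡ y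
    f-injective c x∈ y∈ eq = trans (sym (f-cube c x∈)) (trans (cong (f ∘ f) eq) (f-cube c y∈))

    drop-fixed : ∀ {x l} → Closed (x ∷ l) → f x ≡ x → Closed l
    drop-fixed {x} {l} c@(closed u@(_ ∷ u′) _ _) fx = closed u′ step (f-cube c ∘ there)
      where
      step : ∀ {y} → y ∈ l → f y ∈ l
      step y∈ = ∈-tail (λ eq → head∉tail u (subst (_∈ l) (f-injective c (there y∈) (here refl) (trans eq (sym fx))) y∈))
        (f-∈ c (there y∈))

    drop-orbit : ∀ {x l} → Closed (x ∷ f x ∷ f (f x) ∷ l) → Closed l
    drop-orbit {x} {l} c@(closed u@(_ ∷ u₁@(_ ∷ u₂@(_ ∷ u₃))) _ _) = closed u₃ step (f-cube c ∘ th)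
      where
      th : ∀ {y} → y ∈ l → y ∈ x ∷ f x ∷ f (f x) ∷ l
      th = there ∘ there ∘ there
      step : ∀ {y} → y ∈ l → f y ∈ l
      step {y} y∈ = ∈-tail n₂ (∈-tail n₁ (∈-tail n₀ (f-∈ c (th y∈))))
        where
        n₀ : f y ≢ x
        n₀ eq = head∉tail u₂ (subst (_∈ l)
          (f-injective c (th y∈) (there (there (here refl))) (trans eq (sym (f-cube c (here refl))))) y∈)
        n₁ : f y ≢ f x
        n₁ eq = head∉tail u (there (there (subst (_∈ l) (f-injective c (th y∈) (here refl) eq) y∈)))
        n₂ : f y ≢ f (f x)
        n₂ eq = head∉tail u₁ (there (subst (_∈ l) (f-injective c (th y∈) (there (here refl)) eq) y∈))

    add-fixed : ∀ {x l} → Closed (x ∷ l) → f x ≡ x → OrbitCount l → OrbitCount (x ∷ l)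
    add-fixed {x} {l} c@(closed u _ _) fx (representatives rs v sub sep meet , eq) =
      representatives (x ∷ rs) (All.tabulate (λ y∈ x≡y → head∉tail u (subst (_∈ l) (sym x≡y) (sub y∈))) ∷ v)
        sub′ sep′ meet′ , count
      where
      c′ : Closed l
      c′ = drop-fixed c fx
      sub′ : ∀ {y} → y ∈ x ∷ rs → y ∈ x ∷ l
      sub′ (here eq)  = here eq
      sub′ (there y∈) = there (sub y∈)
      absent : ∀ {y} → y ∈ rs → x ≡ f y ⊎ x ≡ f (f y) → ⊥
      absent y∈ (inj₁ e) = head∉tail u (subst (_∈ l) (sym e) (f-∈ c′ (sub y∈)))
      absent y∈ (inj₂ e) = head∉tail u (subst (_∈ l) (sym e) (f-∈ c′ (f-∈ c′ (sub y∈))))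
      sep′ : ∀ {y z} → y ∈ x ∷ rs → z ∈ x ∷ rs → z ≡ f y ⊎ z ≡ f (f y) → y ≡ z
      sep′ (here refl) (here refl) _ = refl
      sep′ (here refl) (there z∈) (inj₁ e) = sym (trans e fx)
      sep′ (here refl) (there z∈) (inj₂ e) = sym (trans e (trans (cong f fx) fx))
      sep′ (there y∈) (here refl) e = ⊥-elim (absent y∈ e)
      sep′ (there y∈) (there z∈) e = sep y∈ z∈ e
      meet′ : ∀ {y} → y ∈ x ∷ l → ∃ λ z → z ∈ x ∷ rs × (y ≡ z ⊎ y ≡ f z ⊎ y ≡ f (f z))
      meet′ (here refl) = x , here refl , inj₁ refl
      meet′ (there y∈) with meet y∈
      ... | z , z∈ , e = z , there z∈ , e
      arith : ∀ a b → 3 + (a + 2 * b) ≡ suc a + 2 * suc b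
      arith = solve-∀
      3*suc : ∀ a → 3 * suc a ≡ 3 + 3 * a
      3*suc = solve-∀
      count : 3 * suc (length rs) ≡ suc (length l) + 2 * fixed (x ∷ l)
      count = trans (3*suc (length rs)) (trans (cong (3 +_) eq)
        (trans (arith (length l) (fixed l))
          (cong (λ k → suc (length l) + 2 * length k) (sym (filter-accept (λ x → f x ≟ x) fx)))))

    add-orbit : ∀ {x l} → Closed (x ∷ f x ∷ f (f x) ∷ l) → OrbitCount l → OrbitCount (x ∷ f x ∷ f (f x) ∷ l)
    add-orbit {x} {l} c@(closed u@(_ ∷ u₁@(_ ∷ u₂)) _ _) (representatives rs v sub sep meet , eq) =
      representatives (x ∷ rs) (All.tabulate (λ y∈ x≡y → x∉ (subst (_∈ l) (sym x≡y) (sub y∈))) ∷ v)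
        sub′ sep′ meet′ , count
      where
      c′ : Closed l
      c′ = drop-orbit c
      x∉ : x ∉ l
      x∉ = head∉tail u ∘ there ∘ there
      sub′ : ∀ {y} → y ∈ x ∷ rs → y ∈ x ∷ f x ∷ f (f x) ∷ l
      sub′ (here eq)  = here eq
      sub′ (there y∈) = there (there (there (sub y∈)))
      absent : ∀ {y} → y ∈ rs → x ≡ f y ⊎ x ≡ f (f y) → ⊥
      absent y∈ (inj₁ e) = x∉ (subst (_∈ l) (sym e) (f-∈ c′ (sub y∈)))
      absent y∈ (inj₂ e) = x∉ (subst (_∈ l) (sym e) (f-∈ c′ (f-∈ c′ (sub y∈))))
      sep′ : ∀ {y z} → y ∈ x ∷ rs → z ∈ x ∷ rs → z ≡ f y ⊎ z ≡ f (f y) → y ≡ z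
      sep′ (here refl) (here refl) _ = refl
      sep′ (here refl) (there z∈) (inj₁ refl) = ⊥-elim (head∉tail u₁ (there (sub z∈)))
      sep′ (here refl) (there z∈) (inj₂ refl) = ⊥-elim (head∉tail u₂ (sub z∈))
      sep′ (there y∈) (here refl) e = ⊥-elim (absent y∈ e)
      sep′ (there y∈) (there z∈) e = sep y∈ z∈ e
      meet′ : ∀ {y} → y ∈ x ∷ f x ∷ f (f x) ∷ l → ∃ λ z → z ∈ x ∷ rs × (y ≡ z ⊎ y ≡ f z ⊎ y ≡ f (f z))
      meet′ (here refl) = x , here refl , inj₁ refl
      meet′ (there (here refl)) = x , here refl , inj₂ (inj₁ refl)
      meet′ (there (there (here refl))) = x , here refl , inj₂ (inj₂ refl)
      meet′ (there (there (there y∈))) with meet y∈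
      ... | z , z∈ , e = z , there z∈ , e
      notFixed : ∀ {y} → y ∈ x ∷ f x ∷ f (f x) ∷ l → y ≡ x ⊎ y ≡ f x ⊎ y ≡ f (f x) → f y ≢ y
      notFixed y∈ (inj₁ refl) e = head∉tail u (here (sym e))
      notFixed y∈ (inj₂ (inj₁ refl)) e = head∉tail u (here (sym (f-injective c y∈ (here refl) e)))
      notFixed y∈ (inj₂ (inj₂ refl)) e =
        head∉tail u (here (sym (f-injective c (there (here refl)) (here refl) (f-injective c y∈ (there (here refl)) e))))
      F? : (y : A) → Dec (f y ≡ y)
      F? y = f y ≟ y
      same : filter F? (x ∷ f x ∷ f (f x) ∷ l) ≡ filter F? l
      same = trans (filter-reject F? (notFixed (here refl) (inj₁ refl)))
            (trans (filter-reject F? (notFixed (there (here refl)) (inj₂ (inj₁ refl))))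
                   (filter-reject F? (notFixed (there (there (here refl))) (inj₂ (inj₂ refl)))))
      3*suc : ∀ a → 3 * suc a ≡ 3 + 3 * a
      3*suc = solve-∀
      count : 3 * suc (length rs) ≡ 3 + length l + 2 * fixed (x ∷ f x ∷ f (f x) ∷ l)
      count = trans (3*suc (length rs)) (trans (cong (3 +_) eq)
        (cong (λ k → 3 + (length l + 2 * length k)) (sym same)))

    orbit-first : ∀ {x l} → Closed (x ∷ l) → f x ≢ x → ∃ λ l′ → x ∷ l ↭ x ∷ f x ∷ f (f x) ∷ l′
    orbit-first {x} {l} c fx≢x = proj₁ second , ↭-prep x (↭-trans (proj₂ first) (↭-prep (f x) (proj₂ second)))
      where
      first : ∃ λ l₁ → l ↭ f x ∷ l₁
      first = extract (∈-tail fx≢x (f-∈ c (here refl)))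
      ffx≢fx : f (f x) ≢ f x
      ffx≢fx e = fx≢x (f-injective c (f-∈ c (here refl)) (here refl) e)
      ffx≢x : f (f x) ≢ x
      ffx≢x e = fx≢x (trans (sym (cong f e)) (f-cube c (here refl)))
      second : ∃ λ l₂ → proj₁ first ↭ f (f x) ∷ l₂
      second = extract (∈-tail ffx≢fx (∈-resp-↭ (proj₂ first) (∈-tail ffx≢x (f-∈ c (f-∈ c (here refl))))))

    -- The recursion runs on `n`, since the list left after an orbit has been permuted to the front
    -- is not a subterm of the original one.
    count-orbits : ∀ n l → length l ≤ n → Closed l → OrbitCount l
    count-orbits n [] _ c = representatives [] [] (λ ()) (λ ()) (λ ()) , refl
    count-orbits (suc n) (x ∷ l) (s≤s len) c = cases (f x ≟ x)
      where
      cases : Dec (f x ≡ x) → OrbitCount (x ∷ l)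
      cases (yes fx)  = add-fixed c fx (count-orbits n l len (drop-fixed c fx))
      cases (no fx≢x) = OrbitCount-resp-↭ (↭-sym p)
        (add-orbit (Closed-resp-↭ p c) (count-orbits n l′ len′ (drop-orbit (Closed-resp-↭ p c))))
        where
        l′ : List A
        l′ = proj₁ (orbit-first c fx≢x)
        p : x ∷ l ↭ x ∷ f x ∷ f (f x) ∷ l′
        p = proj₂ (orbit-first c fx≢x)
        len′ : length l′ ≤ n
        len′ = ≤-trans (m≤n+m (length l′) 2) (≤-trans (≤-reflexive (suc-injective (sym (↭-length p)))) len)

    Card-fixed : ∀ {P : A → Set} {n} (c : Card P n) → Card (λ x → P x × f x ≡ x) (fixed (elements c))
    Card-fixed c = proj₂ (Card-filter (λ x → f x ≟ x) c)

    orbits : ∀ {P : A → Set} {n} (c : Card P n) → (∀ {x} → P x → P (f x)) → (∀ {x} → P x → f (f (f x)) ≡ x) →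
             Σ (Representatives f (elements c)) λ r → 3 * length (reps r) ≡ n + 2 * fixed (elements c)
    orbits c fP f³ with count-orbits _ (elements c) (≤-reflexive refl)
                          (closed (unique c) (complete c ∘ fP ∘ sound c) (f³ ∘ sound c))
    ... | r , eq = r , trans eq (cong (_+ _) (size c))

-- Divisibility, the Chinese remainder theorem, multiplicativity of both counts.

module Arithmetic where

  open Counting
  open import Data.Nat
  open import Data.Nat.Properties
  open import Data.Nat.Divisibility
  open import Data.Nat.DivMod
  open import Data.Nat.GCD using (module Bézout; gcd; gcd[m,n]∣m; gcd[m,n]∣n; gcd[m,n]≢0)
  open import Data.Nat.Coprimality using (Coprime; coprime-divisor; coprime-Bézout; coprime-/gcd)
  import Data.Nat.Coprimality as Coprime
  open import Data.Nat.Primality using (Prime; prime⇒irreducible; prime⇒nonTrivial)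
  open import Data.Nat.Tactic.RingSolver using (solve-∀)
  open import Data.Product using (∃; ∃₂; _×_; _,_)
  open import Data.Sum using (inj₁; inj₂; [_,_]′)
  open import Data.Empty using (⊥-elim)
  open import Relation.Nullary using (¬_)
  open import Relation.Binary.PropositionalEquality

  open ≡-Reasoning

  coprime-∣ : ∀ {m n m′ n′} → m′ ∣ m → n′ ∣ n → Coprime m n → Coprime m′ n′
  coprime-∣ m′∣m n′∣n c (d∣m′ , d∣n′) = c (∣-trans d∣m′ m′∣m , ∣-trans d∣n′ n′∣n)

  coprime-* : ∀ {m n k} → Coprime m k → Coprime n k → Coprime (m * n) k
  coprime-* {m} cm cn {d} (d∣mn , d∣k) =
    cn (coprime-divisor {m = d} {n = m} (λ (x∣d , x∣m) → cm (x∣m , ∣-trans x∣d d∣k)) d∣mn , d∣k)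

  coprime-^ : ∀ {m k} → Coprime m k → ∀ i → Coprime (m ^ i) k
  coprime-^ {k = k} c zero    = Coprime.1-coprimeTo k
  coprime-^         c (suc i) = coprime-* c (coprime-^ c i)

  coprime-*-∣ : ∀ {m n k} → Coprime m n → m ∣ k → n ∣ k → m * n ∣ k
  coprime-*-∣ {m} {n} c (divides-refl q) n∣k =
    subst (_∣ q * m) (*-comm n m) (*-monoˡ-∣ m (coprime-divisor (Coprime.sym c) (subst (n ∣_) (*-comm q m) n∣k)))

  prime-∤⇒coprime : ∀ {p a} → Prime p → ¬ p ∣ a → Coprime p a
  prime-∤⇒coprime pr p∤a (d∣p , d∣a) with prime⇒irreducible pr d∣p
  ... | inj₁ d≡1 = d≡1
  ... | inj₂ refl = ⊥-elim (p∤a d∣a)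

  prime-∤1 : ∀ {p} → Prime p → ¬ p ∣ 1
  prime-∤1 pr p∣1 = nonTrivial⇒≢1 {{prime⇒nonTrivial pr}} (∣1⇒≡1 p∣1)

  -- Take `x₁ = gcd x M`: the cofactor `x / x₁` divides `(M / x₁) * N` and is coprime to `M / x₁`,
  -- so it divides `N`.
  coprime-split : ∀ {M N x} .{{_ : NonZero M}} → Coprime M N → x ∣ M * N →
                  ∃₂ λ x₁ x₂ → x ≡ x₁ * x₂ × x₁ ∣ M × x₂ ∣ N
  coprime-split {M} {N} {x} c x∣MN = gcd x M , x / gcd x M , sym eqx , gcd[m,n]∣n x M , ∣N
    where
    instance
      g≢0 : NonZero (gcd x M)
      g≢0 = ≢-nonZero (gcd[m,n]≢0 x M (inj₂ (≢-nonZero⁻¹ M)))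
    eqx : gcd x M * (x / gcd x M) ≡ x
    eqx = m*[n/m]≡n (gcd[m,n]∣m x M)
    eqM : gcd x M * (M / gcd x M) ≡ M
    eqM = m*[n/m]≡n (gcd[m,n]∣n x M)
    ∣N : x / gcd x M ∣ N
    ∣N = coprime-divisor (coprime-/gcd x M) (*-cancelˡ-∣ (gcd x M)
      (subst₂ _∣_ (sym eqx) (trans (cong (_* N) (sym eqM)) (*-assoc (gcd x M) _ N)) x∣MN))

  coprime-split-unique : ∀ {M N x₁ x₂ y₁ y₂} → Coprime M N →
    x₁ ∣ M → y₁ ∣ M → x₂ ∣ N → y₂ ∣ N → x₁ * x₂ ≡ y₁ * y₂ → x₁ ≡ y₁ × x₂ ≡ y₂
  coprime-split-unique {M} {N} {x₁} {x₂} {y₁} {y₂} c x₁∣ y₁∣ x₂∣ y₂∣ eq =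
    ∣-antisym (first {b = x₂} x₁∣ y₂∣ eq) (first {b = y₂} y₁∣ x₂∣ (sym eq)) ,
    ∣-antisym (second {a = x₁} x₂∣ y₁∣ eq) (second {a = y₁} y₂∣ x₁∣ (sym eq))
    where
    first : ∀ {a b c d} → a ∣ M → d ∣ N → a * b ≡ c * d → a ∣ c
    first {a} {b} {c′} {d} a∣ d∣ e =
      coprime-divisor {n = d} (coprime-∣ a∣ d∣ c) (subst (a ∣_) (trans e (*-comm c′ d)) (m∣m*n b))
    second : ∀ {a b c d} → b ∣ N → c ∣ M → a * b ≡ c * d → b ∣ d
    second {a} {b} {c′} {d} b∣ c∣ e =
      coprime-divisor {n = c′} (Coprime.sym (coprime-∣ c∣ b∣ c)) (subst (b ∣_) e (n∣m*n a))

  linear-congruence : ∀ {p a} .{{_ : NonZero p}} → Coprime p a → ∀ t → ∃ λ s → p ∣ a * s + t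
  linear-congruence {suc p} {a} c t with coprime-Bézout c
  ... | Bézout.+- x y eq = y * t , divides (x * t) (trans (e₁ a y t) (trans (cong (_* t) eq) (e₂ x p t)))
    where
    e₁ : ∀ a y t → a * (y * t) + t ≡ (1 + y * a) * t
    e₁ = solve-∀
    e₂ : ∀ x p t → x * suc p * t ≡ x * t * suc p
    e₂ = solve-∀
  -- Here `y` inverts `a`, and `p` stands for -1 modulo `suc p`, so the witness is the negative of
  -- `y * t` without subtraction.
  ... | Bézout.-+ x y eq = y * (t * p) , divides (x * (t * p) + t)
        (trans (e₁ a y t p) (trans (cong (λ z → z * (t * p) + t) (sym eq)) (e₂ x p t)))
    where
    e₁ : ∀ a y t p → a * (y * (t * p)) + t ≡ y * a * (t * p) + t
    e₁ = solve-∀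
    e₂ : ∀ x p t → (1 + x * suc p) * (t * p) + t ≡ (x * (t * p) + t) * suc p
    e₂ = solve-∀

  residue-unique : ∀ {e i j k l} → i < e → j < e → i + k * e ≡ j + l * e → i ≡ j
  residue-unique {e@(suc _)} {i} {j} {k} {l} i<e j<e eq = begin
    i               ≡⟨ m<n⇒m%n≡m i<e ⟨
    i % e           ≡⟨ [m+kn]%n≡m%n i k e ⟨
    (i + k * e) % e ≡⟨ cong (_% e) eq ⟩
    (j + l * e) % e ≡⟨ [m+kn]%n≡m%n j l e ⟩
    j % e           ≡⟨ m<n⇒m%n≡m j<e ⟩
    j               ∎

  Residue : ℕ → ℕ → ℕ → Set
  Residue e r b = ∃ λ k → b ≡ r + k * e

  Residue-% : ∀ b e .{{_ : NonZero e}} → Residue e (b % e) b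
  Residue-% b e = b / e , m≡m%n+[m/n]*n b e

  Residue⇒∣ : ∀ {e r b t} → Residue e r b → Residue e r (b + t) → e ∣ t
  Residue⇒∣ {e} {r} {b} {t} (k , refl) (l , eq) = ∣m+n∣m⇒∣n
    (divides l (+-cancelˡ-≡ r _ _ (trans (sym (+-assoc r (k * e) t)) eq))) (n∣m*n k)

  -- The difference of the two numbers is divisible by both moduli, hence by their product, and is
  -- smaller than it.
  crt-unique : ∀ {e₁ e₂ r₁ r₂ b b′} → Coprime e₁ e₂ → b < e₁ * e₂ → b′ < e₁ * e₂ →
    Residue e₁ r₁ b → Residue e₁ r₁ b′ → Residue e₂ r₂ b → Residue e₂ r₂ b′ → b ≡ b′
  crt-unique {e₁} {e₂} {r₁} {r₂} {b} {b′} c b< b′< p p′ q q′ =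
    [ (λ b≤b′ → ordered b≤b′ b′< p p′ q q′) , (λ b′≤b → sym (ordered b′≤b b< p′ p q′ q)) ]′ (≤-total b b′)
    where
    ordered : ∀ {b b′} → b ≤ b′ → b′ < e₁ * e₂ → Residue e₁ r₁ b → Residue e₁ r₁ b′ →
              Residue e₂ r₂ b → Residue e₂ r₂ b′ → b ≡ b′
    ordered {b} b≤b′ b′< p p′ q q′ with m≤n⇒∃[o]m+o≡n b≤b′
    ... | zero , refl = sym (+-identityʳ b)
    ... | t@(suc _) , refl = ⊥-elim (<⇒≱ (≤-<-trans (m≤n+m t b) b′<)
            (∣⇒≤ (coprime-*-∣ c (Residue⇒∣ p p′) (Residue⇒∣ q q′))))

  crt : ∀ {e₁ e₂} .{{_ : NonZero e₁}} .{{_ : NonZero e₂}} → Coprime e₁ e₂ → ∀ r₁ r₂ → r₁ < e₁ → r₂ < e₂ →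
    ∃ λ b → b < e₁ * e₂ × Residue e₁ r₁ b × Residue e₂ r₂ b
  -- Since `e` is -1 modulo `e₂`, the congruence solved here says that `r₁ + k * e₁` is `r₂` modulo
  -- `e₂`.
  crt {e₁} {e₂@(suc e)} c r₁ r₂ r₁< r₂< with linear-congruence (Coprime.sym c) (r₁ + e * r₂)
  ... | k , divides j eq = x % (e₁ * e₂) , m%n<n x (e₁ * e₂) ,
        subst (λ r → Residue e₁ r (x % (e₁ * e₂))) mod₁ (Residue-% _ e₁) ,
        subst (λ r → Residue e₂ r (x % (e₁ * e₂))) mod₂ (Residue-% _ e₂)
    where
    instance
      e₁e₂≢0 : NonZero (e₁ * e₂)
      e₁e₂≢0 = m*n≢0 e₁ e₂
    x : ℕ
    x = r₁ + k * e₁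
    mod₁ : x % (e₁ * e₂) % e₁ ≡ r₁
    mod₁ = trans (m∣n⇒o%n%m≡o%m e₁ (e₁ * e₂) x (m∣m*n e₂)) (trans ([m+kn]%n≡m%n r₁ k e₁) (m<n⇒m%n≡m r₁<))
    rearrange : ∀ r₁ k e₁ r₂ e → r₁ + k * e₁ + r₂ * suc e ≡ r₂ + (e₁ * k + (r₁ + e * r₂))
    rearrange = solve-∀
    mod₂ : x % (e₁ * e₂) % e₂ ≡ r₂
    mod₂ = begin
      x % (e₁ * e₂) % e₂                       ≡⟨ m∣n⇒o%n%m≡o%m e₂ (e₁ * e₂) x (n∣m*n e₁) ⟩
      x % e₂                                   ≡⟨ [m+kn]%n≡m%n x r₂ e₂ ⟨
      (x + r₂ * e₂) % e₂                       ≡⟨ cong (_% e₂) (rearrange r₁ k e₁ r₂ e) ⟩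
      (r₂ + (e₁ * k + (r₁ + e * r₂))) % e₂     ≡⟨ cong (λ z → (r₂ + z) % e₂) eq ⟩
      (r₂ + j * e₂) % e₂                       ≡⟨ [m+kn]%n≡m%n r₂ j e₂ ⟩
      r₂ % e₂                                  ≡⟨ m<n⇒m%n≡m r₂< ⟩
      r₂                                       ∎

  factor-nonZeroˡ : ∀ a {d n} .{{_ : NonZero n}} → a * d ≡ n → NonZero a
  factor-nonZeroˡ a refl = m*n≢0⇒m≢0 a

  factor-nonZeroʳ : ∀ a {d n} .{{_ : NonZero n}} → a * d ≡ n → NonZero d
  factor-nonZeroʳ a refl = m*n≢0⇒n≢0 a

  -- Hermite normal forms (a , d , b), standing for the lattice spanned by
  -- (d , 0) and (b , a), of index n in ℤ².
  Sub : ℕ → ℕ × ℕ × ℕ → Set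
  Sub n (a , d , b) = a * d ≡ n × b < d

  -- Only `b < d` is asked of `b`, so the mixed-radix expansion `b₁ + b₂ * d₁` can pair the
  -- residues; no congruence has to be respected.
  Sub-* : ∀ {M N x y} .{{_ : NonZero M}} .{{_ : NonZero N}} → Coprime M N →
          Card (Sub M) x → Card (Sub N) y → Card (Sub (M * N)) (x * y)
  Sub-* {M} {N} coprime cM cN = Card-bij R to from functional injective (Card-× cM cN)
    where
    Triple : Set
    Triple = ℕ × ℕ × ℕ
    Pair : Triple × Triple → Set
    Pair (s , t) = Sub M s × Sub N t
    R : Triple × Triple → Triple → Set
    R ((a₁ , d₁ , b₁) , (a₂ , d₂ , b₂)) (a , d , b) = a ≡ a₁ * a₂ × d ≡ d₁ * d₂ × b ≡ b₁ + b₂ * d₁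
    swap4 : ∀ a b c d → a * b * (c * d) ≡ a * c * (b * d)
    swap4 = solve-∀
    to : ∀ x → Pair x → ∃ λ y → Sub (M * N) y × R x y
    to ((a₁ , d₁ , b₁) , (a₂ , d₂ , b₂)) ((refl , b₁<) , (refl , b₂<)) =
      (a₁ * a₂ , d₁ * d₂ , b₁ + b₂ * d₁) , (swap4 a₁ a₂ d₁ d₂ , small) , refl , refl , refl
      where
      small : b₁ + b₂ * d₁ < d₁ * d₂
      small = <-≤-trans (+-monoˡ-< (b₂ * d₁) b₁<) (≤-trans (*-monoˡ-≤ d₁ b₂<) (≤-reflexive (*-comm d₂ d₁)))
    from : ∀ y → Sub (M * N) y → ∃ λ x → Pair x × R x y
    from (a , d , b) (ad≡ , b<) with coprime-split {M} {N} {a} coprime (subst (a ∣_) ad≡ (m∣m*n d))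
    ... | a₁ , a₂ , refl , divides d₁ eqM , divides d₂ eqN =
        ((a₁ , d₁ , b % d₁) , (a₂ , d₂ , b / d₁)) ,
        (((trans (*-comm a₁ d₁) (sym eqM) , m%n<n b d₁) ,
         (trans (*-comm a₂ d₂) (sym eqN) , m<n*o⇒m/o<n (subst (b <_) (trans d≡ (*-comm d₁ d₂)) b<))) ,
        refl , d≡ , m≡m%n+[m/n]*n b d₁)
      where
      instance
        d₁≢0 : NonZero d₁
        d₁≢0 = factor-nonZeroˡ d₁ (sym eqM)
        a≢0 : NonZero (a₁ * a₂)
        a≢0 = m*n≢0 a₁ a₂ {{factor-nonZeroʳ d₁ (sym eqM)}} {{factor-nonZeroʳ d₂ (sym eqN)}}
      shuffle : ∀ a b c d → c * a * (d * b) ≡ a * b * (c * d)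
      shuffle = solve-∀
      d≡ : d ≡ d₁ * d₂
      d≡ = *-cancelˡ-≡ d (d₁ * d₂) (a₁ * a₂) (trans ad≡ (trans (cong₂ _*_ eqM eqN) (shuffle a₁ a₂ d₁ d₂)))
    functional : ∀ x y y′ → Pair x → Sub (M * N) y → Sub (M * N) y′ → R x y → R x y′ → y ≡ y′
    functional _ _ _ _ _ _ (refl , refl , refl) (refl , refl , refl) = refl
    injective : ∀ x x′ y → Pair x → Pair x′ → Sub (M * N) y → R x y → R x′ y → x ≡ x′
    injective ((a₁ , d₁ , b₁) , (a₂ , d₂ , b₂)) ((a₁′ , d₁′ , b₁′) , (a₂′ , d₂′ , b₂′)) _
              ((e₁ , b₁<) , (e₂ , _)) ((e₁′ , b₁′<) , (e₂′ , _)) _ (refl , refl , refl) (ea , ed , eb)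
      with coprime-split-unique coprime (subst (a₁ ∣_) e₁ (m∣m*n d₁)) (subst (a₁′ ∣_) e₁′ (m∣m*n d₁′))
             (subst (a₂ ∣_) e₂ (m∣m*n d₂)) (subst (a₂′ ∣_) e₂′ (m∣m*n d₂′)) ea
         | coprime-split-unique coprime (subst (d₁ ∣_) e₁ (n∣m*n a₁)) (subst (d₁′ ∣_) e₁′ (n∣m*n a₁′))
             (subst (d₂ ∣_) e₂ (n∣m*n a₂)) (subst (d₂′ ∣_) e₂′ (n∣m*n a₂′)) ed
    ... | refl , refl | refl , refl with residue-unique {k = b₂} {l = b₂′} b₁< b₁′< eb
    ... | refl with *-cancelʳ-≡ b₂ b₂′ d₁ {{factor-nonZeroʳ a₁ e₁}} (+-cancelˡ-≡ b₁ _ _ eb)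
    ... | refl = refl

  -- The norm of `b + ζ`, since ζ and its conjugate have sum 1 and product 1.
  poly : ℕ → ℕ
  poly b = b * b + b + 1

  Root : ℕ → ℕ → Set
  Root e b = b < e × e ∣ poly b

  -- (c , e , b) stands for the lattice c ⟨e , ζ + b⟩ of ℤ[ζ]; it is closed under
  -- multiplication by ζ because e divides poly b.
  Inv : ℕ → ℕ × ℕ × ℕ → Set
  Inv n (c , e , b) = c * c * e ≡ n × Root e b

  poly-Residue : ∀ {e r b} → Residue e r b → ∃ λ t → poly b ≡ poly r + t * e
  poly-Residue {e} {r} (k , refl) = 2 * r * k + k * k * e + k , expand r k e
    where
    expand : ∀ r k e → (r + k * e) * (r + k * e) + (r + k * e) + 1
                     ≡ r * r + r + 1 + (2 * r * k + k * k * e + k) * e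
    expand = solve-∀

  poly-Residue⁻ : ∀ {e r b} → Residue e r b → e ∣ poly b → e ∣ poly r
  poly-Residue⁻ {e} {r} {b} res e∣ with poly-Residue res
  ... | t , eq = ∣m+n∣m⇒∣n (subst (e ∣_) (trans eq (+-comm (poly r) (t * e))) e∣) (n∣m*n t)

  poly-Residue⁺ : ∀ {e r b} → Residue e r b → e ∣ poly r → e ∣ poly b
  poly-Residue⁺ {e} {r} {b} res e∣ with poly-Residue res
  ... | t , eq = subst (e ∣_) (sym eq) (∣m∣n⇒∣m+n e∣ (n∣m*n t))

  Root-% : ∀ {e b} .{{_ : NonZero e}} → e ∣ poly b → Root e (b % e)
  Root-% {e} {b} e∣ = m%n<n b e , poly-Residue⁻ (Residue-% b e) e∣

  -- Unlike in `Sub-*`, `b` is tied to a polynomial congruence, which reduction modulo `e₁` and `e₂`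
  -- respects; hence the Chinese remainder theorem in place of mixed radix.
  Inv-* : ∀ {M N x y} .{{_ : NonZero M}} .{{_ : NonZero N}} → Coprime M N →
          Card (Inv M) x → Card (Inv N) y → Card (Inv (M * N)) (x * y)
  Inv-* {M} {N} coprime cM cN = Card-bij R to from functional injective (Card-× cM cN)
    where
    Triple : Set
    Triple = ℕ × ℕ × ℕ
    Pair : Triple × Triple → Set
    Pair (s , t) = Inv M s × Inv N t
    R : Triple × Triple → Triple → Set
    R ((c₁ , e₁ , b₁) , (c₂ , e₂ , b₂)) (c , e , b) = c ≡ c₁ * c₂ × e ≡ e₁ * e₂ × Residue e₁ b₁ b × Residue e₂ b₂ b
    swap6 : ∀ a b c d → a * b * (a * b) * (c * d) ≡ a * a * c * (b * b * d)
    swap6 = solve-∀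
    c∣ : ∀ {n} c e → c * c * e ≡ n → c ∣ n
    c∣ c e refl = ∣m⇒∣m*n e (m∣m*n c)
    e∣ : ∀ {n} c e → c * c * e ≡ n → e ∣ n
    e∣ c e refl = n∣m*n (c * c)
    to : ∀ x → Pair x → ∃ λ y → Inv (M * N) y × R x y
    to ((c₁ , e₁ , b₁) , (c₂ , e₂ , b₂)) ((eqM , b₁< , r₁) , (eqN , b₂< , r₂))
      with crt {{factor-nonZeroʳ (c₁ * c₁) eqM}} {{factor-nonZeroʳ (c₂ * c₂) eqN}}
               (coprime-∣ (e∣ c₁ e₁ eqM) (e∣ c₂ e₂ eqN) coprime) b₁ b₂ b₁< b₂<
    ... | b , b< , res₁ , res₂ = (c₁ * c₂ , e₁ * e₂ , b) ,
          (trans (swap6 c₁ c₂ e₁ e₂) (cong₂ _*_ eqM eqN) , b< ,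
           coprime-*-∣ (coprime-∣ (e∣ c₁ e₁ eqM) (e∣ c₂ e₂ eqN) coprime)
             (poly-Residue⁺ res₁ r₁) (poly-Residue⁺ res₂ r₂)) ,
          refl , refl , res₁ , res₂
    from : ∀ y → Inv (M * N) y → ∃ λ x → Pair x × R x y
    from (c , e , b) (eq , b< , root) with coprime-split {M} {N} {c} coprime (c∣ c e eq)
    ... | c₁ , c₂ , refl , c₁∣M , c₂∣N = assemble squares
      where
      -- To define `e₁` and `e₂`, the squares must divide: `c₁ * c₁` divides `M * N` and is coprime
      -- to `N`, and likewise for `c₂`.
      squares : c₁ * c₁ ∣ M × c₂ * c₂ ∣ N
      squares =
        coprime-divisor (coprime-* cop₁ cop₁)
          (subst (c₁ * c₁ ∣_) (trans eq (*-comm M N)) (divides (c₂ * c₂ * e) (pull₁ c₁ c₂ e))) ,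
        coprime-divisor (coprime-* (Coprime.sym cop₂) (Coprime.sym cop₂))
          (subst (c₂ * c₂ ∣_) eq (divides (c₁ * c₁ * e) (pull₂ c₁ c₂ e)))
        where
        cop₁ : Coprime c₁ N
        cop₁ = coprime-∣ c₁∣M ∣-refl coprime
        cop₂ : Coprime M c₂
        cop₂ = coprime-∣ ∣-refl c₂∣N coprime
        pull₁ : ∀ c₁ c₂ e → c₁ * c₂ * (c₁ * c₂) * e ≡ c₂ * c₂ * e * (c₁ * c₁)
        pull₁ = solve-∀
        pull₂ : ∀ c₁ c₂ e → c₁ * c₂ * (c₁ * c₂) * e ≡ c₁ * c₁ * e * (c₂ * c₂)
        pull₂ = solve-∀
      assemble : c₁ * c₁ ∣ M × c₂ * c₂ ∣ N → ∃ λ x → Pair x × R x (c₁ * c₂ , e , b)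
      assemble (divides e₁ eqM , divides e₂ eqN) =
        ((c₁ , e₁ , b % e₁) , (c₂ , e₂ , b % e₂)) ,
        ((trans (*-comm (c₁ * c₁) e₁) (sym eqM) , Root-% (∣-trans (subst (e₁ ∣_) (sym e≡) (m∣m*n e₂)) root)) ,
         (trans (*-comm (c₂ * c₂) e₂) (sym eqN) , Root-% (∣-trans (subst (e₂ ∣_) (sym e≡) (n∣m*n e₁)) root))) ,
        refl , e≡ , Residue-% b e₁ , Residue-% b e₂
        where
        instance
          e₁≢0 : NonZero e₁
          e₁≢0 = factor-nonZeroˡ e₁ (sym eqM)
          e₂≢0 : NonZero e₂
          e₂≢0 = factor-nonZeroˡ e₂ (sym eqN)
          cc≢0 : NonZero (c₁ * c₁ * (c₂ * c₂))
          cc≢0 = m*n≢0 (c₁ * c₁) (c₂ * c₂) {{factor-nonZeroʳ e₁ (sym eqM)}} {{factor-nonZeroʳ e₂ (sym eqN)}}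
        left : ∀ c₁ c₂ e → c₁ * c₁ * (c₂ * c₂) * e ≡ c₁ * c₂ * (c₁ * c₂) * e
        left = solve-∀
        right : ∀ c₁ c₂ e₁ e₂ → e₁ * (c₁ * c₁) * (e₂ * (c₂ * c₂)) ≡ c₁ * c₁ * (c₂ * c₂) * (e₁ * e₂)
        right = solve-∀
        e≡ : e ≡ e₁ * e₂
        e≡ = *-cancelˡ-≡ e (e₁ * e₂) (c₁ * c₁ * (c₂ * c₂))
          (trans (left c₁ c₂ e) (trans eq (trans (cong₂ _*_ eqM eqN) (right c₁ c₂ e₁ e₂))))
    functional : ∀ x y y′ → Pair x → Inv (M * N) y → Inv (M * N) y′ → R x y → R x y′ → y ≡ y′
    functional ((c₁ , e₁ , b₁) , (c₂ , e₂ , b₂)) _ _ ((eqM , _) , (eqN , _)) (_ , b< , _) (_ , b′< , _)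
      (refl , refl , p , q) (refl , refl , p′ , q′) =
      cong (λ b → _ , _ , b) (crt-unique (coprime-∣ (e∣ c₁ e₁ eqM) (e∣ c₂ e₂ eqN) coprime) b< b′< p p′ q q′)
    injective : ∀ x x′ y → Pair x → Pair x′ → Inv (M * N) y → R x y → R x′ y → x ≡ x′
    injective ((c₁ , e₁ , b₁) , (c₂ , e₂ , b₂)) ((c₁′ , e₁′ , b₁′) , (c₂′ , e₂′ , b₂′)) _
              ((q₁ , b₁< , _) , (q₂ , b₂< , _)) ((q₁′ , b₁′< , _) , (q₂′ , b₂′< , _)) _
              (refl , refl , (k₁ , s₁) , (k₂ , s₂)) (ec , ee , (l₁ , s₁′) , (l₂ , s₂′))
      with coprime-split-unique coprime (c∣ c₁ e₁ q₁) (c∣ c₁′ e₁′ q₁′) (c∣ c₂ e₂ q₂) (c∣ c₂′ e₂′ q₂′) ec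
         | coprime-split-unique coprime (e∣ c₁ e₁ q₁) (e∣ c₁′ e₁′ q₁′) (e∣ c₂ e₂ q₂) (e∣ c₂′ e₂′ q₂′) ee
    ... | refl , refl | refl , refl
      with residue-unique {k = k₁} {l = l₁} b₁< b₁′< (trans (sym s₁) s₁′)
         | residue-unique {k = k₂} {l = l₂} b₂< b₂′< (trans (sym s₂) s₂′)
    ... | refl | refl = refl

-- Both counts at prime powers.

module PrimePowerCounts where

  open import Defs
  open Counting
  open Arithmetic
  open import Data.Nat
  open import Data.Nat.Properties
  open import Data.Nat.Divisibility
  open import Data.Nat.DivMod
  open import Data.Nat.Coprimality using (Coprime; coprime-divisor)
  import Data.Nat.Coprimality as Coprime
  open import Data.Nat.Primality using (Prime; prime?; prime⇒irreducible; prime⇒nonZero; prime⇒nonTrivial; euclidsLemma)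
  open import Data.Nat.Tactic.RingSolver using (solve-∀)
  open import Data.List using ([]; _∷_; length)
  open import Data.List.Membership.Propositional using (_∈_)
  open import Data.List.Relation.Unary.All as All using ([]; _∷_)
  open import Data.List.Relation.Unary.Any using (here; there)
  open import Data.List.Relation.Unary.AllPairs using ([]; _∷_)
  open import Data.Product using (∃; ∃₂; _×_; _,_; proj₁; proj₂)
  open import Data.Sum using (_⊎_; inj₁; inj₂; [_,_]′)
  open import Data.Empty using (⊥; ⊥-elim)
  open import Relation.Nullary using (¬_; Dec; yes; no)
  open import Relation.Nullary.Decidable using (toWitness)
  open import Relation.Binary.PropositionalEquality

  prime-power-∤ : ∀ {p a d} → Prime p → ∀ k → a * d ≡ p ^ k → ¬ p ∣ a → a ≡ 1
  prime-power-∤ {a = a} {d} pr k eq p∤a =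
    Coprime.sym (coprime-^ (prime-∤⇒coprime pr p∤a) k) (∣-refl , subst (a ∣_) eq (m∣m*n d))

  -- The sum of the powers of `p` up to the exponent `k`, in the recursive form in which normal
  -- forms get counted; `geomQ` is its closed form.
  geometric : ℕ → ℕ → ℕ
  geometric p zero    = 1
  geometric p (suc k) = geometric p k + p ^ suc k

  geomQ≡geometric : ∀ {p} → 2 ≤ p → ∀ k → geomQ p k ≡ geometric p k
  geomQ≡geometric {suc (suc p)} (s≤s (s≤s _)) k =
    trans (cong (λ z → (z ∸ 1) / suc p) (sym (sum k))) (m*n/n≡m (geometric (2 + p) k) (suc p))
    where
    step : ∀ g x y → 1 + (g + x) * suc y ≡ (1 + g * suc y) + x * suc y
    step = solve-∀
    last : ∀ x y → x + x * suc y ≡ (2 + y) * x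
    last = solve-∀
    sum : ∀ k → 1 + geometric (2 + p) k * suc p ≡ (2 + p) ^ suc k
    sum zero    = trans (cong (λ z → suc (suc z)) (+-identityʳ p)) (sym (*-identityʳ (2 + p)))
    sum (suc k) = trans (step (geometric (2 + p) k) ((2 + p) ^ suc k) p)
      (trans (cong (_+ (2 + p) ^ suc k * suc p) (sum k)) (last ((2 + p) ^ suc k) p))

  -- If `p` divides `a`, dividing it out leaves a normal form for the exponent `k`. Otherwise
  -- `a = 1`, `d` is the full power and `b` is free below it, which contributes the new term.
  Card-Sub-power : ∀ {p} → Prime p → ∀ k → Card (Sub (p ^ k)) (geometric p k)
  Card-Sub-power {p} pr zero = Card-⇔ to from (Card-singleton (1 , 1 , 0))
    where
    to : ∀ {x} → x ≡ (1 , 1 , 0) → Sub 1 x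
    to refl = refl , s≤s z≤n
    from : ∀ {x} → Sub 1 x → x ≡ (1 , 1 , 0)
    from {a , d , b} (eq , b<) with m*n≡1⇒m≡1 a d eq | m*n≡1⇒n≡1 a d eq
    from {a , d , zero} (eq , b<) | refl | refl = refl
    from {a , d , suc b} (eq , s≤s ()) | refl | refl
  Card-Sub-power {p} pr (suc k) = Card-⇔ to from (Card-⊎ disjoint scaled top)
    where
    instance
      p≢0 : NonZero p
      p≢0 = prime⇒nonZero pr
    Scaled Top : ℕ × ℕ × ℕ → Set
    Scaled (a , d , b) = Sub (p ^ suc k) (a , d , b) × p ∣ a
    Top (a , d , b) = a ≡ 1 × d ≡ p ^ suc k × b < p ^ suc k
    scaled : Card Scaled (geometric p k)
    scaled = Card-bij (λ (a , d , b) (a′ , d′ , b′) → a′ ≡ p * a × d′ ≡ d × b′ ≡ b)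
      (λ (a , d , b) (eq , b<) → (p * a , d , b) ,
         ((trans (*-assoc p a d) (cong (p *_) eq) , b<) , m∣m*n a) , refl , refl , refl)
      (λ { (a , d , b) ((eq , b<) , divides q refl) → (q , d , b) ,
         (*-cancelˡ-≡ (q * d) (p ^ k) p (trans (sym (*-assoc p q d)) (trans (cong (_* d) (*-comm p q)) eq)) , b<) ,
         *-comm q p , refl , refl })
      (λ { _ _ _ _ _ _ (refl , refl , refl) (refl , refl , refl) → refl })
      (λ { (a , _) (a′ , _) _ _ _ _ (refl , refl , refl) (e , refl , refl) →
           cong (_, _) (*-cancelˡ-≡ a a′ p e) })
      (Card-Sub-power pr k)
    top : Card Top (p ^ suc k)
    top = Card-bij (λ b x → x ≡ (1 , p ^ suc k , b))
      (λ b b< → _ , (refl , refl , b<) , refl)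
      (λ { (_ , _ , b) (refl , refl , b<) → b , b< , refl })
      (λ { _ _ _ _ _ _ refl refl → refl }) (λ { _ _ _ _ _ _ refl refl → refl }) (Card-< (p ^ suc k))
    disjoint : ∀ {x} → Scaled x → Top x → ⊥
    disjoint (_ , p∣a) (refl , _) = prime-∤1 pr p∣a
    to : ∀ {x} → Scaled x ⊎ Top x → Sub (p ^ suc k) x
    to (inj₁ (s , _)) = s
    to (inj₂ (refl , refl , b<)) = *-identityˡ _ , b<
    from : ∀ {x} → Sub (p ^ suc k) x → Scaled x ⊎ Top x
    from {a , d , b} s@(eq , b<) with p ∣? a
    ... | yes p∣a = inj₁ (s , p∣a)
    ... | no p∤a with prime-power-∤ {d = d} pr (suc k) eq p∤a
    ... | refl with trans (sym (*-identityˡ d)) eq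
    ... | refl = inj₂ (refl , refl , b<)

  -- The primitive ideals of norm `e`: those that are not a proper integer multiple of another
  -- ideal.
  Unit : ℕ → ℕ × ℕ × ℕ → Set
  Unit e (c , e′ , b) = c ≡ 1 × e′ ≡ e × Root e b

  Card-Unit : ∀ {e ρ} → Card (Root e) ρ → Card (Unit e) ρ
  Card-Unit {e} = Card-bij (λ b x → x ≡ (1 , e , b))
    (λ b r → _ , (refl , refl , r) , refl)
    (λ { (_ , _ , b) (refl , refl , r) → b , r , refl })
    (λ { _ _ _ _ _ _ refl refl → refl }) (λ { _ _ _ _ _ _ refl refl → refl })

  Unit⇒Inv : ∀ {e x} → Unit e x → Inv e x
  Unit⇒Inv (refl , refl , r) = *-identityˡ _ , r

  Inv-∤⇒Unit : ∀ {p k c e b} → Prime p → Inv (p ^ k) (c , e , b) → ¬ p ∣ c → Unit (p ^ k) (c , e , b)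
  Inv-∤⇒Unit {p} {k} {c} {e} pr (eq , r) p∤c with prime-power-∤ {d = c * e} pr k (trans (sym (*-assoc c c e)) eq) p∤c
  ... | refl with trans (sym (*-identityˡ e)) eq
  ... | refl = refl , refl , r

  Card-Root-1 : Card (Root 1) 1
  Card-Root-1 = Card-⇔ (λ { refl → s≤s z≤n , ∣-refl }) (λ { {zero} _ → refl ; {suc b} (s≤s () , _) }) (Card-singleton 0)

  Card-Inv-power₀ : ∀ {p} → Prime p → Card (Inv (p ^ 0)) 1
  Card-Inv-power₀ {p} pr = Card-⇔ Unit⇒Inv from (Card-Unit Card-Root-1)
    where
    from : ∀ {x} → Inv 1 x → Unit 1 x
    from {c , e , b} i@(eq , r) = Inv-∤⇒Unit {k = 0} pr i
      (λ p∣c → prime-∤1 pr (subst (p ∣_) eq (∣m⇒∣m*n e (∣m⇒∣m*n c p∣c))))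

  Card-Inv-power₁ : ∀ {p ρ} → Prime p → Card (Root (p ^ 1)) ρ → Card (Inv (p ^ 1)) ρ
  Card-Inv-power₁ {p} pr roots = Card-⇔ Unit⇒Inv from (Card-Unit roots)
    where
    instance
      p≢0 : NonZero p
      p≢0 = prime⇒nonZero pr
    from : ∀ {x} → Inv (p ^ 1) x → Unit (p ^ 1) x
    from {c , e , b} i@(eq , r) = Inv-∤⇒Unit {k = 1} pr i
      (λ p∣c → prime-∤1 pr (*-cancelˡ-∣ p (subst (p * p ∣_) eq (∣m⇒∣m*n e (*-pres-∣ p∣c p∣c)))))

  -- Dividing `c` by `p` divides the index by `p * p`, so the exponent drops by two. What remains is
  -- primitive and corresponds to the roots modulo `p ^ (2 + k)`.
  Card-Inv-step : ∀ {p k ρ f} → Prime p → Card (Root (p ^ (2 + k))) ρ → Card (Inv (p ^ k)) f →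
                  Card (Inv (p ^ (2 + k))) (f + ρ)
  Card-Inv-step {p} {k} pr roots invs = Card-⇔ to from (Card-⊎ disjoint scaled (Card-Unit roots))
    where
    instance
      p≢0 : NonZero p
      p≢0 = prime⇒nonZero pr
      pp≢0 : NonZero (p * p)
      pp≢0 = m*n≢0 p p
    Scaled : ℕ × ℕ × ℕ → Set
    Scaled (c , e , b) = Inv (p ^ (2 + k)) (c , e , b) × p ∣ c
    pull : ∀ p c e → p * c * (p * c) * e ≡ p * (p * (c * c * e))
    pull = solve-∀
    pull′ : ∀ p c e → p * p * (c * c * e) ≡ c * p * (c * p) * e
    pull′ = solve-∀
    scaled : Card Scaled _
    scaled = Card-bij (λ (a , d , b) (a′ , d′ , b′) → a′ ≡ p * a × d′ ≡ d × b′ ≡ b)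
      (λ (c , e , b) (eq , r) → (p * c , e , b) ,
         ((trans (pull p c e) (cong (λ z → p * (p * z)) eq) , r) , m∣m*n c) , refl , refl , refl)
      (λ { (c , e , b) ((eq , r) , divides q refl) → (q , e , b) ,
         (*-cancelˡ-≡ (q * q * e) (p ^ k) (p * p) (trans (pull′ p q e) (trans eq (sym (*-assoc p p (p ^ k))))) , r) ,
         *-comm q p , refl , refl })
      (λ { _ _ _ _ _ _ (refl , refl , refl) (refl , refl , refl) → refl })
      (λ { (c , _) (c′ , _) _ _ _ _ (refl , refl , refl) (e , refl , refl) →
           cong (_, _) (*-cancelˡ-≡ c c′ p e) })
      invs
    disjoint : ∀ {x} → Scaled x → Unit (p ^ (2 + k)) x → ⊥
    disjoint (_ , p∣c) (refl , _) = prime-∤1 pr p∣c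
    to : ∀ {x} → Scaled x ⊎ Unit (p ^ (2 + k)) x → Inv (p ^ (2 + k)) x
    to (inj₁ (i , _)) = i
    to (inj₂ u) = Unit⇒Inv u
    from : ∀ {x} → Inv (p ^ (2 + k)) x → Scaled x ⊎ Unit (p ^ (2 + k)) x
    from {c , e , b} i with p ∣? c
    ... | yes p∣c = inj₁ (i , p∣c)
    ... | no p∤c = inj₂ (Inv-∤⇒Unit {k = 2 + k} pr i p∤c)

  prime[3] : Prime 3
  prime[3] = toWitness {a? = prime? 3} _

  discriminant : ∀ r → 4 * poly r ≡ (2 * r + 1) * (2 * r + 1) + 3
  discriminant = expand
    where
    expand : ∀ r → 4 * (r * r + r + 1) ≡ (2 * r + 1) * (2 * r + 1) + 3
    expand = solve-∀

  -- The identity 4f = f′² + 3 of `discriminant` leaves 3 as the only possible common prime of f and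
  -- f′. So roots modulo other primes are simple, on which both the bound by two and Hensel lifting
  -- rest.
  derivative-∤ : ∀ {p r} → Prime p → p ≢ 3 → p ∣ poly r → ¬ p ∣ 2 * r + 1
  derivative-∤ {p} {r} pr p≢3 p∣f p∣f′ with prime⇒irreducible prime[3]
    (∣m+n∣m⇒∣n (subst (p ∣_) (discriminant r) (∣n⇒∣m*n 4 p∣f)) (∣m⇒∣m*n (2 * r + 1) p∣f′))
  ... | inj₁ refl = prime-∤1 pr ∣-refl
  ... | inj₂ p≡3 = p≢3 p≡3

  ∣<⇒≡0 : ∀ {m n} → m ∣ n → n < m → n ≡ 0
  ∣<⇒≡0 {n = zero}  _ _ = refl
  ∣<⇒≡0 {n = suc _} d l = ⊥-elim (<⇒≱ l (∣⇒≤ d))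

  module TwoRoots {p} (pr : Prime p) (p≢3 : p ≢ 3) (i : ℕ) where

    private
      q : ℕ
      q = p ^ suc i

      p∣q : p ∣ q
      p∣q = m∣m*n (p ^ i)

      difference : ∀ x t → (x + t) * (x + t) + (x + t) + 1 ≡ (x * x + x + 1) + t * (x + (x + t) + 1)
      difference = solve-∀

      gap : ∀ x t → x + (x + t) + 1 ≡ t + (2 * x + 1)
      gap = solve-∀

      -- With `y = x + t`, the values differ by `t * (x + y + 1)`. If `p` does not divide `t`, then
      -- `q` divides the second factor, which lies strictly between 0 and `2 * q`. If it does, the
      -- second factor is f′(x) modulo `p`, hence a unit, and `q` divides `t < q`.
      related : ∀ {x y} → x ≤ y → Root q x → Root q y → x ≡ y ⊎ x + y + 1 ≡ q
      related {x} x≤y (x< , q∣x) (y< , q∣y) with m≤n⇒∃[o]m+o≡n x≤y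
      ... | t , refl with p ∣? t
      ... | no p∤t = inj₂ (sandwich (coprime-divisor (coprime-^ (prime-∤⇒coprime pr p∤t) (suc i)) q∣))
        where
        q∣ : q ∣ t * (x + (x + t) + 1)
        q∣ = ∣m+n∣m⇒∣n (subst (q ∣_) (difference x t) q∣y) q∣x
        below : x + (x + t) + 1 < q + q
        below = subst (_< q + q) (sym (trans (+-assoc x (x + t) 1) (cong (x +_) (+-comm (x + t) 1)))) (+-mono-<-≤ x< y<)
        sandwich : q ∣ x + (x + t) + 1 → x + (x + t) + 1 ≡ q
        sandwich (divides zero eq) = ⊥-elim (1+n≢0 (trans (+-comm 1 (x + (x + t))) eq))
        sandwich (divides (suc zero) eq) = trans eq (+-identityʳ q)
        sandwich (divides (suc (suc k)) eq) = ⊥-elim (<⇒≱ below (≤-trans (≤-trans (m≤m+n (q + q) (k * q))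
          (≤-reflexive (+-assoc q q (k * q)))) (≤-reflexive (sym eq))))
      ... | yes p∣t = inj₁ (sym (trans (cong (x +_) t≡0) (+-identityʳ x)))
        where
        p∤ : ¬ p ∣ x + (x + t) + 1
        p∤ d = derivative-∤ {r = x} pr p≢3 (∣-trans p∣q q∣x) (∣m+n∣m⇒∣n (subst (p ∣_) (gap x t) d) p∣t)
        q∣ : q ∣ (x + (x + t) + 1) * t
        q∣ = subst (q ∣_) (*-comm t _) (∣m+n∣m⇒∣n (subst (q ∣_) (difference x t) q∣y) q∣x)
        t≡0 : t ≡ 0
        t≡0 = ∣<⇒≡0 (coprime-divisor (coprime-^ (prime-∤⇒coprime pr p∤) (suc i)) q∣) (≤-<-trans (m≤n+m t x) y<)

    -- The roots of b² + b + 1 have sum -1, so the second one is `q - 1 - r`; it differs from `r`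
    -- because `p` does not divide `2 * r + 1`.
    Card-Root-two : ∀ {r} → Root q r → Card (Root q) 2
    Card-Root-two {r} root@(r< , q∣r) with m≤n⇒∃[o]m+o≡n r<
    ... | r′ , eq = card (r ∷ r′ ∷ []) ((r≢r′ ∷ []) ∷ [] ∷ []) to from refl
      where
      mirror : ∀ r r′ → r * (suc r + r′) + (r′ * r′ + r′ + 1) ≡ (r * r + r + 1) + r′ * (suc r + r′)
      mirror = solve-∀
      root′ : Root q r′
      root′ = ≤-trans (s≤s (m≤n+m r′ r)) (≤-reflexive eq) ,
        ∣m+n∣m⇒∣n (subst (q ∣_) (sym (trans (cong (λ z → r * z + poly r′) (sym eq))
                    (trans (mirror r r′) (cong (λ z → poly r + r′ * z) eq)))) (∣m∣n⇒∣m+n q∣r (n∣m*n r′)))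
                  (n∣m*n r)
      double : ∀ r → suc r + r ≡ 2 * r + 1
      double = solve-∀
      r≢r′ : r ≢ r′
      r≢r′ refl = derivative-∤ {r = r} pr p≢3 (∣-trans p∣q q∣r) (subst (p ∣_) (trans (sym eq) (double r)) p∣q)
      to : ∀ {x} → x ∈ r ∷ r′ ∷ [] → Root q x
      to (here refl) = root
      to (there (here refl)) = root′
      from : ∀ {x} → Root q x → x ∈ r ∷ r′ ∷ []
      from {x} rx with ≤-total r x
      ... | inj₁ r≤x with related r≤x root rx
      ... | inj₁ refl = here refl
      ... | inj₂ e = there (here (+-cancelˡ-≡ (suc r) x r′ (trans (+-comm 1 (r + x)) (trans e (sym eq)))))
      from {x} rx | inj₂ x≤r with related x≤r rx root
      ... | inj₁ refl = here refl
      ... | inj₂ e = there (here (+-cancelˡ-≡ (suc r) x r′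
          (trans (+-comm 1 (r + x)) (trans (trans (cong (_+ 1) (+-comm r x)) e) (sym eq)))))

  -- Newton's step: with `poly r = t * p ^ suc i`, passing to `r + s * p ^ suc i` adds
  -- `(2 * r + 1) * s` to `t` modulo `p`, and simplicity of the root allows an `s` that cancels `t`.
  hensel : ∀ {p r} → Prime p → p ≢ 3 → ∀ i → p ^ suc i ∣ poly r → ∃ λ r′ → p ^ suc (suc i) ∣ poly r′
  hensel {p} {r} pr p≢3 i (divides t eq)
    with linear-congruence {p} {{prime⇒nonZero pr}}
           (prime-∤⇒coprime {p} {2 * r + 1} pr (derivative-∤ {r = r} pr p≢3 (divides (t * p ^ i) (trans eq (e₀ t p (p ^ i)))))) t
    where
    e₀ : ∀ t p x → t * (p * x) ≡ t * x * p
    e₀ = solve-∀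
  ... | s , divides u eq′ = r + s * p ^ suc i , divides (u + s * s * p ^ i)
        (trans (e₁ r s p (p ^ i)) (trans (cong (_+ ((2 * r + 1) * s * (p * p ^ i) + s * s * (p * p ^ i) * (p * p ^ i))) eq)
        (trans (e₂ t r s p (p ^ i)) (trans (cong (λ z → (z + s * s * (p * p ^ i)) * (p * p ^ i)) eq′) (e₃ u s p (p ^ i))))))
    where
    e₁ : ∀ r s p x → (r + s * (p * x)) * (r + s * (p * x)) + (r + s * (p * x)) + 1
                   ≡ (r * r + r + 1) + ((2 * r + 1) * s * (p * x) + s * s * (p * x) * (p * x))
    e₁ = solve-∀
    e₂ : ∀ t r s p x → t * (p * x) + ((2 * r + 1) * s * (p * x) + s * s * (p * x) * (p * x))
                     ≡ ((2 * r + 1) * s + t + s * s * (p * x)) * (p * x)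
    e₂ = solve-∀
    e₃ : ∀ u s p x → (u * p + s * s * (p * x)) * (p * x) ≡ (u + s * s * x) * (p * (p * x))
    e₃ = solve-∀

  -- The map x ↦ -1/(1+x) permutes the residues other than 0 and -1, has order
  -- three, and its fixed points are the roots of b² + b + 1.
  module Möbius {p} (pr : Prime p) where

    private
      instance
        p≢0 : NonZero p
        p≢0 = prime⇒nonZero pr

    Good : ℕ → Set
    Good x = 0 < x × suc x < p

    Image : ℕ → ℕ → Set
    Image x y = p ∣ suc x * y + 1

    small-∤ : ∀ {x} → 0 < x → x < p → ¬ p ∣ x
    small-∤ 0<x x<p p∣x = <⇒≢ 0<x (sym (∣<⇒≡0 p∣x x<p))

    -- Injectivity of a linear map with unit coefficient, with a common constant `K` because the
    -- relations defining `f` are written without subtraction.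
    cancel : ∀ {c x y} K → ¬ p ∣ c → x < p → y < p → p ∣ x * c + K → p ∣ y * c + K → x ≡ y
    cancel {c} {x} {y} K p∤c x< y< px py =
      [ (λ x≤y → ordered x≤y y< px py) , (λ y≤x → sym (ordered y≤x x< py px)) ]′ (≤-total x y)
      where
      expand : ∀ x t c K → (x + t) * c + K ≡ (x * c + K) + c * t
      expand = solve-∀
      ordered : ∀ {x y} → x ≤ y → y < p → p ∣ x * c + K → p ∣ y * c + K → x ≡ y
      ordered {x} x≤y y< px py with m≤n⇒∃[o]m+o≡n x≤y
      ... | t , refl = sym (trans (cong (x +_) t≡0) (+-identityʳ x))
        where
        t≡0 : t ≡ 0
        t≡0 = ∣<⇒≡0 (coprime-divisor (prime-∤⇒coprime pr p∤c)
          (∣m+n∣m⇒∣n (subst (p ∣_) (expand x t c K) py) px)) (≤-<-trans (m≤n+m t x) y<)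

    image? : ∀ x → Dec (∃ λ y → y < p × Image x y)
    image? x = anyUpTo? (λ y → p ∣? suc x * y + 1) p

    -- Junk value 0 when 1 + x is not invertible.
    f : ℕ → ℕ
    f x with image? x
    ... | yes (y , _) = y
    ... | no _        = 0

    image-exists : ∀ {x} → Good x → ∃ λ y → y < p × Image x y
    image-exists {x} (_ , sx<) with linear-congruence (prime-∤⇒coprime pr (small-∤ (s≤s z≤n) sx<)) 1
    ... | s , p∣ = s % p , m%n<n s p , ∣m+n∣m⇒∣n (subst (p ∣_) reduce p∣) (n∣m*n (suc x * (s / p)))
      where
      expand : ∀ x r q p → suc x * (r + q * p) + 1 ≡ suc x * q * p + (suc x * r + 1)
      expand = solve-∀
      reduce : suc x * s + 1 ≡ suc x * (s / p) * p + (suc x * (s % p) + 1)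
      reduce = trans (cong (λ z → suc x * z + 1) (m≡m%n+[m/n]*n s p)) (expand x (s % p) (s / p) p)

    f-spec : ∀ {x} → Good x → f x < p × Image x (f x)
    f-spec {x} g with image? x
    ... | yes (y , spec) = spec
    ... | no ¬∃ = ⊥-elim (¬∃ (image-exists g))

    -- The value 0 would make `p` divide 1, and the value -1 would make it divide `x`, as (1 +
    -- x)(-1) + 1 = -x.
    f-good : ∀ {x} → Good x → Good (f x)
    f-good {x} g@(0<x , sx<) with f x | f-spec g
    ... | zero | _ , im = ⊥-elim (prime-∤1 pr (subst (p ∣_) (cong (_+ 1) (*-zeroʳ (suc x))) im))
    ... | suc y | y< , im = s≤s z≤n , ≤∧≢⇒< y< λ { refl →
          small-∤ 0<x (<-trans (n<1+n x) sx<) (∣m+n∣m⇒∣n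
            (subst (p ∣_) (sym (expand x y)) (n∣m*n (suc x))) im) }
      where
      expand : ∀ x y → (suc x * suc y + 1) + x ≡ suc x * (2 + y)
      expand = solve-∀

    f-cube : ∀ {x} → Good x → f (f (f x)) ≡ x
    -- Combining the defining relations of `y`, `z` and `w` shows that `w` and `x` both solve one
    -- linear congruence, with the unit `y * z` as coefficient and the same constant.
    f-cube {x} g = cancel {y * z} (y * z + z + w * z + w + 1) p∤yz
        (proj₁ (f-spec gz)) (<-trans (n<1+n x) (proj₂ g))
        (subst (p ∣_) (eq₁ w y z) (∣m∣n⇒∣m+n (∣n⇒∣m*n w (proj₂ (f-spec gy))) (proj₂ (f-spec gy))))
        (subst (p ∣_) (eq₂ x y z w) (∣m∣n⇒∣m+n (∣n⇒∣m*n z (proj₂ (f-spec g))) (proj₂ (f-spec gz))))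
      where
      y z w : ℕ
      y = f x
      z = f y
      w = f z
      gy : Good y
      gy = f-good g
      gz : Good z
      gz = f-good gy
      p∤yz : ¬ p ∣ y * z
      p∤yz d with euclidsLemma y z pr d
      ... | inj₁ e = small-∤ (proj₁ gy) (<-trans (n<1+n y) (proj₂ gy)) e
      ... | inj₂ e = small-∤ (proj₁ gz) (<-trans (n<1+n z) (proj₂ gz)) e
      eq₁ : ∀ w y z → w * (suc y * z + 1) + (suc y * z + 1) ≡ w * (y * z) + (y * z + z + w * z + w + 1)
      eq₁ = solve-∀
      eq₂ : ∀ x y z w → z * (suc x * y + 1) + (suc z * w + 1) ≡ x * (y * z) + (y * z + z + w * z + w + 1)
      eq₂ = solve-∀

    poly-Image : ∀ x → suc x * x + 1 ≡ poly x
    poly-Image = expand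
      where
      expand : ∀ x → suc x * x + 1 ≡ x * x + x + 1
      expand = solve-∀

    Root⇒Good : ∀ {x} → Root p x → Good x
    Root⇒Good {zero} (_ , p∣) = ⊥-elim (prime-∤1 pr p∣)
    Root⇒Good {suc x} (x< , p∣) = s≤s z≤n , ≤∧≢⇒< x< λ { refl →
        prime-∤1 pr (∣m+n∣m⇒∣n (subst (p ∣_) (expand x) p∣) (n∣m*n (suc x))) }
      where
      expand : ∀ x → suc x * suc x + suc x + 1 ≡ suc x * (2 + x) + 1
      expand = solve-∀

    Root⇒fixed : ∀ {x} → Root p x → f x ≡ x
    Root⇒fixed {x} r@(x< , p∣) = cancel {suc x} 1 (small-∤ (s≤s z≤n) (proj₂ g)) (proj₁ (f-spec g)) x<
        (subst (p ∣_) (cong (_+ 1) (*-comm (suc x) (f x))) (proj₂ (f-spec g)))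
        (subst (p ∣_) (trans (sym (poly-Image x)) (cong (_+ 1) (*-comm (suc x) x))) p∣)
      where
      g : Good x
      g = Root⇒Good r

    Card-Good : Card Good (p ∸ 2)
    Card-Good = Card-bij (λ i x → x ≡ suc i)
      (λ i i< → suc i , (s≤s z≤n , subst (2 + i <_) (m+[n∸m]≡n 2≤p) (+-monoʳ-< 2 i<)) , refl)
      (λ { (suc i) (_ , i<) → i , ∸-monoˡ-< i< (s≤s (s≤s z≤n)) , refl })
      (λ { _ _ _ _ _ _ refl refl → refl }) (λ { _ _ _ _ _ _ refl refl → refl }) (Card-< (p ∸ 2))
      where
      2≤p : 2 ≤ p
      2≤p = nonTrivial⇒n>1 p {{prime⇒nonTrivial pr}}

    root-count : ∃₂ λ K N → Card (Root p) K × 3 * N ≡ p ∸ 2 + 2 * K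
    root-count = let r , eq = orbits Card-Good f-good f-cube in
      fixed (elements Card-Good) , length (reps r) , Card-⇔ to from (Card-fixed Card-Good) , eq
      where
      open OrderThree _≟_ f
      to : ∀ {x} → Good x × f x ≡ x → Root p x
      to {x} (g , fx) = <-trans (n<1+n x) (proj₂ g) ,
        subst (p ∣_) (trans (cong (λ z → suc x * z + 1) fx) (poly-Image x)) (proj₂ (f-spec g))
      from : ∀ {x} → Root p x → Good x × f x ≡ x
      from r = Root⇒Good r , Root⇒fixed r

  %3-cong : ∀ {a b} k l → a + 3 * k ≡ b + 3 * l → a % 3 ≡ b % 3
  %3-cong {a} {b} k l eq = begin
    a % 3           ≡⟨ [m+kn]%n≡m%n a k 3 ⟨
    (a + k * 3) % 3 ≡⟨ cong (λ z → (a + z) % 3) (*-comm k 3) ⟩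
    (a + 3 * k) % 3 ≡⟨ cong (_% 3) eq ⟩
    (b + 3 * l) % 3 ≡⟨ cong (λ z → (b + z) % 3) (*-comm 3 l) ⟩
    (b + l * 3) % 3 ≡⟨ [m+kn]%n≡m%n b l 3 ⟩
    b % 3           ∎
    where open ≡-Reasoning

  mod3-split : ∀ p → p ≡ p % 3 + 3 * (p / 3)
  mod3-split p = trans (m≡m%n+[m/n]*n p 3) (cong (p % 3 +_) (*-comm (p / 3) 3))

  %3≢0⇒≢3 : ∀ {p r} → p % 3 ≡ suc r → p ≢ 3
  %3≢0⇒≢3 () refl

  -- For `p` equal to 1 modulo 3, the number `p - 2` is no multiple of 3, so the order-three map
  -- cannot act without fixed points.
  root-mod-prime : ∀ {p} → Prime p → p % 3 ≡ 1 → ∃ λ r → p ∣ poly r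
  root-mod-prime {p} pr p≡1 = examine (Möbius.root-count pr)
    where
    2≢1 : 2 % 3 ≢ 1 % 3
    2≢1 ()
    e : ∀ N → 3 * N ≡ p ∸ 2 + 0 → 1 + 3 * (p / 3) ≡ 2 + 3 * N
    e N eq = trans (cong (_+ 3 * (p / 3)) (sym p≡1)) (trans (sym (mod3-split p))
      (trans (sym (m+[n∸m]≡n (nonTrivial⇒n>1 p {{prime⇒nonTrivial pr}})))
             (cong (2 +_) (sym (trans eq (+-identityʳ (p ∸ 2)))))))
    examine : (∃₂ λ K N → Card (Root p) K × 3 * N ≡ p ∸ 2 + 2 * K) → ∃ λ r → p ∣ poly r
    examine (_ , _ , card (r ∷ _) _ s _ _ , _)     = r , proj₂ (s (here refl))
    examine (_ , N , card [] _ _ _ refl , eq) = ⊥-elim (2≢1 (%3-cong {2} {1} N (p / 3) (sym (e N eq))))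

  -- A root would bring exactly one more, so that `K = 2` and `3 * N = p + 2`, which is 1 modulo 3.
  no-root-mod-prime : ∀ {p r} → Prime p → p % 3 ≡ 2 → ¬ p ∣ poly r
  no-root-mod-prime {p} {r} pr p≡2 p∣ = contra (%3-cong {1} {0} (suc (p / 3)) N e)
    where
    instance
      p≢0 : NonZero p
      p≢0 = prime⇒nonZero pr
    K N : ℕ
    K = proj₁ (Möbius.root-count pr)
    N = proj₁ (proj₂ (Möbius.root-count pr))
    root : Root (p ^ 1) (r % p)
    root = subst (λ z → Root z (r % p)) (sym (*-identityʳ p)) (Root-% {b = r} p∣)
    K≡2 : K ≡ 2
    K≡2 = Card-unique (proj₁ (proj₂ (proj₂ (Möbius.root-count pr)))) (subst (λ z → Card (Root z) 2) (*-identityʳ p)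
            (TwoRoots.Card-Root-two pr (%3≢0⇒≢3 p≡2) 0 root))
    contra : 1 % 3 ≢ 0 % 3
    contra ()
    shift : ∀ x → 1 + 3 * suc x ≡ 2 + (2 + 3 * x)
    shift = solve-∀
    e : 1 + 3 * suc (p / 3) ≡ 3 * N
    e = trans (shift (p / 3)) (trans (cong (λ z → 2 + (z + 3 * (p / 3))) (sym p≡2))
      (trans (cong (2 +_) (sym (mod3-split p)))
      (trans (cong (2 +_) (sym (m+[n∸m]≡n (nonTrivial⇒n>1 p {{prime⇒nonTrivial pr}}))))
      (trans (+-comm 4 (p ∸ 2)) (trans (cong (λ z → p ∸ 2 + 2 * z) (sym K≡2)) (sym (proj₂ (proj₂ (proj₂ (Möbius.root-count pr))))))))))

  root-mod-power : ∀ {p} → Prime p → p % 3 ≡ 1 → ∀ i → ∃ λ r → p ^ suc i ∣ poly r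
  root-mod-power {p} pr p≡1 zero = let r , p∣ = root-mod-prime pr p≡1 in
    r , subst (_∣ poly r) (sym (*-identityʳ p)) p∣
  root-mod-power pr p≡1 (suc i) = let r , q∣ = root-mod-power pr p≡1 i in
    hensel {r = r} pr (%3≢0⇒≢3 p≡1) i q∣

  Card-Root-≡1 : ∀ {p} → Prime p → p % 3 ≡ 1 → ∀ i → Card (Root (p ^ suc i)) 2
  Card-Root-≡1 {p} pr p≡1 i = let r , q∣ = root-mod-power pr p≡1 i in
    TwoRoots.Card-Root-two pr (%3≢0⇒≢3 p≡1) i (Root-% {b = r} {{m^n≢0 p (suc i) {{prime⇒nonZero pr}}}} q∣)

  Card-Root-≡2 : ∀ {p} → Prime p → p % 3 ≡ 2 → ∀ i → Card (Root (p ^ suc i)) 0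
  Card-Root-≡2 {p} pr p≡2 i = Card-∅ (λ {r} (_ , q∣) → no-root-mod-prime {r = r} pr p≡2 (∣-trans (m∣m*n (p ^ i)) q∣))

  Card-Root-3 : Card (Root 3) 1
  Card-Root-3 = Card-⇔ (λ { refl → s≤s (s≤s z≤n) , ∣-refl }) from (Card-singleton 1)
    where
    from : ∀ {x} → Root 3 x → x ≡ 1
    from {0} (_ , d) = ⊥-elim (prime-∤1 prime[3] d)
    from {1} _ = refl
    from {2} (_ , d) = ⊥-elim (prime-∤1 prime[3] (∣m+n∣m⇒∣n {n = 1} d (divides 2 refl)))
    from {suc (suc (suc _))} (s≤s (s≤s (s≤s ())) , _)

  -- If 9 divided f(r), then by 4f = f′² + 3 first 3 would divide f′, then 9 would divide f′², and
  -- finally 9 would divide 3.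
  Card-Root-9 : ∀ i → Card (Root (3 ^ (2 + i))) 0
  Card-Root-9 i = Card-∅ (λ {r} (_ , q∣) → none r (∣-trans (∣-trans (m∣m*n (3 ^ i)) (∣-reflexive (*-assoc 3 3 (3 ^ i)))) q∣))
    where
    none : ∀ r → ¬ 9 ∣ poly r
    none r 9∣ = prime-∤1 prime[3] (*-cancelˡ-∣ {3} {1} 3 (∣m+n∣m⇒∣n 9∣sum (*-pres-∣ 3∣u 3∣u)))
      where
      u : ℕ
      u = 2 * r + 1
      9∣sum : 9 ∣ u * u + 3
      9∣sum = subst (9 ∣_) (discriminant r) (∣n⇒∣m*n 4 9∣)
      3∣uu : 3 ∣ u * u
      3∣uu = ∣m+n∣m⇒∣n (subst (3 ∣_) (+-comm (u * u) 3) (∣-trans (divides 3 refl) 9∣sum)) ∣-refl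
      3∣u : 3 ∣ u
      3∣u = [ (λ d → d) , (λ d → d) ]′ (euclidsLemma u u prime[3] 3∣uu)

  Card-Inv-3 : ∀ k → Card (Inv (3 ^ k)) 1
  Card-Inv-3 zero          = Card-Inv-power₀ prime[3]
  Card-Inv-3 (suc zero)    = Card-Inv-power₁ prime[3] Card-Root-3
  Card-Inv-3 (suc (suc k)) = Card-Inv-step {k = k} prime[3] (Card-Root-9 k) (Card-Inv-3 k)

  -- Here `c = p ^ j`; each `j` with `2 * j < k` allows two roots and `2 * j = k` allows one, in
  -- total `k + 1`.
  Card-Inv-≡1 : ∀ {p} → Prime p → p % 3 ≡ 1 → ∀ k → Card (Inv (p ^ k)) (suc k)
  Card-Inv-≡1 pr p≡1 zero          = Card-Inv-power₀ pr
  Card-Inv-≡1 pr p≡1 (suc zero)    = Card-Inv-power₁ pr (Card-Root-≡1 pr p≡1 0)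
  Card-Inv-≡1 pr p≡1 (suc (suc k)) = Card-cong (+-comm (suc k) 2)
    (Card-Inv-step {k = k} pr (Card-Root-≡1 pr p≡1 (suc k)) (Card-Inv-≡1 pr p≡1 k))

  evenness : ℕ → ℕ
  evenness zero          = 1
  evenness (suc zero)    = 0
  evenness (suc (suc k)) = evenness k

  -- Without roots modulo `p` only `e = 1` is possible, and then `c * c = p ^ k`.
  Card-Inv-≡2 : ∀ {p} → Prime p → p % 3 ≡ 2 → ∀ k → Card (Inv (p ^ k)) (evenness k)
  Card-Inv-≡2 pr p≡2 zero          = Card-Inv-power₀ pr
  Card-Inv-≡2 pr p≡2 (suc zero)    = Card-Inv-power₁ pr (Card-Root-≡2 pr p≡2 0)
  Card-Inv-≡2 pr p≡2 (suc (suc k)) = Card-cong (+-identityʳ (evenness k))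
    (Card-Inv-step {k = k} pr (Card-Root-≡2 pr p≡2 (suc k)) (Card-Inv-≡2 pr p≡2 k))

-- Assembling the local counts over the factorisation.

module Factorised where

  open import Defs
  open Counting
  open Arithmetic
  open PrimePowerCounts
  open import Data.Nat
  open import Data.Nat.Properties
  open import Data.Nat.Divisibility
  open import Data.Nat.DivMod
  open import Data.Nat.Coprimality using (Coprime)
  import Data.Nat.Coprimality as Coprime
  open import Data.Nat.Primality using (Prime; prime⇒irreducible; prime⇒nonZero; prime⇒nonTrivial)
  open import Data.List using (List; []; _∷_; map)
  open import Data.List.Relation.Unary.All as All using (All; []; _∷_)
  import Data.List.Relation.Unary.All.Properties as All
  open import Data.List.Relation.Unary.Any using (Any; here; there)
  open import Data.List.Relation.Unary.AllPairs using ([]; _∷_)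
  open import Data.List.Relation.Unary.Unique.Propositional using (Unique)
  open import Data.Product using (_×_; _,_; proj₁; proj₂)
  open import Data.Sum using ([_,_]′)
  open import Relation.Binary.PropositionalEquality

  distinct-primes-coprime : ∀ {p q} → Prime p → Prime q → p ≢ q → Coprime p q
  distinct-primes-coprime pr qr p≢q = prime-∤⇒coprime pr λ p∣q →
    [ (λ { refl → prime-∤1 pr ∣-refl }) , p≢q ]′ (prime⇒irreducible qr p∣q)

  coprime-powProd : ∀ {n} xs → All (λ x → Coprime n (proj₁ x)) xs → Coprime n (powProd xs)
  coprime-powProd {n} []       []       = Coprime.sym (Coprime.1-coprimeTo n)
  coprime-powProd ((p , k) ∷ xs) (c ∷ cs) =
    Coprime.sym (coprime-* (coprime-^ (Coprime.sym c) k) (Coprime.sym (coprime-powProd xs cs)))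

  coprime-others : ∀ {p} → Prime p → ∀ (xs : List (ℕ × ℕ)) → All (p ≢_) (map proj₁ xs) → All (λ x → Prime (proj₁ x)) xs →
                   All (λ x → Coprime p (proj₁ x)) xs
  coprime-others pr []       []          []         = []
  coprime-others pr (_ ∷ xs) (p≢q ∷ p∉) (qr ∷ qrs) = distinct-primes-coprime pr qr p≢q ∷ coprime-others pr xs p∉ qrs

  powProd≢0 : ∀ xs → All (λ x → Prime (proj₁ x)) xs → NonZero (powProd xs)
  powProd≢0 []             []         = _
  powProd≢0 ((p , k) ∷ xs) (pr ∷ prs) = m*n≢0 (p ^ k) (powProd xs) {{m^n≢0 p k {{prime⇒nonZero pr}}}} {{powProd≢0 xs prs}}

  Multiplicative : (ℕ → ℕ × ℕ × ℕ → Set) → Set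
  Multiplicative X = ∀ {M N x y} .{{_ : NonZero M}} .{{_ : NonZero N}} → Coprime M N →
                     Card (X M) x → Card (X N) y → Card (X (M * N)) (x * y)

  module _ {X : ℕ → ℕ × ℕ × ℕ → Set} (X-* : Multiplicative X) (X-1 : Card (X 1) 1) where

    Card-powProd : (val : ℕ × ℕ → ℕ) → ∀ xs → Unique (map proj₁ xs) →
      All (λ x → Prime (proj₁ x) × Card (X (proj₁ x ^ proj₂ x)) (val x)) xs →
      Card (X (powProd xs)) (prodℕ (map val xs))
    Card-powProd val []             _        _ = X-1
    Card-powProd val ((p , k) ∷ xs) (p∉ ∷ u) ((pr , c) ∷ cs) =
      X-* {{m^n≢0 p k {{prime⇒nonZero pr}}}} {{powProd≢0 xs (All.map proj₁ cs)}}
        (coprime-^ (coprime-powProd xs (coprime-others pr xs p∉ (All.map proj₁ cs))) k)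
        c (Card-powProd val xs u cs)

  module _ (m : ℕ) {ps qs : List (ℕ × ℕ)} (P : PrimePowers 1 ps) (Q : PrimePowers 2 qs) where

    private
      coprime-PrimePowers : ∀ {p r s xs} → Prime p → p % 3 ≡ r → r ≢ s → PrimePowers s xs → Coprime p (powProd xs)
      coprime-PrimePowers {xs = xs} pr p≡r r≢s (_ , all) = coprime-powProd xs (coprime-others pr xs
        (All.map⁺ (All.map (λ { (_ , q≡s , _) refl → r≢s (trans (sym p≡r) q≡s) }) all)) (All.map proj₁ all))

      primes : ∀ {r xs} → PrimePowers r xs → All (λ x → Prime (proj₁ x)) xs
      primes (_ , all) = All.map proj₁ all

      0≢1 : 0 ≢ 1
      0≢1 ()
      0≢2 : 0 ≢ 2
      0≢2 ()
      1≢2 : 1 ≢ 2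
      1≢2 ()

      3^⊥ps : Coprime (3 ^ m) (powProd ps)
      3^⊥ps = coprime-^ (coprime-PrimePowers prime[3] refl 0≢1 P) m

      ps⊥qs : Coprime (powProd ps) (powProd qs)
      ps⊥qs = Coprime.sym (coprime-powProd ps (coprimes (proj₂ P)))
        where
        coprimes : ∀ {xs} → All (λ x → Prime (proj₁ x) × (proj₁ x % 3 ≡ 1) × (1 ≤ proj₂ x)) xs →
                   All (λ x → Coprime (powProd qs) (proj₁ x)) xs
        coprimes []                       = []
        coprimes ((pr , p≡1 , _) ∷ rest) = Coprime.sym (coprime-PrimePowers pr p≡1 1≢2 Q) ∷ coprimes rest

    Card-factorisation : ∀ {X} → Multiplicative X → ∀ {x y z} →
      Card (X (3 ^ m)) x → Card (X (powProd ps)) y → Card (X (powProd qs)) z →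
      Card (X (3 ^ m * powProd ps * powProd qs)) (x * y * z)
    Card-factorisation X-* cx cy cz =
      X-* {{m*n≢0 (3 ^ m) (powProd ps) {{m^n≢0 3 m}} {{powProd≢0 ps (primes P)}}}} {{powProd≢0 qs (primes Q)}}
        (coprime-* (coprime-^ (coprime-PrimePowers prime[3] refl 0≢2 Q) m) ps⊥qs)
        (X-* {{m^n≢0 3 m}} {{powProd≢0 ps (primes P)}} 3^⊥ps cx cy) cz

    private
      Card-Sub-geomQ : ∀ {p} → Prime p → ∀ k → Card (Sub (p ^ k)) (geomQ p k)
      Card-Sub-geomQ {p} pr k = Card-cong (sym (geomQ≡geometric (nonTrivial⇒n>1 p {{prime⇒nonTrivial pr}}) k)) (Card-Sub-power pr k)

      Card-Sub-powProd : ∀ {r xs} → PrimePowers r xs → Card (Sub (powProd xs)) (geomProd xs)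
      Card-Sub-powProd {xs = xs} (u , all) = Card-powProd Sub-* (Card-Sub-power prime[3] 0) _ xs u
        (All.map (λ { (pr , _) → pr , Card-Sub-geomQ pr _ }) all)

    Card-Sub : Card (Sub (3 ^ m * powProd ps * powProd qs)) (geomQ 3 m * geomProd ps * geomProd qs)
    Card-Sub = Card-factorisation Sub-* (Card-Sub-geomQ prime[3] m) (Card-Sub-powProd P) (Card-Sub-powProd Q)

    -- The factor for `qs` is 1 if all its exponents are even and 0 otherwise, so this one formula
    -- yields both cases of the theorem.
    Card-Inv : Card (Inv (3 ^ m * powProd ps * powProd qs)) (divCount ps * prodℕ (map (λ x → evenness (proj₂ x)) qs))
    Card-Inv = Card-cong (cong (_* prodℕ (map (λ x → evenness (proj₂ x)) qs)) (*-identityˡ (divCount ps)))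
      (Card-factorisation Inv-* (Card-Inv-3 m)
        (Card-powProd Inv-* (Card-Inv-3 0) _ ps (proj₁ P)
          (All.map (λ { (pr , p≡1 , _) → pr , Card-Inv-≡1 pr p≡1 _ }) (proj₂ P)))
        (Card-powProd Inv-* (Card-Inv-3 0) _ qs (proj₁ Q)
          (All.map (λ {x} (pr , q≡2 , _) → pr , Card-Inv-≡2 pr q≡2 (proj₂ x)) (proj₂ Q))))

  evenness-even : ∀ k → k % 2 ≡ 0 → evenness k ≡ 1
  evenness-even zero          _  = refl
  evenness-even (suc (suc k)) eq = evenness-even k eq

  evenness-odd : ∀ k → k % 2 ≡ 1 → evenness k ≡ 0
  evenness-odd (suc zero)    _  = refl
  evenness-odd (suc (suc k)) eq = evenness-odd k eq

  product-evenness-even : ∀ {qs : List (ℕ × ℕ)} → All (λ x → proj₂ x % 2 ≡ 0) qs → prodℕ (map (λ x → evenness (proj₂ x)) qs) ≡ 1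
  product-evenness-even []       = refl
  product-evenness-even {x ∷ _} (e ∷ es) = cong₂ _*_ (evenness-even (proj₂ x) e) (product-evenness-even es)

  product-evenness-odd : ∀ {qs : List (ℕ × ℕ)} → Any (λ x → proj₂ x % 2 ≡ 1) qs → prodℕ (map (λ x → evenness (proj₂ x)) qs) ≡ 0
  product-evenness-odd {x ∷ qs} (here o)  = cong (_* prodℕ (map (λ x → evenness (proj₂ x)) qs)) (evenness-odd (proj₂ x) o)
  product-evenness-odd {x ∷ qs} (there o) = trans (cong (evenness (proj₂ x) *_) (product-evenness-odd o)) (*-zeroʳ (evenness (proj₂ x)))

-- Unrolling a hexagonal map onto the triangular lattice.

module Developing where

  open import Defs using (Orbit3; Orbit6; Step; σ-step; α-step)
  open import Data.Integer using (ℤ; +_; -[1+_]; _+_; _*_; -_; 0ℤ; 1ℤ; -1ℤ)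
  open import Data.Integer.Properties using (+-identityˡ; +-assoc; +-comm; +-inverseˡ; +-inverseʳ; neg-involutive)
  open import Data.Integer.Tactic.RingSolver using (solve-∀)
  open import Data.Nat using (zero; suc)
  open import Data.Fin using (Fin; zero; suc)
  open import Data.Product using (∃; _×_; _,_; proj₁; proj₂)
  open import Data.Sum using (_⊎_; inj₁; inj₂)
  open import Data.Empty using (⊥; ⊥-elim)
  open import Function using (_∘_)
  open import Function.Bundles using (_↔_; Inverse; mk↔ₛ′)
  open import Relation.Nullary using (¬_)
  open import Relation.Binary.PropositionalEquality
  open import Relation.Binary.Construct.Closure.ReflexiveTransitive using (Star; ε; _◅_)

  -- The triangular lattice of hexagon centres, in the basis 1, ζ = exp(πi/3).
  Pt : Set
  Pt = ℤ × ℤ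

  𝟎 : Pt
  𝟎 = 0ℤ , 0ℤ

  infixl 6 _⊕_
  _⊕_ : Pt → Pt → Pt
  (x , y) ⊕ (x′ , y′) = x + x′ , y + y′

  ⊖_ : Pt → Pt
  ⊖ (x , y) = - x , - y

  ζ : Pt → Pt
  ζ (x , y) = - y , x + y

  -- The neighbours 1, ζ, ζ² of the origin.
  e : Fin 3 → Pt
  e zero             = 1ℤ , 0ℤ
  e (suc zero)       = 0ℤ , 1ℤ
  e (suc (suc zero)) = -1ℤ , 1ℤ

  ⊕-identityˡ : ∀ v → 𝟎 ⊕ v ≡ v
  ⊕-identityˡ (x , y) = cong₂ _,_ (+-identityˡ x) (+-identityˡ y)

  ⊕-comm : ∀ u v → u ⊕ v ≡ v ⊕ u
  ⊕-comm (a , b) (c , d) = cong₂ _,_ (+-comm a c) (+-comm b d)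

  ⊕-assoc : ∀ u v w → (u ⊕ v) ⊕ w ≡ u ⊕ (v ⊕ w)
  ⊕-assoc (a , b) (c , d) (x , y) = cong₂ _,_ (+-assoc a c x) (+-assoc b d y)

  ⊕-inverseˡ : ∀ v → ⊖ v ⊕ v ≡ 𝟎
  ⊕-inverseˡ (x , y) = cong₂ _,_ (+-inverseˡ x) (+-inverseˡ y)

  ⊕-inverseʳ : ∀ v → v ⊕ ⊖ v ≡ 𝟎
  ⊕-inverseʳ (x , y) = cong₂ _,_ (+-inverseʳ x) (+-inverseʳ y)

  ⊖-involutive : ∀ v → ⊖ ⊖ v ≡ v
  ⊖-involutive (x , y) = cong₂ _,_ (neg-involutive x) (neg-involutive y)

  ζ-cube : ∀ v → ζ (ζ (ζ v)) ≡ ⊖ v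
  ζ-cube (x , y) = cong₂ _,_ (first x y) (second x y)
    where
    first : ∀ x y → - (- y + (x + y)) ≡ - x
    first = solve-∀
    second : ∀ x y → - (x + y) + (- y + (x + y)) ≡ - y
    second = solve-∀

  ℤ-induction : (Q : ℤ → Set) → Q 0ℤ → (∀ i → Q i → Q (1ℤ + i)) → (∀ i → Q i → Q (-1ℤ + i)) → ∀ i → Q i
  ℤ-induction Q z s p (+ zero)       = z
  ℤ-induction Q z s p (+ suc n)      = s (+ n) (ℤ-induction Q z s p (+ n))
  ℤ-induction Q z s p -[1+ zero ]    = p 0ℤ z
  ℤ-induction Q z s p -[1+ suc n ]   = p -[1+ n ] (ℤ-induction Q z s p -[1+ n ])

  1+[-1+i] : ∀ i → 1ℤ + (-1ℤ + i) ≡ i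
  1+[-1+i] = solve-∀

  -- The universal map: darts of the hexagonal tiling modulo the half-turn about
  -- the origin, which identifies side r + 3 of the face v with side r of ⊖ v.
  φ̂ α̂ σ̂ : Fin 3 × Pt → Fin 3 × Pt
  φ̂ (zero , v)           = suc zero , v
  φ̂ (suc zero , v)       = suc (suc zero) , v
  φ̂ (suc (suc zero) , v) = zero , ⊖ v
  α̂ (r , v) = r , ⊖ (e r ⊕ v)
  σ̂ x = φ̂ (α̂ x)

  -- A `Trihex` without `euler` and over any type of darts. This allows comparing maps whose numbers
  -- of darts are not yet known to agree.
  record HexMap (D : Set) : Set where
    field
      σ : D → D
      α : D → D
      σ-cube    : ∀ x → σ (σ (σ x)) ≡ x
      σ-fix     : ∀ x → σ x ≢ x
      α-invol   : ∀ x → α (α x) ≡ x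
      α-fix     : ∀ x → α x ≢ x
      faces     : ∀ x → Orbit3 (λ y → σ (α y)) x ⊎ Orbit6 (λ y → σ (α y)) x
      connected : ∀ x y → Star (Step σ α) x y

    φ : D → D
    φ y = σ (α y)

  module _ {D : Set} where

    pow : (f g : D → D) → ℤ → D → D
    pow f g (+ zero)     d = d
    pow f g (+ suc n)    d = f (pow f g (+ n) d)
    pow f g -[1+ zero ]  d = g d
    pow f g -[1+ suc n ] d = g (pow f g -[1+ n ] d)

    module _ {f g : D → D} (fg : ∀ x → f (g x) ≡ x) (gf : ∀ x → g (f x) ≡ x) where

      pow-suc : ∀ i d → f (pow f g i d) ≡ pow f g (1ℤ + i) d
      pow-suc (+ n)        d = refl
      pow-suc -[1+ zero ]  d = fg d
      pow-suc -[1+ suc n ] d = fg (pow f g -[1+ n ] d)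

      pow-pred : ∀ i d → g (pow f g i d) ≡ pow f g (-1ℤ + i) d
      pow-pred (+ zero)     d = refl
      pow-pred (+ suc n)    d = gf (pow f g (+ n) d)
      pow-pred -[1+ zero ]  d = refl
      pow-pred -[1+ suc n ] d = refl

      module _ {h : D → D} (hf : ∀ x → h (f x) ≡ f (h x)) where

        commutes-inverse : ∀ x → h (g x) ≡ g (h x)
        commutes-inverse x = trans (sym (gf (h (g x)))) (cong g (trans (sym (hf (g x))) (cong h (fg x))))

        pow-comm : ∀ i d → h (pow f g i d) ≡ pow f g i (h d)
        pow-comm (+ zero)     d = refl
        pow-comm (+ suc n)    d = trans (hf _) (cong f (pow-comm (+ n) d))
        pow-comm -[1+ zero ]  d = commutes-inverse d
        pow-comm -[1+ suc n ] d = trans (commutes-inverse _) (cong g (pow-comm -[1+ n ] d))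

  module Develop {D : Set} (H : HexMap D) where

    open HexMap H

    φ³ : D → D
    φ³ x = φ (φ (φ x))

    φ⁶ : ∀ x → φ³ (φ³ x) ≡ x
    φ⁶ x with faces x
    ... | inj₁ (eq , _) = trans (cong φ³ eq) eq
    ... | inj₂ (eq , _) = eq

    φ≢ : ∀ x → φ x ≢ x
    φ≢ x eq with faces x
    ... | inj₁ (_ , ne)     = ne eq
    ... | inj₂ (_ , _ , ne) = ne (trans (cong φ eq) eq)

    φφ≢ : ∀ x → φ (φ x) ≢ x
    φφ≢ x eq with faces x
    ... | inj₁ (eq₃ , _)    = φ≢ x (trans (sym (cong φ eq)) eq₃)
    ... | inj₂ (_ , _ , ne) = ne eq

    φ-injective : ∀ {x y} → φ x ≡ φ y → x ≡ y
    φ-injective {x} {y} eq = trans (sym (φ⁶ x)) (trans (cong (φ ∘ φ ∘ φ³) eq) (φ⁶ y))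

    φα≡σ : ∀ x → φ (α x) ≡ σ x
    φα≡σ x = cong σ (α-invol x)

    -- Since `φ ∘ α = σ`, this is `σ³ = 1` read around a vertex; it is the source of the relations
    -- between the translations.
    vertex : ∀ x → φ (α (φ (α (φ x)))) ≡ α x
    vertex x = trans (φα≡σ _) (trans (cong σ (φα≡σ _)) (σ-cube (α x)))

    -- Translations by 1, ζ and ζ²: leave the face across the side in that
    -- direction and turn around the new face back to the initial orientation.
    A A⁻ B B⁻ C : D → D
    A x  = φ³ (α x)
    A⁻ x = α (φ³ x)
    B x  = φ (φ (α (φ x)))
    B⁻ x = φ³ (φ (φ (α (φ³ (φ x)))))
    C x  = φ (α (φ (φ x)))

    AA⁻ : ∀ x → A (A⁻ x) ≡ x
    AA⁻ x = trans (cong φ³ (α-invol (φ³ x))) (φ⁶ x)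

    A⁻A : ∀ x → A⁻ (A x) ≡ x
    A⁻A x = trans (cong α (φ⁶ (α x))) (α-invol x)

    BB⁻ : ∀ x → B (B⁻ x) ≡ x
    BB⁻ x = trans (cong (λ z → φ (φ (α z))) (φ⁶ (α (φ³ (φ x))))) (trans (cong (φ ∘ φ) (α-invol _)) (φ⁶ x))

    B⁻B : ∀ x → B⁻ (B x) ≡ x
    B⁻B x = trans (cong (λ z → φ³ (φ (φ (α z)))) (φ⁶ (α (φ x))))
      (trans (cong (φ³ ∘ φ ∘ φ) (α-invol (φ x))) (φ⁶ x))

    -- This is 1 + ζ² = ζ: the faces at 0, ζ² and ζ meet in one vertex, and its relation shortens
    -- the detour.
    AC≡B : ∀ x → A (C x) ≡ B x
    AC≡B x = cong (φ ∘ φ) (vertex (φ x))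

    CA≡B : ∀ x → C (A x) ≡ B x
    CA≡B x = cong φ (sym (trans (cong (φ ∘ α ∘ φ) x≡) (vertex z)))
      where
      z : D
      z = φ (φ (φ³ (α x)))
      x≡ : x ≡ α (φ z)
      x≡ = trans (sym (α-invol x)) (cong α (sym (φ⁶ (α x))))

    -- Both sides are `A ∘ C ∘ A`.
    BA≡AB : ∀ x → B (A x) ≡ A (B x)
    BA≡AB x = trans (sym (AC≡B (A x))) (cong A (CA≡B x))

    dev : D → Pt → D
    dev d (x , y) = pow A A⁻ x (pow B B⁻ y d)

    dev-A : ∀ d x y → A (dev d (x , y)) ≡ dev d (1ℤ + x , y)
    dev-A d x y = pow-suc AA⁻ A⁻A x _

    dev-A⁻ : ∀ d x y → A⁻ (dev d (x , y)) ≡ dev d (-1ℤ + x , y)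
    dev-A⁻ d x y = pow-pred AA⁻ A⁻A x _

    dev-B : ∀ d x y → B (dev d (x , y)) ≡ dev d (x , 1ℤ + y)
    dev-B d x y = trans (pow-comm AA⁻ A⁻A {B} BA≡AB x _) (cong (pow A A⁻ x) (pow-suc BB⁻ B⁻B y d))

    dev-B⁻ : ∀ d x y → B⁻ (dev d (x , y)) ≡ dev d (x , -1ℤ + y)
    dev-B⁻ d x y = trans (pow-comm AA⁻ A⁻A {B⁻} (λ z → sym (commutes-inverse BB⁻ B⁻B {A} (λ w → sym (BA≡AB w)) z)) x _)
      (cong (pow A A⁻ x) (pow-pred BB⁻ B⁻B y d))

    dev-C : ∀ d x y → C (dev d (x , y)) ≡ dev d (-1ℤ + x , 1ℤ + y)
    dev-C d x y = trans (cong C (sym (AA⁻ (dev d (x , y))))) (trans (CA≡B (A⁻ (dev d (x , y))))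
      (trans (cong B (dev-A⁻ d x y)) (dev-B d (-1ℤ + x) y)))

    -- Forward steps suffice: as `A⁻` and `B⁻` cancel, a backward step of `Q` is a forward step read
    -- from its other end. Translating, turning the base dart and applying a morphism all become
    -- instances of this uniqueness.
    dev-unique : ∀ {d} (Q : Pt → D) → Q 𝟎 ≡ d → (∀ x y → A (Q (x , y)) ≡ Q (1ℤ + x , y)) →
                 (∀ x y → B (Q (x , y)) ≡ Q (x , 1ℤ + y)) → ∀ v → dev d v ≡ Q v
    dev-unique {d} Q q0 qA qB (x , y) = ℤ-induction (λ x → dev d (x , y) ≡ Q (x , y))
      (ℤ-induction (λ y → dev d (0ℤ , y) ≡ Q (0ℤ , y)) (sym q0)
        (λ y eq → trans (sym (dev-B d 0ℤ y)) (trans (cong B eq) (qB 0ℤ y)))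
        (λ y eq → trans (sym (dev-B⁻ d 0ℤ y)) (trans (cong B⁻ (trans eq
          (trans (cong (λ z → Q (0ℤ , z)) (sym (1+[-1+i] y))) (sym (qB 0ℤ (-1ℤ + y)))))) (B⁻B _))) y)
      (λ x eq → trans (sym (dev-A d x y)) (trans (cong A eq) (qA x y)))
      (λ x eq → trans (sym (dev-A⁻ d x y)) (trans (cong A⁻ (trans eq
          (trans (cong (λ z → Q (z , y)) (sym (1+[-1+i] x))) (sym (qA (-1ℤ + x) y))))) (A⁻A _))) x

    dev-⊕ : ∀ d v w → dev (dev d v) w ≡ dev d (w ⊕ v)
    dev-⊕ d v@(a , b) = dev-unique (λ w → dev d (w ⊕ v)) (cong (dev d) (⊕-identityˡ v))
      (λ x y → trans (dev-A d (x + a) (y + b)) (cong (λ z → dev d (z , y + b)) (sym (+-assoc 1ℤ x a))))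
      (λ x y → trans (dev-B d (x + a) (y + b)) (cong (λ z → dev d (x + a , z)) (sym (+-assoc 1ℤ y b))))

    -- By definition `A ∘ φ = φ ∘ B` and `B ∘ φ = φ ∘ C`: turning the base dart by 60 degrees turns
    -- the directions 1 and ζ into ζ and ζ².
    dev-φ : ∀ d v → dev (φ d) v ≡ φ (dev d (ζ v))
    dev-φ d = dev-unique (λ v → φ (dev d (ζ v))) refl
      (λ x y → cong φ (trans (dev-B d (- y) (x + y)) (cong (λ z → dev d (- y , z)) (sym (+-assoc 1ℤ x y)))))
      (λ x y → cong φ (trans (dev-C d (- y) (x + y)) (cong₂ (λ s t → dev d (s , t)) (first y) (second x y))))
      where
      first : ∀ y → -1ℤ + - y ≡ - (1ℤ + y)
      first = solve-∀
      second : ∀ x y → 1ℤ + (x + y) ≡ x + (1ℤ + y)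
      second = solve-∀

    dev-φ³ : ∀ d v → dev (φ³ d) v ≡ φ³ (dev d (⊖ v))
    dev-φ³ d v = trans (dev-φ (φ (φ d)) v) (trans (cong φ (dev-φ (φ d) (ζ v)))
      (trans (cong (φ ∘ φ) (dev-φ d (ζ (ζ v)))) (cong (φ³ ∘ dev d) (ζ-cube v))))

    -- The translations in the deck group of the unrolling from `d`.
    Stab : D → Pt → Set
    Stab d v = dev d v ≡ d

    dev-cong : ∀ d u v w → dev d u ≡ dev d v → dev d (w ⊕ u) ≡ dev d (w ⊕ v)
    dev-cong d u v w eq = trans (sym (dev-⊕ d u w)) (trans (cong (λ z → dev z w) eq) (dev-⊕ d v w))

    dev-eq⇒Stab : ∀ d u v → dev d u ≡ dev d v → Stab d (⊖ v ⊕ u)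
    dev-eq⇒Stab d u v eq = trans (dev-cong d u v (⊖ v) eq) (cong (dev d) (⊕-inverseˡ v))

    Stab⇒dev-eq : ∀ d u v → Stab d (⊖ v ⊕ u) → dev d u ≡ dev d v
    Stab⇒dev-eq d u v eq = trans (cong (dev d) (sym u≡)) (trans (dev-cong d (⊖ v ⊕ u) 𝟎 v eq) (cong (dev d) v≡))
      where
      u≡ : v ⊕ (⊖ v ⊕ u) ≡ u
      u≡ = trans (sym (⊕-assoc v (⊖ v) u)) (trans (cong (_⊕ u) (⊕-inverseʳ v)) (⊕-identityˡ u))
      v≡ : v ⊕ 𝟎 ≡ v
      v≡ = trans (⊕-comm v 𝟎) (⊕-identityˡ v)

    Stab-φ : ∀ d v → Stab (φ d) v → Stab d (ζ v)
    Stab-φ d v s = φ-injective (trans (sym (dev-φ d v)) s)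

    Stab-φ⁻ : ∀ d v → Stab d (ζ v) → Stab (φ d) v
    Stab-φ⁻ d v s = trans (dev-φ d v) (cong φ s)

    -- Translations commute, so moving the base dart by `u` leaves the stabiliser unchanged; only
    -- the direction of the base dart matters.
    Stab-dev : ∀ d u v → Stab (dev d u) v → Stab d v
    Stab-dev d u v s = subst (Stab d) (eq u v) (dev-eq⇒Stab d (v ⊕ u) u (trans (sym (dev-⊕ d u v)) s))
      where
      eq₁ : ∀ a b → - a + (b + a) ≡ b
      eq₁ = solve-∀
      eq : ∀ u v → ⊖ u ⊕ (v ⊕ u) ≡ v
      eq (a , b) (c , d) = cong₂ _,_ (eq₁ a c) (eq₁ b d)

    Stab-dev⁻ : ∀ d u v → Stab d v → Stab (dev d u) v
    Stab-dev⁻ d u v s = trans (dev-⊕ d u v) (trans (cong (dev d) (⊕-comm v u)) (trans (sym (dev-⊕ d v u)) (cong (λ z → dev z u) s)))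

  module Based {D : Set} (H : HexMap D) (d : D) (base : Develop.φ³ H d ≡ d) where

    open HexMap H
    open Develop H

    P : Pt → D
    P = dev d

    P-⊖ : ∀ v → φ³ (P v) ≡ P (⊖ v)
    P-⊖ v = sym (trans (cong (λ z → dev z (⊖ v)) (sym base)) (trans (dev-φ³ d (⊖ v)) (cong (φ³ ∘ P) (⊖-involutive v))))

    -- The covering map. Through `P-⊖`, `base` makes it compatible with the half-turn about the
    -- origin that is built into `φ̂`.
    π : Fin 3 × Pt → D
    π (zero , v)           = P v
    π (suc zero , v)       = φ (P v)
    π (suc (suc zero) , v) = φ (φ (P v))

    φ³-cancel : ∀ {x y} → φ³ x ≡ y → x ≡ φ³ y
    φ³-cancel {x} eq = trans (sym (φ⁶ x)) (cong φ³ eq)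

    P-e : Fin 3 → D → D
    P-e zero             = A
    P-e (suc zero)       = B
    P-e (suc (suc zero)) = C

    P-neighbour : ∀ r v → P-e r (P v) ≡ P (e r ⊕ v)
    P-neighbour zero (x , y)             = trans (dev-A d x y) (cong (λ z → P (1ℤ + x , z)) (sym (+-identityˡ y)))
    P-neighbour (suc zero) (x , y)       = trans (dev-B d x y) (cong (λ z → P (z , 1ℤ + y)) (sym (+-identityˡ x)))
    P-neighbour (suc (suc zero)) (x , y) = dev-C d x y

    π-φ : ∀ x → π (φ̂ x) ≡ φ (π x)
    π-φ (zero , v)           = refl
    π-φ (suc zero , v)       = refl
    π-φ (suc (suc zero) , v) = sym (P-⊖ v)

    π-α : ∀ x → π (α̂ x) ≡ α (π x)
    π-α (zero , v) = sym (trans (φ³-cancel (P-neighbour zero v)) (P-⊖ (e zero ⊕ v)))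
    π-α (suc zero , v) = sym (trans
      (φ³-cancel (cong φ (P-neighbour (suc zero) v))) (cong φ (P-⊖ (e (suc zero) ⊕ v))))
    π-α (suc (suc zero) , v) = sym (trans
      (φ³-cancel (cong (φ ∘ φ) (P-neighbour (suc (suc zero)) v))) (cong (φ ∘ φ) (P-⊖ (e (suc (suc zero)) ⊕ v))))

    π-σ : ∀ x → π (σ̂ x) ≡ σ (π x)
    π-σ x = trans (π-φ (α̂ x)) (trans (cong φ (π-α x)) (φα≡σ (π x)))

    -- Each step lifts through `σ̂` or `α̂`, so connectedness makes `π` surjective.
    lift-path : ∀ {x y} → Star (Step σ α) x y → (∃ λ s → π s ≡ x) → ∃ λ s → π s ≡ y
    lift-path ε l = l
    lift-path (σ-step _ ◅ path) (s , eq) = lift-path path (σ̂ s , trans (π-σ s) (cong σ eq))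
    lift-path (α-step _ ◅ path) (s , eq) = lift-path path (α̂ s , trans (π-α s) (cong α eq))

    lift : ∀ x → ∃ λ s → π s ≡ x
    lift x = lift-path (connected d x) ((zero , 𝟎) , refl)

    rotation-shift : ∀ u v w → φ (P u) ≡ P v → φ (P (ζ w ⊕ u)) ≡ P (w ⊕ v)
    rotation-shift u v w eq = begin
      φ (P (ζ w ⊕ u))     ≡⟨ cong φ (dev-⊕ d u (ζ w)) ⟨
      φ (dev (P u) (ζ w)) ≡⟨ dev-φ (P u) w ⟨
      dev (φ (P u)) w     ≡⟨ cong (λ z → dev z w) eq ⟩
      dev (P v) w         ≡⟨ dev-⊕ d v w ⟩
      P (w ⊕ v)           ∎
      where open ≡-Reasoning

    -- A rotation by 60° has its centre at a face, where φ has no fixed point.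
    no-rotation₁ : ∀ u v → φ (P u) ≢ P v
    no-rotation₁ u@(a , b) v@(c , f) eq =
      φ≢ (P (w ⊕ v)) (trans (cong (φ ∘ P) (sym (cong₂ _,_ (first a b c f) (second a b c f)))) (rotation-shift u v w eq))
      where
      -- The solution of `ζ w + u = w + v`, which exists because ζ - 1 = ζ² is a unit.
      w : Pt
      w = ζ (u ⊕ ⊖ v)
      first : ∀ a b c f → - (a + - c + (b + - f)) + a ≡ - (b + - f) + c
      first = solve-∀
      second : ∀ a b c f → - (b + - f) + (a + - c + (b + - f)) + b ≡ a + - c + (b + - f) + f
      second = solve-∀

    -- A rotation by 120° has its centre at a face or at a vertex.
    no-rotation₂ : ∀ u v → φ (φ (P u)) ≢ P v
    no-rotation₂ u@(a , b) v@(c , f) eq = centre (residue-mod-3 (c + - a + - (f + - b)))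
      where
      residue-mod-3 : ∀ z → ∃ λ x → z + + 3 * x ≡ 0ℤ ⊎ z + + 3 * x ≡ 1ℤ ⊎ z + + 3 * x ≡ -1ℤ
      residue-mod-3 = ℤ-induction _ (0ℤ , inj₁ refl)
        (λ { i (x , inj₁ eq) → x , inj₂ (inj₁ (trans (up i x) (cong (λ z → 1ℤ + z) eq)))
           ; i (x , inj₂ (inj₁ eq)) → -1ℤ + x , inj₂ (inj₂ (trans (wrap i x) (cong (λ z → -1ℤ + (-1ℤ + z)) eq)))
           ; i (x , inj₂ (inj₂ eq)) → x , inj₁ (trans (up i x) (cong (λ z → 1ℤ + z) eq)) })
        (λ { i (x , inj₁ eq) → x , inj₂ (inj₂ (trans (down i x) (cong (λ z → -1ℤ + z) eq)))
           ; i (x , inj₂ (inj₁ eq)) → x , inj₁ (trans (down i x) (cong (λ z → -1ℤ + z) eq))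
           ; i (x , inj₂ (inj₂ eq)) → 1ℤ + x , inj₂ (inj₁ (trans (wrap⁻ i x) (cong (λ z → 1ℤ + (1ℤ + z)) eq))) })
        where
        up : ∀ i x → 1ℤ + i + + 3 * x ≡ 1ℤ + (i + + 3 * x)
        up = solve-∀
        down : ∀ i x → -1ℤ + i + + 3 * x ≡ -1ℤ + (i + + 3 * x)
        down = solve-∀
        wrap : ∀ i x → 1ℤ + i + + 3 * (-1ℤ + x) ≡ -1ℤ + (-1ℤ + (i + + 3 * x))
        wrap = solve-∀
        wrap⁻ : ∀ i x → -1ℤ + i + + 3 * (1ℤ + x) ≡ 1ℤ + (1ℤ + (i + + 3 * x))
        wrap⁻ = solve-∀
      -- As ζ² - 1 has norm 3, the analogous equation is solvable for one residue in three only. The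
      -- choice of `w` makes the second coordinates of `p` and `q` equal; the first ones differ by a
      -- number that `x` moves in steps of 3, hence to 0, 1 or -1.
      module Shifted (x : ℤ) where
        w p q : Pt
        w = x , x + - (f + - b)
        p = ζ (ζ w) ⊕ u
        q = w ⊕ v
        moved : φ (φ (P p)) ≡ P q
        moved = begin
          φ (φ (P p))                 ≡⟨ cong (φ ∘ φ) (dev-⊕ d u (ζ (ζ w))) ⟨
          φ (φ (dev (P u) (ζ (ζ w)))) ≡⟨ cong φ (dev-φ (P u) (ζ w)) ⟨
          φ (dev (φ (P u)) (ζ w))     ≡⟨ dev-φ (φ (P u)) w ⟨
          dev (φ (φ (P u))) w         ≡⟨ cong (λ z → dev z w) eq ⟩
          dev (P v) w                 ≡⟨ dev-⊕ d v w ⟩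
          P q                         ∎
          where open ≡-Reasoning
        q≡ : ∀ {k} → c + - a + - (f + - b) + + 3 * x ≡ k → q ≡ (k , 0ℤ) ⊕ p
        q≡ refl = cong₂ _,_ (first x a b c f) (second x b f)
          where
          first : ∀ x a b c f → x + c ≡ c + - a + - (f + - b) + + 3 * x + (- (x + (x + - (f + - b))) + a)
          first = solve-∀
          second : ∀ x b f → x + - (f + - b) + f ≡ 0ℤ + (- (x + - (f + - b)) + (x + (x + - (f + - b))) + b)
          second = solve-∀
      centre : (∃ λ x → c + - a + - (f + - b) + + 3 * x ≡ 0ℤ ⊎ c + - a + - (f + - b) + + 3 * x ≡ 1ℤ
                      ⊎ c + - a + - (f + - b) + + 3 * x ≡ -1ℤ) → ⊥
      centre (x , inj₁ k) = φφ≢ (P p) (trans moved (cong P (trans (q≡ k) (⊕-identityˡ p))))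
        where open Shifted x
      centre (x , inj₂ (inj₁ k)) = σ-fix (P p) (trans (sym (φα≡σ (P p)))
        (trans (cong φ (φ³-cancel (trans (P-neighbour zero p) (trans (cong P (sym (q≡ k))) (sym moved))))) (φ⁶ (P p))))
        where open Shifted x
      centre (x , inj₂ (inj₂ k)) = σ-fix (φ³ (P p)) (trans (sym (φα≡σ (φ³ (P p))))
        (cong φ (trans (dev-A⁻ d (proj₁ p) (proj₂ p)) (trans (cong (λ z → P (-1ℤ + proj₁ p , z)) (sym (+-identityˡ (proj₂ p))))
          (trans (cong P (sym (q≡ k))) (sym moved))))))
        where open Shifted x

    -- A coincidence of two different sides would put a rotation by 60 or 120 degrees into the deck
    -- group.
    π-injective : ∀ r s u v → π (r , u) ≡ π (s , v) → r ≡ s × P u ≡ P v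
    π-injective zero zero u v eq = refl , eq
    π-injective zero (suc zero) u v eq = ⊥-elim (no-rotation₁ v u (sym eq))
    π-injective zero (suc (suc zero)) u v eq = ⊥-elim (no-rotation₂ v u (sym eq))
    π-injective (suc zero) zero u v eq = ⊥-elim (no-rotation₁ u v eq)
    π-injective (suc zero) (suc zero) u v eq = refl , φ-injective eq
    π-injective (suc zero) (suc (suc zero)) u v eq = ⊥-elim (no-rotation₁ v u (φ-injective (sym eq)))
    π-injective (suc (suc zero)) zero u v eq = ⊥-elim (no-rotation₂ u v eq)
    π-injective (suc (suc zero)) (suc zero) u v eq = ⊥-elim (no-rotation₁ u v (φ-injective eq))
    π-injective (suc (suc zero)) (suc (suc zero)) u v eq = refl , φ-injective (φ-injective eq)

    π-cong : ∀ r u v → P u ≡ P v → π (r , u) ≡ π (r , v)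
    π-cong zero u v             eq = eq
    π-cong (suc zero) u v       eq = cong φ eq
    π-cong (suc (suc zero)) u v eq = cong (φ ∘ φ) eq

    -- The half-turn about u + e r / 2 would fix an edge.
    no-half-turn : ∀ r u → ¬ Stab d (u ⊕ (e r ⊕ u))
    no-half-turn r u s = α-fix (π (r , u)) (trans (sym (π-α (r , u))) (π-cong r (⊖ (e r ⊕ u)) u (sym
      (Stab⇒dev-eq d u (⊖ (e r ⊕ u)) (subst (Stab d) (trans (⊕-comm u (e r ⊕ u)) (cong (_⊕ u) (sym (⊖-involutive (e r ⊕ u))))) s)))))

  module _ {D D′ : Set} (H : HexMap D) (H′ : HexMap D′) (f : D → D′)
    (f-σ : ∀ x → f (HexMap.σ H x) ≡ HexMap.σ H′ (f x)) (f-α : ∀ x → f (HexMap.α H x) ≡ HexMap.α H′ (f x)) where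

    private
      module M  = HexMap H
      module M′ = HexMap H′
      module T  = Develop H
      module T′ = Develop H′

    morphism-φ : ∀ x → f (M.φ x) ≡ M′.φ (f x)
    morphism-φ x = trans (f-σ (M.α x)) (cong M′.σ (f-α x))

    morphism-φ³ : ∀ x → f (T.φ³ x) ≡ T′.φ³ (f x)
    morphism-φ³ x = trans (morphism-φ _) (cong M′.φ (trans (morphism-φ _) (cong M′.φ (morphism-φ x))))

    morphism-dev : ∀ d v → f (T.dev d v) ≡ T′.dev (f d) v
    morphism-dev d v = sym (T′.dev-unique (λ v → f (T.dev d v)) refl
      (λ x y → trans (sym (f-A _)) (cong f (T.dev-A d x y)))
      (λ x y → trans (sym (f-B _)) (cong f (T.dev-B d x y))) v)
      where
      f-A : ∀ x → f (T.A x) ≡ T′.A (f x)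
      f-A x = trans (morphism-φ³ (M.α x)) (cong T′.φ³ (f-α x))
      f-B : ∀ x → f (T.B x) ≡ T′.B (f x)
      f-B x = trans (morphism-φ _) (cong M′.φ (trans (morphism-φ _) (cong M′.φ (trans (f-α _) (cong M′.α (morphism-φ x))))))

  -- Both maps are quotients of the same universal map, and by `π-injective` the stabiliser
  -- determines which of its darts get identified. So lifting through one `π` and projecting by the
  -- other does not depend on the lift.
  module Compare {D D′ : Set} (H : HexMap D) (H′ : HexMap D′) {d : D} {d′ : D′}
    (base : Develop.φ³ H d ≡ d) (base′ : Develop.φ³ H′ d′ ≡ d′)
    (S⊆S′ : ∀ v → Develop.Stab H d v → Develop.Stab H′ d′ v)
    (S′⊆S : ∀ v → Develop.Stab H′ d′ v → Develop.Stab H d v) where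

    private
      module B  = Based H d base
      module B′ = Based H′ d′ base′

      π⇒π′ : ∀ s t → B.π s ≡ B.π t → B′.π s ≡ B′.π t
      π⇒π′ (r , u) (r′ , v) eq with B.π-injective r r′ u v eq
      ... | refl , eq′ = B′.π-cong r u v (Develop.Stab⇒dev-eq H′ d′ u v (S⊆S′ (⊖ v ⊕ u) (Develop.dev-eq⇒Stab H d u v eq′)))

      π′⇒π : ∀ s t → B′.π s ≡ B′.π t → B.π s ≡ B.π t
      π′⇒π (r , u) (r′ , v) eq with B′.π-injective r r′ u v eq
      ... | refl , eq′ = B.π-cong r u v (Develop.Stab⇒dev-eq H d u v (S′⊆S (⊖ v ⊕ u) (Develop.dev-eq⇒Stab H′ d′ u v eq′)))

      f : D → D′
      f x = B′.π (proj₁ (B.lift x))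

      g : D′ → D
      g y = B.π (proj₁ (B′.lift y))

      f-π : ∀ s → f (B.π s) ≡ B′.π s
      f-π s = π⇒π′ (proj₁ (B.lift (B.π s))) s (proj₂ (B.lift (B.π s)))

      g-π : ∀ s → g (B′.π s) ≡ B.π s
      g-π s = π′⇒π (proj₁ (B′.lift (B′.π s))) s (proj₂ (B′.lift (B′.π s)))

    bijection : D ↔ D′
    bijection = mk↔ₛ′ f g
      (λ y → trans (f-π (proj₁ (B′.lift y))) (proj₂ (B′.lift y)))
      (λ x → trans (g-π (proj₁ (B.lift x))) (proj₂ (B.lift x)))

    bijection-σ : ∀ x → Inverse.to bijection (HexMap.σ H x) ≡ HexMap.σ H′ (Inverse.to bijection x)
    bijection-σ x = trans (cong (f ∘ HexMap.σ H) (sym (proj₂ (B.lift x))))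
      (trans (cong f (sym (B.π-σ s))) (trans (f-π (σ̂ s)) (B′.π-σ s)))
      where
      s : Fin 3 × Pt
      s = proj₁ (B.lift x)

    bijection-α : ∀ x → Inverse.to bijection (HexMap.α H x) ≡ HexMap.α H′ (Inverse.to bijection x)
    bijection-α x = trans (cong (f ∘ HexMap.α H) (sym (proj₂ (B.lift x))))
      (trans (cong f (sym (B.π-α s))) (trans (f-π (α̂ s)) (B′.π-α s)))
      where
      s : Fin 3 × Pt
      s = proj₁ (B.lift x)

-- Sublattices of Λ: normal forms, finite quotients, uniqueness.

module Lattices where

  open Arithmetic using (residue-unique)
  open Developing
  open import Data.Integer using (ℤ; +_; -[1+_]; ∣_∣; _+_; _*_; -_; 0ℤ; 1ℤ; -1ℤ)
  open import Data.Integer.Properties using (+-injective; pos-+; pos-*; *-cancelˡ-≡; *-zeroʳ; *-zeroˡ; abs-*)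
  open import Data.Integer.DivMod using (_/ℕ_; _%ℕ_; n%ℕd<d; a≡a%ℕn+[a/ℕn]*n)
  open import Data.Integer.Tactic.RingSolver using (solve-∀)
  open import Data.Nat as ℕ using (ℕ; zero; suc; NonZero; _<_; s≤s)
  import Data.Nat.Properties as ℕ
  open import Data.Nat.Divisibility using (divides; ∣-antisym)
  open import Data.Fin as Fin using (Fin; toℕ; fromℕ<; combine; remQuot)
  open import Data.Fin.Properties using (toℕ<n; toℕ-fromℕ<; toℕ-injective; remQuot-combine; combine-remQuot)
  open import Data.Product using (∃; ∃₂; _×_; _,_; proj₁; proj₂)
  open import Data.Sum using (_⊎_; inj₁; inj₂)
  open import Data.Empty using (⊥-elim)
  open import Function using (_∘_)
  open import Relation.Nullary using (¬_; Dec; yes; no)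
  open import Relation.Binary.PropositionalEquality

  Triple : Set
  Triple = ℕ × ℕ × ℕ

  Lat : Triple → Pt → Set
  Lat (a , d , b) (x , y) = ∃₂ λ t u → x ≡ + b * t + + d * u × y ≡ + a * t

  double : Triple → Triple
  double (a , d , b) = 2 ℕ.* a , 2 ℕ.* d , 2 ℕ.* b

  record Subgroup (L : Pt → Set) : Set where
    field
      L-𝟎 : L 𝟎
      L-⊕ : ∀ u v → L u → L v → L (u ⊕ v)
      L-⊖ : ∀ u → L u → L (⊖ u)

  Lat-subgroup : ∀ s → Subgroup (Lat s)
  Lat-subgroup (a , d , b) = record
    { L-𝟎 = 0ℤ , 0ℤ , zero₂ (+ b) (+ d) , sym (*-zeroʳ (+ a))
    ; L-⊕ = λ { _ _ (t , u , refl , refl) (t′ , u′ , refl , refl) →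
                t + t′ , u + u′ , add (+ b) (+ d) t u t′ u′ , add₁ (+ a) t t′ }
    ; L-⊖ = λ { _ (t , u , refl , refl) → - t , - u , neg (+ b) (+ d) t u , neg₁ (+ a) t }
    }
    where
    zero₂ : ∀ b d → 0ℤ ≡ b * 0ℤ + d * 0ℤ
    zero₂ = solve-∀
    add : ∀ b d t u t′ u′ → b * t + d * u + (b * t′ + d * u′) ≡ b * (t + t′) + d * (u + u′)
    add = solve-∀
    add₁ : ∀ a t t′ → a * t + a * t′ ≡ a * (t + t′)
    add₁ = solve-∀
    neg : ∀ b d t u → - (b * t + d * u) ≡ b * - t + d * - u
    neg = solve-∀
    neg₁ : ∀ a t → - (a * t) ≡ a * - t
    neg₁ = solve-∀

  twice : ∀ b t → + (2 ℕ.* b) * t ≡ + b * t + + b * t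
  twice b t = trans (cong (_* t) (pos-* 2 b)) (expand (+ b) t)
    where
    expand : ∀ b t → + 2 * b * t ≡ b * t + b * t
    expand = solve-∀

  private
    interchange : ∀ x y → x + x + (y + y) ≡ x + y + (x + y)
    interchange = solve-∀

  Lat-double⁺ : ∀ s m → Lat s m → Lat (double s) (m ⊕ m)
  Lat-double⁺ (a , d , b) _ (t , u , refl , refl) =
    t , u , sym (trans (cong₂ _+_ (twice b t) (twice d u)) (interchange (+ b * t) (+ d * u))) , sym (twice a t)

  Lat-even : ∀ s v → Lat (double s) v → ∃ λ m → Lat s m × v ≡ m ⊕ m
  Lat-even (a , d , b) _ (t , u , refl , refl) = (+ b * t + + d * u , + a * t) , (t , u , refl , refl) ,
    cong₂ _,_ (trans (cong₂ _+_ (twice b t) (twice d u)) (interchange (+ b * t) (+ d * u))) (twice a t)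

  halve : ∀ {x y : ℤ} → x + x ≡ y + y → x ≡ y
  halve {x} {y} eq = *-cancelˡ-≡ (+ 2) x y (trans (two x) (trans eq (sym (two y))))
    where
    two : ∀ x → + 2 * x ≡ x + x
    two = solve-∀

  Lat-double⁻ : ∀ s m → Lat (double s) (m ⊕ m) → Lat s m
  Lat-double⁻ s (x , y) l with Lat-even s _ l
  ... | (x′ , y′) , l′ , eq = subst (Lat s) (cong₂ _,_ (sym (halve (cong proj₁ eq))) (sym (halve (cong proj₂ eq)))) l′

  small-unique : ∀ {a m n} t → m < a → n < a → - + m + + n ≡ + a * t → m ≡ n
  small-unique {a} {m} {n} (+ k) m< n< eq = residue-unique {k = k} {l = 0} m< n<
    (+-injective (trans (trans (pos-+ m (k ℕ.* a)) (cong (λ z → + m + z) (pos-* k a)))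
      (trans (e₁ (+ m) (+ k) (+ a)) (trans (cong (λ z → + m + z) (sym eq))
        (trans (e₂ (+ m) (+ n)) (cong +_ (sym (ℕ.+-identityʳ n))))))))
    where
    e₁ : ∀ m k a → m + k * a ≡ m + a * k
    e₁ = solve-∀
    e₂ : ∀ m n → m + (- m + n) ≡ n
    e₂ = solve-∀
  small-unique {a} {m} {n} -[1+ k ] m< n< eq = residue-unique {k = 0} {l = suc k} m< n<
    (+-injective (trans (cong +_ (ℕ.+-identityʳ m)) (trans (e₁ (+ m) (+ n))
      (trans (cong (λ z → + n + - z) eq) (trans (e₂ (+ n) (+ a) (+ suc k))
        (sym (trans (pos-+ n (suc k ℕ.* a)) (cong (λ z → + n + z) (pos-* (suc k) a)))))))))
    where
    e₁ : ∀ m n → m ≡ n + - (- m + n)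
    e₁ = solve-∀
    e₂ : ∀ n a k → n + - (a * - k) ≡ n + k * a
    e₂ = solve-∀

  -- A class map with a section takes the place of a quotient type and puts the classes into
  -- `Fin V`, from which the darts are built.
  record Quotient (L : Pt → Set) (V : ℕ) : Set where
    field
      class    : Pt → Fin V
      point    : Fin V → Pt
      class-point : ∀ i → class (point i) ≡ i
      class⇒L  : ∀ u v → class u ≡ class v → L (⊖ v ⊕ u)
      L⇒class  : ∀ u v → L (⊖ v ⊕ u) → class u ≡ class v

  module _ (a d b : ℕ) .{{_ : NonZero a}} .{{_ : NonZero d}} where

    private
      L : Pt → Set
      L = Lat (a , d , b)

      open Subgroup (Lat-subgroup (a , d , b))

      rep : Fin a × Fin d → Pt
      rep (i , j) = + toℕ j , + toℕ i

      -- Removing `y / a` copies of `(b , a)` shifts the abscissa, so `y` is reduced before `x`.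
      reduce : Pt → Fin a × Fin d
      reduce (x , y) = fromℕ< (n%ℕd<d y a) , fromℕ< (n%ℕd<d (x + - (+ b * (y /ℕ a))) d)

      reduce-L : ∀ v → L (⊖ rep (reduce v) ⊕ v)
      reduce-L (x , y) = y /ℕ a , z /ℕ d ,
        trans (cong (λ w → - + w + x) (toℕ-fromℕ< (n%ℕd<d z d)))
          (trans (e₁ x (+ b * (y /ℕ a)) (+ (z %ℕ d)))
            (trans (cong (λ w → + b * (y /ℕ a) + (w + - + (z %ℕ d))) (a≡a%ℕn+[a/ℕn]*n z d))
              (e₂ (+ b * (y /ℕ a)) (+ (z %ℕ d)) (z /ℕ d) (+ d)))) ,
        trans (cong (λ w → - + w + y) (toℕ-fromℕ< (n%ℕd<d y a)))
          (trans (cong (λ w → - + (y %ℕ a) + w) (a≡a%ℕn+[a/ℕn]*n y a)) (e₃ (+ (y %ℕ a)) (y /ℕ a) (+ a)))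
        where
        z : ℤ
        z = x + - (+ b * (y /ℕ a))
        e₁ : ∀ x c r → - r + x ≡ c + (x + - c + - r)
        e₁ = solve-∀
        e₂ : ∀ c r q d → c + (r + q * d + - r) ≡ c + d * q
        e₂ = solve-∀
        e₃ : ∀ r q a → - r + (r + q * a) ≡ a * q
        e₃ = solve-∀

      -- The heights agree modulo `a`, hence agree, which forces `t = 0`; then the abscissas agree
      -- modulo `d`.
      rep-unique : ∀ s s′ → L (⊖ rep s ⊕ rep s′) → s ≡ s′
      rep-unique (i , j) (i′ , j′) (t , u , ex , ey)
        with toℕ-injective (small-unique t (toℕ<n i) (toℕ<n i′) ey)
      ... | refl = cong (i ,_) (toℕ-injective (small-unique u (toℕ<n j) (toℕ<n j′)
            (trans ex (trans (cong (λ w → + b * w + + d * u) t≡0) (e₁ (+ b) (+ d * u))))))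
        where
        e₀ : ∀ x → - x + x ≡ 0ℤ
        e₀ = solve-∀
        t≡0 : t ≡ 0ℤ
        t≡0 = *-cancelˡ-≡ (+ a) t 0ℤ (trans (sym ey) (trans (e₀ (+ toℕ i)) (sym (*-zeroʳ (+ a)))))
        e₁ : ∀ b z → b * 0ℤ + z ≡ z
        e₁ = solve-∀

      telescope : ∀ u v w → (⊖ u ⊕ v) ⊕ (⊖ v ⊕ w) ≡ ⊖ u ⊕ w
      telescope (a , b) (c , d) (x , y) = cong₂ _,_ (go a c x) (go b d y)
        where
        go : ∀ a c x → (- a + c) + (- c + x) ≡ - a + x
        go = solve-∀

      flip : ∀ u v → ⊖ (⊖ u ⊕ v) ≡ ⊖ v ⊕ u
      flip (a , b) (c , d) = cong₂ _,_ (go a c) (go b d)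
        where
        go : ∀ a c → - (- a + c) ≡ - c + a
        go = solve-∀

      chain : ∀ u v w → L (⊖ u ⊕ v) → L (⊖ v ⊕ w) → L (⊖ u ⊕ w)
      chain u v w p q = subst L (telescope u v w) (L-⊕ (⊖ u ⊕ v) (⊖ v ⊕ w) p q)

      turn : ∀ u v → L (⊖ u ⊕ v) → L (⊖ v ⊕ u)
      turn u v p = subst L (flip u v) (L-⊖ (⊖ u ⊕ v) p)

    Lat-quotient : Quotient L (a ℕ.* d)
    Lat-quotient = record
      { class = λ v → combine (proj₁ (reduce v)) (proj₂ (reduce v))
      ; point = λ i → rep (remQuot d i)
      ; class-point = λ i → trans (cong (λ (i , j) → combine i j)
          (rep-unique (reduce (rep (remQuot d i))) (remQuot d i) (reduce-L (rep (remQuot d i))))) (combine-remQuot {a} d i)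
      ; class⇒L = λ u v eq → chain v (rep (reduce v)) u (turn (rep (reduce v)) v (reduce-L v))
          (subst (λ s → L (⊖ rep s ⊕ u))
            (trans (sym (remQuot-combine {a} {d} _ _)) (trans (cong (remQuot d) eq) (remQuot-combine {a} {d} _ _)))
            (reduce-L u))
      ; L⇒class = λ u v l → cong (λ (i , j) → combine i j) (rep-unique (reduce u) (reduce v)
          (chain (rep (reduce u)) u (rep (reduce v)) (reduce-L u)
            (chain u v (rep (reduce v)) (turn v u l) (turn (rep (reduce v)) v (reduce-L v)))))
      }

  least : {Q : ℕ → Set} → (∀ k → Dec (Q k)) → ∀ N → Q N → ∃ λ k → Q k × (∀ j → j < k → ¬ Q j)
  least {Q} Q? N q = search N 0 (ℕ.+-identityʳ N) (λ _ ())
    where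
    search : ∀ fuel k → fuel ℕ.+ k ≡ N → (∀ j → j < k → ¬ Q j) → ∃ λ k → Q k × (∀ j → j < k → ¬ Q j)
    search zero k refl below = k , q , below
    search (suc fuel) k eq below with Q? k
    ... | yes qk = k , qk , below
    ... | no ¬qk = search fuel (suc k) (trans (ℕ.+-suc fuel k) eq) below′
      where
      below′ : ∀ j → j < suc k → ¬ Q j
      below′ j (s≤s j≤k) with ℕ.m≤n⇒m<n∨m≡n j≤k
      ... | inj₁ j<k  = below j j<k
      ... | inj₂ refl = ¬qk

  -- The lattice is given only as a decidable predicate, so its normal form is found by search. The
  -- vectors of lengths `N` and `N′` on the axes witness finite index and bound the two searches.
  module Extract {L : Pt → Set} (L? : ∀ v → Dec (L v)) (sub : Subgroup L)
    (N N′ : ℕ) (N≢0 : N ≢ 0) (N′≢0 : N′ ≢ 0) (LN : L (+ N , 0ℤ)) (LN′ : L (0ℤ , + N′)) where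

    open Subgroup sub

    infixr 7 _·_
    _·_ : ℤ → Pt → Pt
    k · (x , y) = k * x , k * y

    L-· : ∀ k v → L v → L (k · v)
    L-· k v@(x , y) l = ℤ-induction (λ k → L (k · v)) (subst L (cong₂ _,_ (sym (*-zeroˡ x)) (sym (*-zeroˡ y))) L-𝟎)
      (λ i li → subst L (cong₂ _,_ (up i x) (up i y)) (L-⊕ v (i · v) l li))
      (λ i li → subst L (cong₂ _,_ (down i x) (down i y)) (L-⊕ (⊖ v) (i · v) (L-⊖ v l) li)) k
      where
      up : ∀ i x → x + i * x ≡ (1ℤ + i) * x
      up = solve-∀
      down : ∀ i x → - x + i * x ≡ (-1ℤ + i) * x
      down = solve-∀

    private
      horizontal : ∃ λ d → (d ≢ 0 × L (+ d , 0ℤ)) × (∀ j → j < d → ¬ (j ≢ 0 × L (+ j , 0ℤ)))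
      horizontal = least (λ d → nonzero? d (L? (+ d , 0ℤ))) N (N≢0 , LN)
        where
        nonzero? : ∀ d → Dec (L (+ d , 0ℤ)) → Dec (d ≢ 0 × L (+ d , 0ℤ))
        nonzero? zero    _       = no (λ (n , _) → n refl)
        nonzero? (suc d) (yes l) = yes ((λ ()) , l)
        nonzero? (suc d) (no ¬l) = no (¬l ∘ proj₂)

    d : ℕ
    d = proj₁ horizontal

    instance
      d≢0 : NonZero d
      d≢0 = ℕ.≢-nonZero (proj₁ (proj₁ (proj₂ horizontal)))

    Ld : L (+ d , 0ℤ)
    Ld = proj₂ (proj₁ (proj₂ horizontal))

    reduce-x : ∀ x y → L (x , y) → L (+ (x %ℕ d) , y)
    reduce-x x y l = subst L (cong₂ _,_ (trans (cong (λ z → z + - (x /ℕ d) * + d) (a≡a%ℕn+[a/ℕn]*n x d))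
        (e₁ (+ (x %ℕ d)) (x /ℕ d) (+ d))) (e₂ y (x /ℕ d)))
      (L-⊕ (x , y) (- (x /ℕ d) · (+ d , 0ℤ)) l (L-· (- (x /ℕ d)) (+ d , 0ℤ) Ld))
      where
      e₁ : ∀ r q d → r + q * d + - q * d ≡ r
      e₁ = solve-∀
      e₂ : ∀ y q → y + - q * 0ℤ ≡ y
      e₂ = solve-∀

    private
      -- Bounding `b` by `d` makes the search decidable and loses nothing, since `reduce-x` brings
      -- any abscissa into this range.
      Height : ℕ → Set
      Height a = a ≢ 0 × ∃ λ b → b < d × L (+ b , + a)

      vertical : ∃ λ a → Height a × (∀ j → j < a → ¬ Height j)
      vertical = least (λ a → nonzero? a (ℕ.anyUpTo? (λ b → L? (+ b , + a)) d)) N′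
        (N′≢0 , 0 , ℕ.>-nonZero⁻¹ d , LN′)
        where
        nonzero? : ∀ a → Dec (∃ λ b → b < d × L (+ b , + a)) → Dec (Height a)
        nonzero? zero    _       = no (λ (n , _) → n refl)
        nonzero? (suc a) (yes l) = yes ((λ ()) , l)
        nonzero? (suc a) (no ¬l) = no (¬l ∘ proj₂)

    a b : ℕ
    a = proj₁ vertical
    b = proj₁ (proj₂ (proj₁ (proj₂ vertical)))

    b<d : b < d
    b<d = proj₁ (proj₂ (proj₂ (proj₁ (proj₂ vertical))))

    instance
      a≢0 : NonZero a
      a≢0 = ℕ.≢-nonZero (proj₁ (proj₁ (proj₂ vertical)))

    Lba : L (+ b , + a)
    Lba = proj₂ (proj₂ (proj₂ (proj₁ (proj₂ vertical))))

    Lat⇒L : ∀ v → Lat (a , d , b) v → L v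
    Lat⇒L _ (t , u , refl , refl) = subst L (cong₂ _,_ (e₁ (+ b) (+ d) t u) (e₂ (+ a) t u))
      (L-⊕ (t · (+ b , + a)) (u · (+ d , 0ℤ)) (L-· t (+ b , + a) Lba) (L-· u (+ d , 0ℤ) Ld))
      where
      e₁ : ∀ b d t u → t * b + u * d ≡ b * t + d * u
      e₁ = solve-∀
      e₂ : ∀ a t u → t * a + u * 0ℤ ≡ a * t
      e₂ = solve-∀

    private
      zero-or-not : ∀ n → n ≡ 0 ⊎ n ≢ 0
      zero-or-not zero    = inj₁ refl
      zero-or-not (suc n) = inj₂ (λ ())

    L-horizontal : ∀ x → L (x , 0ℤ) → ∃ λ u → x ≡ + d * u
    L-horizontal x l with zero-or-not (x %ℕ d)
    ... | inj₂ ≢0 = ⊥-elim (proj₂ (proj₂ horizontal) (x %ℕ d) (n%ℕd<d x d) (≢0 , reduce-x x 0ℤ l))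
    ... | inj₁ ≡0 = x /ℕ d , trans (a≡a%ℕn+[a/ℕn]*n x d) (trans (cong (λ r → + r + (x /ℕ d) * + d) ≡0) (e₁ (x /ℕ d) (+ d)))
      where
      e₁ : ∀ q d → 0ℤ + q * d ≡ d * q
      e₁ = solve-∀

    -- Division by the least height: a nonzero remainder of `y` would be a smaller height. With
    -- remainder zero, subtracting a multiple of `(b , a)` leaves a horizontal vector.
    L⇒Lat : ∀ v → L v → Lat (a , d , b) v
    L⇒Lat (x , y) l with zero-or-not (y %ℕ a)
    ... | inj₂ ≢0 = ⊥-elim (proj₂ (proj₂ vertical) (y %ℕ a) (n%ℕd<d y a)
            (≢0 , x′ %ℕ d , n%ℕd<d x′ d , reduce-x x′ (+ (y %ℕ a)) l′))
      where
      q : ℤ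
      q = y /ℕ a
      x′ : ℤ
      x′ = x + - q * + b
      e₁ : ∀ r q a → r + q * a + - q * a ≡ r
      e₁ = solve-∀
      l′ : L (x′ , + (y %ℕ a))
      l′ = subst L (cong (x′ ,_) (trans (cong (λ z → z + - q * + a) (a≡a%ℕn+[a/ℕn]*n y a)) (e₁ (+ (y %ℕ a)) q (+ a))))
        (L-⊕ (x , y) (- q · (+ b , + a)) l (L-· (- q) (+ b , + a) Lba))
    ... | inj₁ ≡0 = q , proj₁ hor , trans (e₂ x q (+ b)) (cong (λ z → + b * q + z) (proj₂ hor)) , y≡
      where
      q : ℤ
      q = y /ℕ a
      y≡ : y ≡ + a * q
      y≡ = trans (a≡a%ℕn+[a/ℕn]*n y a) (trans (cong (λ r → + r + q * + a) ≡0) (e₁ q (+ a)))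
        where
        e₁ : ∀ q d → 0ℤ + q * d ≡ d * q
        e₁ = solve-∀
      e₂ : ∀ x q b → x ≡ b * q + (x + - q * b)
      e₂ = solve-∀
      e₃ : ∀ a q → a * q + - q * a ≡ 0ℤ
      e₃ = solve-∀
      hor : ∃ λ u → x + - q * + b ≡ + d * u
      hor = L-horizontal (x + - q * + b)
        (subst L (cong (x + - q * + b ,_) (trans (cong (λ z → z + - q * + a) y≡) (e₃ (+ a) q)))
          (L-⊕ (x , y) (- q · (+ b , + a)) l (L-· (- q) (+ b , + a) Lba)))

  pos-∣-antisym : ∀ m n → (∃ λ t → + m ≡ + n * t) → (∃ λ u → + n ≡ + m * u) → m ≡ n
  pos-∣-antisym m n (t , p) (u , q) = ∣-antisym
    (divides ∣ u ∣ (trans (cong ∣_∣ q) (trans (abs-* (+ m) u) (ℕ.*-comm m ∣ u ∣))))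
    (divides ∣ t ∣ (trans (cong ∣_∣ p) (trans (abs-* (+ n) t) (ℕ.*-comm n ∣ t ∣))))

  -- The lattice alone determines `a` as the generator of its heights, `d` as the generator of its
  -- horizontal vectors, and `b` modulo `d` as the abscissa of its vectors at height `a`.
  Lat-unique : ∀ {a d b a′ d′ b′} .{{_ : NonZero a}} .{{_ : NonZero d}} .{{_ : NonZero a′}} .{{_ : NonZero d′}} →
    b < d → b′ < d′ →
    (∀ v → Lat (a , d , b) v → Lat (a′ , d′ , b′) v) → (∀ v → Lat (a′ , d′ , b′) v → Lat (a , d , b) v) →
    (a , d , b) ≡ (a′ , d′ , b′)
  Lat-unique {a} {d} {b} {a′} {d′} {b′} b< b′< to from = cong₂ _,_ a≡ (cong₂ _,_ d≡ b≡)
    where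
    one₁ : ∀ b d → b ≡ b * 1ℤ + d * 0ℤ
    one₁ = solve-∀
    one₂ : ∀ a → a ≡ a * 1ℤ
    one₂ = solve-∀
    one₃ : ∀ b d → d ≡ b * 0ℤ + d * 1ℤ
    one₃ = solve-∀
    diagonal : ∀ a d b → Lat (a , d , b) (+ b , + a)
    diagonal a d b = 1ℤ , 0ℤ , one₁ (+ b) (+ d) , one₂ (+ a)
    flat : ∀ a d b → Lat (a , d , b) (+ d , 0ℤ)
    flat a d b = 0ℤ , 1ℤ , one₃ (+ b) (+ d) , sym (*-zeroʳ (+ a))
    drop : ∀ b z → b * 0ℤ + z ≡ z
    drop = solve-∀
    flat⁻ : ∀ a d b x .{{_ : NonZero a}} → Lat (a , d , b) (x , 0ℤ) → ∃ λ u → x ≡ + d * u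
    flat⁻ a d b x (t , u , ex , ey) = u , trans ex (trans (cong (λ z → + b * z + + d * u) t≡0) (drop (+ b) (+ d * u)))
      where
      t≡0 : t ≡ 0ℤ
      t≡0 = *-cancelˡ-≡ (+ a) t 0ℤ (trans (sym ey) (sym (*-zeroʳ (+ a))))
    height : ∀ a d b x y → Lat (a , d , b) (x , y) → ∃ λ t → y ≡ + a * t
    height a d b x y (t , _ , _ , ey) = t , ey
    a≡ : a ≡ a′
    a≡ = pos-∣-antisym a a′ (height a′ d′ b′ _ _ (to (+ b , + a) (diagonal a d b)))
                            (height a d b _ _ (from (+ b′ , + a′) (diagonal a′ d′ b′)))
    d≡ : d ≡ d′
    d≡ = pos-∣-antisym d d′ (flat⁻ a′ d′ b′ _ (to (+ d , 0ℤ) (flat a d b)))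
                            (flat⁻ a d b _ (from (+ d′ , 0ℤ) (flat a′ d′ b′)))
    b≡ : b ≡ b′
    b≡ with to (+ b , + a) (diagonal a d b)
    ... | t , u , ex , ey = sym (small-unique u b′< (subst (b <_) d≡ b<) (begin
          - + b′ + + b                      ≡⟨ cong (λ z → - + b′ + z) ex ⟩
          - + b′ + (+ b′ * t + + d′ * u)    ≡⟨ cong (λ z → - + b′ + (+ b′ * z + + d′ * u)) t≡1 ⟩
          - + b′ + (+ b′ * 1ℤ + + d′ * u)   ≡⟨ e₁ (+ b′) (+ d′ * u) ⟩
          + d′ * u                          ∎))
      where
      open ≡-Reasoning
      t≡1 : t ≡ 1ℤ
      t≡1 = *-cancelˡ-≡ (+ a) t 1ℤ (trans (cong (λ z → + z * t) a≡) (trans (sym ey) (one₂ (+ a))))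
      e₁ : ∀ b z → - b + (b * 1ℤ + z) ≡ z
      e₁ = solve-∀

-- The model of a trihex with prescribed lattice.

module Models where

  open import Defs using (Dart; Orbit3; Orbit6; Step; σ-step; α-step; Trihex; n3; n6)
  open Counting
  open Developing
  open Lattices
  open import Data.Integer using (+_; _+_; _*_; -_; 0ℤ; 1ℤ; -1ℤ)
  open import Data.Integer.Properties using (+-identityˡ; *-cancelˡ-≡; neg-involutive; +-injective)
  open import Data.Integer.DivMod using (_/ℕ_; _%ℕ_; n%ℕd<d; a≡a%ℕn+[a/ℕn]*n)
  open import Data.Integer.Tactic.RingSolver using (solve-∀)
  open import Data.Nat as ℕ using (ℕ; zero; suc; NonZero; _<_)
  import Data.Nat.Properties as ℕ
  import Data.Nat.Tactic.RingSolver as ℕSolver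
  open import Data.Fin as Fin using (Fin; zero; suc; combine; remQuot)
  open import Data.Fin.Properties using (_≟_; remQuot-combine; combine-remQuot)
  open import Data.List using (List; []; _∷_; length; filter; allFin)
  open import Data.List.Properties using (length-tabulate)
  open import Data.List.Membership.Propositional.Properties using (∈-allFin)
  import Data.List.Relation.Unary.Unique.Propositional.Properties as Unique
  open import Data.Product using (∃; ∃₂; _×_; _,_; proj₁; proj₂)
  open import Data.Sum using (_⊎_; inj₁; inj₂)
  open import Data.Empty using (⊥)
  open import Data.Unit using (⊤; tt)
  open import Function using (_∘_; id)
  open import Relation.Nullary using (Dec; yes; no)
  open import Relation.Nullary.Decidable using (¬?)
  open import Relation.Unary using (Decidable)
  open import Relation.Binary.PropositionalEquality
  open import Relation.Binary.Construct.Closure.ReflexiveTransitive using (Star; ε; _◅_; _◅◅_)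

  Card-Fin : ∀ n → Card {A = Fin n} (λ _ → ⊤) n
  Card-Fin n = card (allFin n) (Unique.allFin⁺ n) (λ _ → tt) (λ {x} _ → ∈-allFin x) (length-tabulate id)

  length-partition : {A : Set} {P : A → Set} (P? : Decidable P) (xs : List A) →
                     length (filter P? xs) ℕ.+ length (filter (¬? ∘ P?) xs) ≡ length xs
  length-partition P? [] = refl
  length-partition P? (x ∷ xs) with P? x
  ... | yes _ = cong suc (length-partition P? xs)
  ... | no _  = trans (ℕ.+-suc _ _) (cong suc (length-partition P? xs))

  n3+n6 : ∀ {V} (φ : Dart V → Dart V) → n3 {V} φ ℕ.+ n6 {V} φ ≡ 3 ℕ.* V
  n3+n6 {V} φ = trans (length-partition (λ x → φ (φ (φ x)) ≟ x) (allFin (3 ℕ.* V))) (length-tabulate id)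

  Card-n3 : ∀ {V} (φ : Dart V → Dart V) → Card (λ x → φ (φ (φ x)) ≡ x) (n3 {V} φ)
  Card-n3 {V} φ = Card-⇔ proj₂ (tt ,_) (proj₂ (Card-filter (λ x → φ (φ (φ x)) ≟ x) (Card-Fin (3 ℕ.* V))))

  double-≢1 : ∀ z → z + z ≢ 1ℤ
  double-≢1 (+ suc n) eq with trans (sym (ℕ.+-suc n n)) (ℕ.suc-injective (+-injective eq))
  ... | ()

  σ̂-cube : ∀ s → σ̂ (σ̂ (σ̂ s)) ≡ s
  σ̂-cube (r , x , y) = cong₂ _,_ (turn r) (cong₂ _,_ (go₁ r) (go₂ r))
    where
    turn : ∀ r → proj₁ (σ̂ (σ̂ (σ̂ (r , x , y)))) ≡ r
    turn zero             = refl
    turn (suc zero)       = refl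
    turn (suc (suc zero)) = refl
    a₀ : ∀ x → - - (-1ℤ + - (0ℤ + - (1ℤ + x))) ≡ x
    a₀ = solve-∀
    a₁ : ∀ x → - (1ℤ + - - (-1ℤ + - (0ℤ + x))) ≡ x
    a₁ = solve-∀
    a₂ : ∀ x → - (0ℤ + - (1ℤ + - - (-1ℤ + x))) ≡ x
    a₂ = solve-∀
    b₀ : ∀ x → - - (1ℤ + - (1ℤ + - (0ℤ + x))) ≡ x
    b₀ = solve-∀
    b₁ : ∀ x → - (0ℤ + - - (1ℤ + - (1ℤ + x))) ≡ x
    b₁ = solve-∀
    b₂ : ∀ x → - (1ℤ + - (0ℤ + - - (1ℤ + x))) ≡ x
    b₂ = solve-∀
    go₁ : ∀ r → proj₁ (proj₂ (σ̂ (σ̂ (σ̂ (r , x , y))))) ≡ x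
    go₁ zero             = a₀ x
    go₁ (suc zero)       = a₁ x
    go₁ (suc (suc zero)) = a₂ x
    go₂ : ∀ r → proj₂ (proj₂ (σ̂ (σ̂ (σ̂ (r , x , y))))) ≡ y
    go₂ zero             = b₀ y
    go₂ (suc zero)       = b₁ y
    go₂ (suc (suc zero)) = b₂ y

  α̂-invol : ∀ s → α̂ (α̂ s) ≡ s
  α̂-invol (r , x , y) = cong (r ,_) (cong₂ _,_ (go (proj₁ (e r)) x) (go (proj₂ (e r)) y))
    where
    go : ∀ e x → - (e + - (e + x)) ≡ x
    go = solve-∀

  φ̂-cube : ∀ r v → φ̂ (φ̂ (φ̂ (r , v))) ≡ (r , ⊖ v)
  φ̂-cube zero             v = refl
  φ̂-cube (suc zero)       v = refl
  φ̂-cube (suc (suc zero)) v = refl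

  φ̂-turns : ∀ s → proj₁ (φ̂ s) ≢ proj₁ s
  φ̂-turns (zero , _)           ()
  φ̂-turns (suc zero , _)       ()
  φ̂-turns (suc (suc zero) , _) ()

  φ̂φ̂-turns : ∀ s → proj₁ (φ̂ (φ̂ s)) ≢ proj₁ s
  φ̂φ̂-turns (zero , _)           ()
  φ̂φ̂-turns (suc zero , _)       ()
  φ̂φ̂-turns (suc (suc zero) , _) ()

  -- The universal map divided by the translations in `L`. The half-turn about the origin is already
  -- built into `α̂` and `φ̂`, so three darts remain for each class modulo `L`.
  module Model {L : Pt → Set} (sub : Subgroup L) (even : ∀ v → L v → ∃ λ m → v ≡ m ⊕ m)
    {V : ℕ} (Q : Quotient L V) where

    open Subgroup sub
    open Quotient Q

    _∼_ : Fin 3 × Pt → Fin 3 × Pt → Set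
    (r , u) ∼ (s , v) = r ≡ s × L (⊖ v ⊕ u)

    abstract
      p : Fin 3 × Pt → Dart V
      p (r , v) = combine r (class v)

      chart : Dart V → Fin 3 × Pt
      chart x = proj₁ (remQuot {3} V x) , point (proj₂ (remQuot {3} V x))

      p-chart : ∀ x → p (chart x) ≡ x
      p-chart x = trans (cong (combine (proj₁ (remQuot {3} V x))) (class-point (proj₂ (remQuot {3} V x)))) (combine-remQuot {3} V x)

      p⇒∼ : ∀ s t → p s ≡ p t → s ∼ t
      p⇒∼ (r , u) (r′ , v) eq = cong proj₁ split , class⇒L u v (cong proj₂ split)
        where
        split : (r , class u) ≡ (r′ , class v)
        split = trans (sym (remQuot-combine {3} {V} r (class u)))
          (trans (cong (remQuot {3} V) eq) (remQuot-combine {3} {V} r′ (class v)))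

      ∼⇒p : ∀ s t → s ∼ t → p s ≡ p t
      ∼⇒p (r , u) (_ , v) (refl , l) = cong (combine r) (L⇒class u v l)

    private
      flip : ∀ u v → ⊖ (⊖ v ⊕ u) ≡ ⊖ ⊖ v ⊕ ⊖ u
      flip (a , b) (c , d) = cong₂ _,_ (go a c) (go b d)
        where
        go : ∀ a c → - (- c + a) ≡ - - c + - a
        go = solve-∀

      flip-e : ∀ f u v → ⊖ (⊖ v ⊕ u) ≡ ⊖ ⊖ (f ⊕ v) ⊕ ⊖ (f ⊕ u)
      flip-e (s , t) (a , b) (c , d) = cong₂ _,_ (go s a c) (go t b d)
        where
        go : ∀ s a c → - (- c + a) ≡ - - (s + c) + - (s + a)
        go = solve-∀

    φ̂-∼ : ∀ s t → s ∼ t → φ̂ s ∼ φ̂ t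
    φ̂-∼ (zero , u)           (_ , v) (refl , l) = refl , l
    φ̂-∼ (suc zero , u)       (_ , v) (refl , l) = refl , l
    φ̂-∼ (suc (suc zero) , u) (_ , v) (refl , l) = refl , subst L (flip u v) (L-⊖ (⊖ v ⊕ u) l)

    α̂-∼ : ∀ s t → s ∼ t → α̂ s ∼ α̂ t
    α̂-∼ (r , u) (_ , v) (refl , l) = refl , subst L (flip-e (e r) u v) (L-⊖ (⊖ v ⊕ u) l)

    abstract
      σ α : Dart V → Dart V
      σ x = p (σ̂ (chart x))
      α x = p (α̂ (chart x))

      α-p : ∀ s → α (p s) ≡ p (α̂ s)
      α-p s = ∼⇒p (α̂ (chart (p s))) (α̂ s) (α̂-∼ (chart (p s)) s (p⇒∼ (chart (p s)) s (p-chart (p s))))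

      σ-p : ∀ s → σ (p s) ≡ p (σ̂ s)
      σ-p s = ∼⇒p (σ̂ (chart (p s))) (σ̂ s) (φ̂-∼ (α̂ (chart (p s))) (α̂ s)
        (α̂-∼ (chart (p s)) s (p⇒∼ (chart (p s)) s (p-chart (p s)))))

    φ : Dart V → Dart V
    φ x = σ (α x)

    φ-p : ∀ s → φ (p s) ≡ p (φ̂ s)
    φ-p s = trans (cong σ (α-p s)) (trans (σ-p (α̂ s)) (cong (p ∘ φ̂) (α̂-invol s)))

    φ³-p : ∀ r v → φ (φ (φ (p (r , v)))) ≡ p (r , ⊖ v)
    φ³-p r v = trans (cong (φ ∘ φ) (φ-p (r , v))) (trans (cong φ (φ-p (φ̂ (r , v))))
      (trans (φ-p (φ̂ (φ̂ (r , v)))) (cong p (φ̂-cube r v))))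

    φφ-p : ∀ s → φ (φ (p s)) ≡ p (φ̂ (φ̂ s))
    φφ-p s = trans (cong φ (φ-p s)) (φ-p (φ̂ s))

    by-chart : (Q : Dart V → Set) → (∀ s → Q (p s)) → ∀ x → Q x
    by-chart Q q x = subst Q (p-chart x) (q (chart x))

    σ-cube : ∀ x → σ (σ (σ x)) ≡ x
    σ-cube = by-chart _ λ s → trans (cong (σ ∘ σ) (σ-p s)) (trans (cong σ (σ-p (σ̂ s)))
      (trans (σ-p (σ̂ (σ̂ s))) (cong p (σ̂-cube s))))

    σ-fix : ∀ x → σ x ≢ x
    σ-fix = by-chart _ λ s eq → φ̂-turns (α̂ s) (proj₁ (p⇒∼ (σ̂ s) s (trans (sym (σ-p s)) eq)))

    α-invol : ∀ x → α (α x) ≡ x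
    α-invol = by-chart _ λ s → trans (cong α (α-p s)) (trans (α-p (α̂ s)) (cong p (α̂-invol s)))

    -- A fixed dart would put -(2v + `e r`) into `L`, although `e r` has an odd coordinate; `even`
    -- excludes this.
    α-fix : ∀ x → α x ≢ x
    α-fix = by-chart _ λ (r , v) eq → odd r v (even _ (proj₂ (p⇒∼ (α̂ (r , v)) (r , v) (trans (sym (α-p (r , v))) eq))))
      where
      shift : ∀ x m → - (x + m) + - (x + m) ≡ 1ℤ + (- x + - (1ℤ + x)) + - (m + m)
      shift = solve-∀
      cancel : ∀ m → 1ℤ + m + - m ≡ 1ℤ
      cancel = solve-∀
      odd₁ : ∀ x m → - x + - (1ℤ + x) ≡ m + m → ⊥
      odd₁ x m eq = double-≢1 (- (x + m)) (trans (shift x m) (trans (cong (λ z → 1ℤ + z + - (m + m)) eq) (cancel (m + m))))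
      odd : ∀ r v → (∃ λ m → ⊖ v ⊕ ⊖ (e r ⊕ v) ≡ m ⊕ m) → ⊥
      odd zero             (x , y) ((m , _) , eq) = odd₁ x m (cong proj₁ eq)
      odd (suc zero)       (x , y) ((_ , m) , eq) = odd₁ y m (cong proj₂ eq)
      odd (suc (suc zero)) (x , y) ((_ , m) , eq) = odd₁ y m (cong proj₂ eq)

    φ-fix : ∀ s → φ (p s) ≢ p s
    φ-fix s eq = φ̂-turns s (proj₁ (p⇒∼ (φ̂ s) s (trans (sym (φ-p s)) eq)))

    φφ-fix : ∀ s → φ (φ (p s)) ≢ p s
    φφ-fix s eq = φ̂φ̂-turns s (proj₁ (p⇒∼ (φ̂ (φ̂ s)) s (trans (sym (φφ-p s)) eq)))

    faces : ∀ x → Orbit3 φ x ⊎ Orbit6 φ x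
    faces = by-chart _ face
      where
      face : ∀ s → Orbit3 φ (p s) ⊎ Orbit6 φ (p s)
      face (r , v) = split (φ (φ (φ (p (r , v)))) ≟ p (r , v))
        where
        split : Dec (φ (φ (φ (p (r , v)))) ≡ p (r , v)) → Orbit3 φ (p (r , v)) ⊎ Orbit6 φ (p (r , v))
        split (yes eq) = inj₁ (eq , φ-fix (r , v))
        split (no neq) = inj₂ (trans (cong (φ ∘ φ ∘ φ) (φ³-p r v))
          (trans (φ³-p r (⊖ v)) (cong (λ w → p (r , w)) (⊖-involutive v))) , neq , φφ-fix (r , v))

    private
      Path : Dart V → Dart V → Set
      Path = Star (Step σ α)

      path-σ : ∀ x → Path x (σ x)
      path-σ x = σ-step x ◅ ε

      path-α : ∀ x → Path x (α x)
      path-α x = α-step x ◅ ε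

      path-φ : ∀ s → Path (p s) (p (φ̂ s))
      path-φ s = subst (Path (p s)) (φ-p s) (path-α (p s) ◅◅ path-σ (α (p s)))

      -- `Step` is directed; `σ⁻¹ = σ²` and `α⁻¹ = α` supply the reversed steps.
      path-sym : ∀ {x y} → Path x y → Path y x
      path-sym ε = ε
      path-sym (σ-step x ◅ q) = path-sym q ◅◅ subst (Path (σ x)) (σ-cube x) (path-σ (σ x) ◅◅ path-σ (σ (σ x)))
      path-sym (α-step x ◅ q) = path-sym q ◅◅ subst (Path (α x)) (α-invol x) (path-α (α x))

      path-rotate : ∀ r v → Path (p (zero , v)) (p (r , v))
      path-rotate zero             v = ε
      path-rotate (suc zero)       v = path-φ (zero , v)
      path-rotate (suc (suc zero)) v = path-φ (zero , v) ◅◅ path-φ (suc zero , v)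

      path-unrotate : ∀ r v → Path (p (r , v)) (p (zero , ⊖ v))
      path-unrotate zero             v = path-φ (zero , v) ◅◅ path-φ (suc zero , v) ◅◅ path-φ (suc (suc zero) , v)
      path-unrotate (suc zero)       v = path-φ (suc zero , v) ◅◅ path-φ (suc (suc zero) , v)
      path-unrotate (suc (suc zero)) v = path-φ (suc (suc zero) , v)

      -- Turn to side `r`, cross it and turn on: crossing lands at the negated centre, and
      -- completing the turn to side 0 negates it again.
      path-neighbour : ∀ r v → Path (p (zero , v)) (p (zero , e r ⊕ v))
      path-neighbour r v = path-rotate r v ◅◅ subst (Path (p (r , v))) (α-p (r , v)) (path-α (p (r , v)))
        ◅◅ subst (λ w → Path (p (α̂ (r , v))) (p (zero , w))) (⊖-involutive (e r ⊕ v)) (path-unrotate r (⊖ (e r ⊕ v)))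

      path-point : ∀ x y → Path (p (zero , 𝟎)) (p (zero , x , y))
      path-point x y = ℤ-induction (λ x → Path (p (zero , 𝟎)) (p (zero , x , y)))
        (ℤ-induction (λ y → Path (p (zero , 𝟎)) (p (zero , 0ℤ , y))) ε (λ y q → q ◅◅ up y)
          (λ y q → q ◅◅ path-sym (subst (λ z → Path (p (zero , 0ℤ , -1ℤ + y)) (p (zero , 0ℤ , z))) (1+[-1+i] y) (up (-1ℤ + y)))) y)
        (λ x q → q ◅◅ right x)
        (λ x q → q ◅◅ path-sym (subst (λ z → Path (p (zero , -1ℤ + x , y)) (p (zero , z , y))) (1+[-1+i] x) (right (-1ℤ + x)))) x
        where
        up : ∀ y → Path (p (zero , 0ℤ , y)) (p (zero , 0ℤ , 1ℤ + y))
        up y = path-neighbour (suc zero) (0ℤ , y)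
        right : ∀ x → Path (p (zero , x , y)) (p (zero , 1ℤ + x , y))
        right x = subst (λ z → Path (p (zero , x , y)) (p (zero , 1ℤ + x , z))) (+-identityˡ y) (path-neighbour zero (x , y))

      path-any : ∀ s → Path (p (zero , 𝟎)) (p s)
      path-any (r , x , y) = path-point x y ◅◅ path-rotate r (x , y)

    connected : ∀ x y → Path x y
    connected x y = by-chart (λ x → Path x y) (λ s → path-sym (path-any s) ◅◅ by-chart (Path (p (zero , 𝟎))) path-any y) x

    hexMap : HexMap (Dart V)
    hexMap = record
      { σ = σ ; α = α ; σ-cube = σ-cube ; σ-fix = σ-fix ; α-invol = α-invol ; α-fix = α-fix
      ; faces = faces ; connected = connected }

    origin : Dart V
    origin = p (zero , 𝟎)

    φ³-origin : Develop.φ³ hexMap origin ≡ origin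
    φ³-origin = φ³-p zero 𝟎

    dev-origin : ∀ v → Develop.dev hexMap origin v ≡ p (zero , v)
    dev-origin = Develop.dev-unique hexMap (λ v → p (zero , v)) refl
      (λ x y → trans (cong (φ ∘ φ ∘ φ) (α-p (zero , x , y))) (trans (φ³-p zero (⊖ (e zero ⊕ (x , y))))
        (cong (λ v → p (zero , v)) (trans (⊖-involutive (e zero ⊕ (x , y))) (cong (1ℤ + x ,_) (+-identityˡ y))))))
      (λ x y → trans (cong (φ ∘ φ ∘ α) (φ-p (zero , x , y))) (trans (cong (φ ∘ φ) (α-p (suc zero , x , y)))
        (trans (φφ-p (α̂ (suc zero , x , y)))
          (cong (λ v → p (zero , v)) (trans (⊖-involutive (e (suc zero) ⊕ (x , y))) (cong (_, 1ℤ + y) (+-identityˡ x)))))))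

    Stab⇒L : ∀ v → Develop.Stab hexMap origin v → L v
    Stab⇒L v s = subst L (⊕-identityˡ v) (proj₂ (p⇒∼ (zero , v) (zero , 𝟎) (trans (sym (dev-origin v)) s)))

    L⇒Stab : ∀ v → L v → Develop.Stab hexMap origin v
    L⇒Stab v l = trans (dev-origin v) (∼⇒p (zero , v) (zero , 𝟎) (refl , subst L (sym (⊕-identityˡ v)) l))

  module Standard (a d b V : ℕ) .{{a≢0 : NonZero a}} .{{d≢0 : NonZero d}} (V≡ : V ≡ 4 ℕ.* (a ℕ.* d)) where

    private
      S : Triple
      S = a , d , b

      size≡ : ∀ a d → 4 ℕ.* (a ℕ.* d) ≡ 2 ℕ.* a ℕ.* (2 ℕ.* d)
      size≡ = ℕSolver.solve-∀

      quotient : Quotient (Lat (double S)) V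
      quotient = subst (Quotient (Lat (double S))) (trans (sym (size≡ a d)) (sym V≡))
        (Lat-quotient (2 ℕ.* a) (2 ℕ.* d) (2 ℕ.* b) {{ℕ.m*n≢0 2 a}} {{ℕ.m*n≢0 2 d}})

      even : ∀ v → Lat (double S) v → ∃ λ m → v ≡ m ⊕ m
      even v l = let m , _ , eq = Lat-even S v l in m , eq

    open Model (Lat-subgroup (double S)) even quotient public

    private
      open Subgroup (Lat-subgroup S)

      -- For `i` and `j` below 2, representatives of the four classes of `Lat S` modulo its double:
      -- the centres of the triangles.
      corner : ℕ × ℕ → Pt
      corner (i , j) = + b * + i + + d * + j , + a * + i

      Corner : Fin 3 × ℕ × ℕ → Set
      Corner (_ , i , j) = ⊤ × i < 2 × j < 2

      R : Fin 3 × ℕ × ℕ → Dart V → Set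
      R (r , ij) x = x ≡ p (r , corner ij)

      parity : ∀ t → ∃₂ λ i q → i < 2 × t ≡ + i + q * + 2
      parity t = t %ℕ 2 , t /ℕ 2 , n%ℕd<d t 2 , a≡a%ℕn+[a/ℕn]*n t 2

      to : ∀ c → Corner c → ∃ λ x → φ (φ (φ x)) ≡ x × R c x
      to (r , i , j) _ = _ , trans (φ³-p r (corner (i , j))) (∼⇒p (r , ⊖ corner (i , j)) (r , corner (i , j))
        (refl , Lat-double⁺ S (⊖ corner (i , j)) (L-⊖ (corner (i , j)) (+ i , + j , refl , refl)))) , refl

      from : ∀ x → φ (φ (φ x)) ≡ x → ∃ λ c → Corner c × R c x
      from = by-chart _ λ (r , v) eq → corners r v (L-⊖ (⊖ v) (Lat-double⁻ S (⊖ v)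
        (proj₂ (p⇒∼ (r , ⊖ v) (r , v) (trans (sym (φ³-p r v)) eq)))))
        where
        e₁ : ∀ b i q d j s → - (b * i + d * j) + (b * (i + q * + 2) + d * (j + s * + 2)) ≡ b * q + b * q + (d * s + d * s)
        e₁ = solve-∀
        e₂ : ∀ a i q → - (a * i) + a * (i + q * + 2) ≡ a * q + a * q
        e₂ = solve-∀
        corners : ∀ r v → Lat S (⊖ ⊖ v) → ∃ λ c → Corner c × R c (p (r , v))
        corners r v@(x , y) (t , u , ex , ey) = build (parity t) (parity u)
          where
          build : (∃₂ λ i q → i < 2 × t ≡ + i + q * + 2) → (∃₂ λ j s → j < 2 × u ≡ + j + s * + 2) →
                  ∃ λ c → Corner c × R c (p (r , v))
          build (i , q , i< , et) (j , s , j< , eu) = (r , i , j) , (tt , i< , j<) ,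
            ∼⇒p (r , v) (r , corner (i , j)) (refl , q , s ,
              trans (cong (λ z → - (+ b * + i + + d * + j) + z)
                      (trans (sym (neg-involutive x)) (trans ex (cong₂ (λ t u → + b * t + + d * u) et eu))))
                (trans (e₁ (+ b) (+ i) q (+ d) (+ j) s) (sym (cong₂ _+_ (twice b q) (twice d s)))) ,
              trans (cong (λ z → - (+ a * + i) + z) (trans (sym (neg-involutive y)) (trans ey (cong (λ t → + a * t) et))))
                (trans (e₂ (+ a) (+ i) q) (sym (twice a q))))

      corner-unique : ∀ i j i′ j′ → i < 2 → j < 2 → i′ < 2 → j′ < 2 →
                      Lat (double S) (⊖ corner (i′ , j′) ⊕ corner (i , j)) → (i , j) ≡ (i′ , j′)
      corner-unique i j i′ j′ i< j< i′< j′< (t , u , ex , ey) = cong₂ _,_ (sym i≡) (sym j≡)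
        where
        e₁ : ∀ a i i′ → a * (- i′ + i) ≡ - (a * i′) + a * i
        e₁ = solve-∀
        e₂ : ∀ a t → a * t + a * t ≡ a * (+ 2 * t)
        e₂ = solve-∀
        i-eq : - + i′ + + i ≡ + 2 * t
        i-eq = *-cancelˡ-≡ (+ a) _ _ (trans (e₁ (+ a) (+ i) (+ i′)) (trans ey (trans (twice a t) (e₂ (+ a) t))))
        i≡ : i′ ≡ i
        i≡ = small-unique t i′< i< i-eq
        e₃ : ∀ x → - x + x ≡ + 2 * 0ℤ
        e₃ = solve-∀
        t≡0 : t ≡ 0ℤ
        t≡0 = *-cancelˡ-≡ (+ 2) t 0ℤ (trans (sym i-eq) (trans (cong (λ z → - + z + + i) i≡) (e₃ (+ i))))
        e₄ : ∀ b i d j j′ → d * (- j′ + j) ≡ - (b * i + d * j′) + (b * i + d * j)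
        e₄ = solve-∀
        e₅ : ∀ b z → b * 0ℤ + z ≡ z
        e₅ = solve-∀
        x-eq : + d * (- + j′ + + j) ≡ + d * (+ 2 * u)
        x-eq = begin
          + d * (- + j′ + + j)
            ≡⟨ e₄ (+ b) (+ i) (+ d) (+ j) (+ j′) ⟩
          - (+ b * + i + + d * + j′) + (+ b * + i + + d * + j)
            ≡⟨ cong (λ z → - (+ b * + z + + d * + j′) + (+ b * + i + + d * + j)) (sym i≡) ⟩
          - (+ b * + i′ + + d * + j′) + (+ b * + i + + d * + j)
            ≡⟨ ex ⟩
          + (2 ℕ.* b) * t + + (2 ℕ.* d) * u
            ≡⟨ cong (λ z → + (2 ℕ.* b) * z + + (2 ℕ.* d) * u) t≡0 ⟩
          + (2 ℕ.* b) * 0ℤ + + (2 ℕ.* d) * u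
            ≡⟨ e₅ (+ (2 ℕ.* b)) (+ (2 ℕ.* d) * u) ⟩
          + (2 ℕ.* d) * u
            ≡⟨ twice d u ⟩
          + d * u + + d * u
            ≡⟨ e₂ (+ d) u ⟩
          + d * (+ 2 * u) ∎
          where open ≡-Reasoning
        j-eq : - + j′ + + j ≡ + 2 * u
        j-eq = *-cancelˡ-≡ (+ d) (- + j′ + + j) (+ 2 * u) x-eq
        j≡ : j′ ≡ j
        j≡ = small-unique u j′< j< j-eq

      injective : ∀ c c′ x → Corner c → Corner c′ → φ (φ (φ x)) ≡ x → R c x → R c′ x → c ≡ c′
      injective (r , i , j) (r′ , i′ , j′) x (_ , i< , j<) (_ , i′< , j′<) _ eq eq′ =
        let r≡ , l = p⇒∼ (r , corner (i , j)) (r′ , corner (i′ , j′)) (trans (sym eq) eq′)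
        in cong₂ _,_ r≡ (corner-unique i j i′ j′ i< j< i′< j′< l)

    -- `φ³` negates the centre `v`, so it fixes the dart exactly when 2v lies in the doubled
    -- lattice, that is, when `v` lies in `Lat S`. This gives three sides times four classes.
    Card-triangles : Card (λ x → φ (φ (φ x)) ≡ x) 12
    Card-triangles = Card-bij R to from (λ { _ _ _ _ _ _ refl refl → refl }) injective
      (Card-× (Card-Fin 3) (Card-× (Card-< 2) (Card-< 2)))

    -- As `n3 + n6 = 3 * V`, the Euler relation amounts to `n3 = 12`.
    euler : 3 ℕ.* (V ℕ.+ 4) ≡ 2 ℕ.* n3 {V} φ ℕ.+ n6 {V} φ
    euler = trans (ℕ.*-distribˡ-+ 3 V 4) (trans (cong (ℕ._+ 12) (sym (n3+n6 {V} φ)))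
      (trans (cong (λ k → n3 {V} φ ℕ.+ n6 {V} φ ℕ.+ k) (sym n3≡12)) (rearrange (n3 {V} φ) (n6 {V} φ))))
      where
      n3≡12 : n3 {V} φ ≡ 12
      n3≡12 = Card-unique (Card-n3 {V} φ) Card-triangles
      rearrange : ∀ x y → x ℕ.+ y ℕ.+ x ≡ 2 ℕ.* x ℕ.+ y
      rearrange = ℕSolver.solve-∀

    trihex : Trihex V
    trihex = record
      { σ = σ ; α = α ; σ-cube = σ-cube ; σ-fix = σ-fix ; α-invol = α-invol ; α-fix = α-fix
      ; faces = faces ; connected = connected ; euler = euler }

-- From trihexes to lattices and back, and the count of orbits.

module Classification where

  open import Defs
  open Counting
  open Arithmetic using (Sub; Inv; poly; factor-nonZeroˡ; factor-nonZeroʳ)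
  open Developing
  open Lattices
  open Models
  open import Data.Integer as ℤ using (ℤ; +_; ∣_∣; _+_; _*_; -_; 0ℤ; 1ℤ; -1ℤ)
  open import Data.Integer.Properties using (*-cancelˡ-≡; *-zeroʳ; pos-+; pos-*; abs-*)
  open import Data.Integer.DivMod using (_/ℕ_; _%ℕ_; n%ℕd<d; a≡a%ℕn+[a/ℕn]*n)
  open import Data.Integer.Tactic.RingSolver using (solve-∀)
  open import Data.Nat as ℕ using (ℕ; zero; suc; NonZero; _<_; s≤s)
  import Data.Nat.Properties as ℕ
  import Data.Nat.Tactic.RingSolver as ℕSolver
  open import Data.Nat.Divisibility using (_∣_; divides)
  open import Data.Fin as Fin using (Fin; zero; suc; toℕ)
  open import Data.Fin.Properties using (_≟_; pigeonhole)
  open import Data.Fin.Permutation using (↔⇒≡)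
  open import Data.List using (List; []; _∷_; length; lookup)
  open import Data.List.Membership.Propositional using (_∈_)
  open import Data.List.Membership.Propositional.Properties using (∈-lookup)
  open import Data.List.Relation.Unary.Any as Any using (here)
  open import Data.List.Relation.Unary.Any.Properties using (lookup-index)
  open import Data.List.Relation.Unary.All as All using ([]; _∷_)
  open import Data.List.Relation.Unary.AllPairs using ([]; _∷_)
  open import Data.List.Relation.Unary.Unique.Propositional using (Unique)
  open import Data.Product using (Σ; ∃; ∃₂; _×_; _,_; proj₁; proj₂)
  open import Data.Product.Properties using (≡-dec)
  open import Data.Sum using (_⊎_; inj₁; inj₂)
  open import Data.Empty using (⊥-elim)
  open import Function using (_∘_)
  open import Function.Bundles using (Inverse)
  open import Relation.Nullary using (Dec; yes; no)
  open import Relation.Nullary.Decidable using (_×-dec_)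
  open import Relation.Binary.PropositionalEquality

  hexMapOf : ∀ {V} → Trihex V → HexMap (Dart V)
  hexMapOf T = record
    { σ = σ ; α = α ; σ-cube = σ-cube ; σ-fix = σ-fix ; α-invol = α-invol ; α-fix = α-fix
    ; faces = faces ; connected = connected }
    where open Trihex T

  infix 4 _≐_
  _≐_ : (Pt → Set) → (Pt → Set) → Set
  L ≐ L′ = (∀ v → L v → L′ v) × (∀ v → L′ v → L v)

  ≐-sym : ∀ {L L′} → L ≐ L′ → L′ ≐ L
  ≐-sym (f , g) = g , f

  ≐-trans : ∀ {L L′ L″} → L ≐ L′ → L′ ≐ L″ → L ≐ L″
  ≐-trans (f , g) (f′ , g′) = (λ v → f′ v ∘ f v) , (λ v → g v ∘ g′ v)

  ≐-∘ : ∀ {L L′} → L ≐ L′ → (h : Pt → Pt) → L ∘ h ≐ L′ ∘ h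
  ≐-∘ (f , g) h = (λ v → f (h v)) , (λ v → g (h v))

  -- Genus 0 enters here: subtracting `n3 + n6 = 3 * V` from the Euler relation leaves `n3 = 12`,
  -- whereas on a torus `n3` would vanish and no dart could serve as base.
  triangle-dart : ∀ {V} (T : Trihex V) → ∃ λ x → Develop.φ³ (hexMapOf T) x ≡ x
  triangle-dart {V} T = first (Card-n3 {V} φ) n3≡12
    where
    φ : Dart V → Dart V
    φ = HexMap.φ (hexMapOf T)
    n3≡12 : n3 {V} φ ≡ 12
    n3≡12 = sym (ℕ.+-cancelˡ-≡ (3 ℕ.* V) 12 (n3 {V} φ) (begin
      3 ℕ.* V ℕ.+ 12                      ≡⟨ ℕ.*-distribˡ-+ 3 V 4 ⟨
      3 ℕ.* (V ℕ.+ 4)                     ≡⟨ Trihex.euler T ⟩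
      2 ℕ.* n3 {V} φ ℕ.+ n6 {V} φ         ≡⟨ rearrange (n3 {V} φ) (n6 {V} φ) ⟩
      n3 {V} φ ℕ.+ n6 {V} φ ℕ.+ n3 {V} φ  ≡⟨ cong (ℕ._+ n3 {V} φ) (n3+n6 {V} φ) ⟩
      3 ℕ.* V ℕ.+ n3 {V} φ                ∎))
      where
      open ≡-Reasoning
      rearrange : ∀ x y → 2 ℕ.* x ℕ.+ y ≡ x ℕ.+ y ℕ.+ x
      rearrange = ℕSolver.solve-∀
    first : ∀ {n} → Card (λ x → φ (φ (φ x)) ≡ x) n → n ≡ 12 → ∃ λ x → φ (φ (φ x)) ≡ x
    first (card [] _ _ _ refl) ()
    first (card (x ∷ _) _ s _ _) _ = x , s (here refl)

  record Signature (V : ℕ) (H : HexMap (Dart V)) (x : Dart V) : Set where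
    field
      a d b : ℕ
      {{a≢0}} : NonZero a
      {{d≢0}} : NonZero d
      b<d  : b < d
      V≡   : V ≡ 4 ℕ.* (a ℕ.* d)
      stab : Develop.Stab H x ≐ Lat (double (a , d , b))

  module _ (V : ℕ) (H : HexMap (Dart V)) (x : Dart V) (base : Develop.φ³ H x ≡ x) where

    private
      open Develop H
      open Based H x base using (no-half-turn)

      S : Pt → Set
      S = Stab x

      S-⊕ : ∀ u v → S u → S v → S (u ⊕ v)
      S-⊕ u v su sv = trans (sym (dev-⊕ x v u)) (trans (cong (λ z → dev z u) sv) su)

      S-⊖ : ∀ u → S u → S (⊖ u)
      S-⊖ u su = trans (cong (λ z → dev z (⊖ u)) (sym su)) (trans (dev-⊕ x u (⊖ u)) (cong (dev x) (⊕-inverseˡ u)))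

      -- The lattice M of which the stabiliser is the double; that the stabiliser has this form is
      -- `S-even`.
      Half : Pt → Set
      Half v = S (v ⊕ v)

      Half-subgroup : Subgroup Half
      Half-subgroup = record
        { L-𝟎 = refl
        ; L-⊕ = λ (a , b) (c , d) hu hv → subst S (cong₂ _,_ (interchange a c) (interchange b d))
            (S-⊕ ((a , b) ⊕ (a , b)) ((c , d) ⊕ (c , d)) hu hv)
        ; L-⊖ = λ (a , b) hu → subst S (cong₂ _,_ (negate a) (negate b)) (S-⊖ ((a , b) ⊕ (a , b)) hu)
        }
        where
        interchange : ∀ a c → a + a + (c + c) ≡ a + c + (a + c)
        interchange = solve-∀
        negate : ∀ a → - (a + a) ≡ - a + - a
        negate = solve-∀

      -- Among `3 * V + 1` points of a line two unroll to the same dart. Applied to both axes, this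
      -- supplies the vectors that `Extract` asks for.
      recurrence : (line : ℕ → Pt) → ∃₂ λ i k → S (⊖ line i ⊕ line (suc i ℕ.+ k))
      recurrence line with pigeonhole (ℕ.n<1+n (3 ℕ.* V)) (λ i → dev x (line (toℕ i)))
      ... | i , j , i<j , eq with ℕ.m≤n⇒∃[o]m+o≡n i<j
      ... | k , e = toℕ i , k , subst (λ n → S (⊖ line (toℕ i) ⊕ line n)) (sym e)
            (dev-eq⇒Stab x (line (toℕ j)) (line (toℕ i)) (sym eq))

      difference : ∀ i k → - + i + + (suc i ℕ.+ k) ≡ + suc k
      difference i k = trans (cong (λ z → - + i + z) (trans (cong +_ (sym (ℕ.+-suc i k))) (pos-+ i (suc k)))) (cancel (+ i) (+ suc k))
        where
        cancel : ∀ i k → - i + (i + k) ≡ k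
        cancel = solve-∀

      horizontal : ∃ λ k → Half (+ suc k , 0ℤ)
      horizontal = let i , k , s = recurrence (λ i → + i , 0ℤ) in
        k , S-⊕ (+ suc k , 0ℤ) (+ suc k , 0ℤ) (subst S (cong (_, 0ℤ) (difference i k)) s) (subst S (cong (_, 0ℤ) (difference i k)) s)

      vertical : ∃ λ k → Half (0ℤ , + suc k)
      vertical = let i , k , s = recurrence (λ i → 0ℤ , + i) in
        k , S-⊕ (0ℤ , + suc k) (0ℤ , + suc k) (subst S (cong (0ℤ ,_) (difference i k)) s) (subst S (cong (0ℤ ,_) (difference i k)) s)

      module E = Extract {Half} (λ v → dev x (v ⊕ v) ≟ x) Half-subgroup
        (suc (proj₁ horizontal)) (suc (proj₁ vertical)) (λ ()) (λ ()) (proj₂ horizontal) (proj₂ vertical)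

      bit : ∀ t → (∃ λ q → t ≡ q + q) ⊎ (∃ λ q → t ≡ 1ℤ + (q + q))
      bit t = split (t %ℕ 2) (n%ℕd<d t 2) (a≡a%ℕn+[a/ℕn]*n t 2)
        where
        e₀ : ∀ q → 0ℤ + q * + 2 ≡ q + q
        e₀ = solve-∀
        e₁ : ∀ q → 1ℤ + q * + 2 ≡ 1ℤ + (q + q)
        e₁ = solve-∀
        split : ∀ r → r < 2 → t ≡ + r + (t /ℕ 2) * + 2 → (∃ λ q → t ≡ q + q) ⊎ (∃ λ q → t ≡ 1ℤ + (q + q))
        split 0 _ eq = inj₁ (t /ℕ 2 , trans eq (e₀ (t /ℕ 2)))
        split 1 _ eq = inj₂ (t /ℕ 2 , trans eq (e₁ (t /ℕ 2)))
        split (suc (suc _)) (s≤s (s≤s ())) _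

      -- Each nonzero class of Λ/2Λ contains one of 1, ζ, ζ², so a vector that is not even is 2u +
      -- `e r` for some `u` and `r`, the case excluded by `no-half-turn`.
      S-even : ∀ v → S v → ∃ λ m → v ≡ m ⊕ m
      S-even (t , u) s = cases (bit t) (bit u)
        where
        z₁ : ∀ q → 1ℤ + (q + q) ≡ q + (1ℤ + q)
        z₁ = solve-∀
        z₀ : ∀ q → q + q ≡ q + (0ℤ + q)
        z₀ = solve-∀
        z₋ : ∀ q → 1ℤ + (q + q) ≡ 1ℤ + q + (-1ℤ + (1ℤ + q))
        z₋ = solve-∀
        cases : (∃ λ q → t ≡ q + q) ⊎ (∃ λ q → t ≡ 1ℤ + (q + q)) →
                (∃ λ q → u ≡ q + q) ⊎ (∃ λ q → u ≡ 1ℤ + (q + q)) → ∃ λ m → (t , u) ≡ m ⊕ m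
        cases (inj₁ (q , et)) (inj₁ (r , eu)) = (q , r) , cong₂ _,_ et eu
        cases (inj₂ (q , et)) (inj₁ (r , eu)) = ⊥-elim (no-half-turn zero (q , r)
          (subst S (cong₂ _,_ (trans et (z₁ q)) (trans eu (z₀ r))) s))
        cases (inj₁ (q , et)) (inj₂ (r , eu)) = ⊥-elim (no-half-turn (suc zero) (q , r)
          (subst S (cong₂ _,_ (trans et (z₀ q)) (trans eu (z₁ r))) s))
        -- The abscissa is `1 + q` and not `q` because ζ² has first coordinate -1.
        cases (inj₂ (q , et)) (inj₂ (r , eu)) = ⊥-elim (no-half-turn (suc (suc zero)) (1ℤ + q , r)
          (subst S (cong₂ _,_ (trans et (z₋ q)) (trans eu (z₁ r))) s))

      triple : Triple
      triple = E.a , E.d , E.b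

      S⇒Lat : ∀ v → S v → Lat (double triple) v
      S⇒Lat v s = let m , eq = S-even v s in
        subst (Lat (double triple)) (sym eq) (Lat-double⁺ triple m (E.L⇒Lat m (subst S eq s)))

      Lat⇒S : ∀ v → Lat (double triple) v → S v
      Lat⇒S v l = let m , lm , eq = Lat-even triple v l in subst S (sym eq) (E.Lat⇒L m lm)

      module Std = Standard E.a E.d E.b (4 ℕ.* (E.a ℕ.* E.d)) refl

      -- The model over the extracted lattice has the same stabiliser, hence equally many darts, and
      -- its size is known by construction.
      V-size : V ≡ 4 ℕ.* (E.a ℕ.* E.d)
      V-size = ℕ.*-cancelˡ-≡ V (4 ℕ.* (E.a ℕ.* E.d)) 3 (↔⇒≡ (Compare.bijection H Std.hexMap base Std.φ³-origin
        (λ v s → Std.L⇒Stab v (S⇒Lat v s)) (λ v s → Lat⇒S v (Std.Stab⇒L v s))))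

    abstract
      signature : Signature V H x
      signature = record { a = E.a ; d = E.d ; b = E.b ; b<d = E.b<d ; V≡ = V-size ; stab = S⇒Lat , Lat⇒S }

  lookup-injective : {A : Set} {xs : List A} → Unique xs → ∀ i j → lookup xs i ≡ lookup xs j → i ≡ j
  lookup-injective {xs = x ∷ xs} u zero    zero    eq = refl
  lookup-injective {xs = x ∷ xs} u zero    (suc j) eq = ⊥-elim (head∉tail u (subst (_∈ xs) (sym eq) (∈-lookup j)))
  lookup-injective {xs = x ∷ xs} u (suc i) zero    eq = ⊥-elim (head∉tail u (subst (_∈ xs) eq (∈-lookup i)))
  lookup-injective {xs = x ∷ xs} (_ ∷ u) (suc i) (suc j) eq = cong suc (lookup-injective u i j eq)

  ζ-⊕ : ∀ u v → ζ (u ⊕ v) ≡ ζ u ⊕ ζ v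
  ζ-⊕ (a , b) (c , d) = cong₂ _,_ (first b d) (second a b c d)
    where
    first : ∀ b d → - (b + d) ≡ - b + - d
    first = solve-∀
    second : ∀ a b c d → a + c + (b + d) ≡ a + b + (c + d)
    second = solve-∀

  Lat-⊖-≐ : ∀ s → Lat s ∘ ⊖_ ≐ Lat s
  Lat-⊖-≐ s = (λ v l → subst (Lat s) (⊖-involutive v) (L-⊖ (⊖ v) l)) , (λ v → L-⊖ v)
    where open Subgroup (Lat-subgroup s)

  Lat-double-≐ : ∀ s → Lat (double s) ∘ (λ v → v ⊕ v) ≐ Lat s
  Lat-double-≐ s = Lat-double⁻ s , Lat-double⁺ s

  -- If `ζ v` lies in the lattice, so does ζ³v = -v; hence the inclusion is an equality.
  ζ-closed⇒≐ : ∀ s → (∀ v → Lat s v → Lat s (ζ v)) → Lat s ∘ ζ ≐ Lat s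
  ζ-closed⇒≐ s c = (λ v l → proj₁ (Lat-⊖-≐ s) v (subst (Lat s) (ζ-cube v) (c (ζ (ζ v)) (c (ζ v) l)))) , c

  pos-poly : ∀ b → + poly b ≡ + b * + b + + b + 1ℤ
  pos-poly b = trans (pos-+ (b ℕ.* b ℕ.+ b) 1)
    (cong (λ z → z + 1ℤ) (trans (pos-+ (b ℕ.* b) b) (cong (λ z → z + + b) (pos-* b b))))

  module _ (n V : ℕ) .{{_ : NonZero n}} (V≡ : V ≡ 4 ℕ.* n) where

    Sub-unique : ∀ S S′ → Sub n S → Sub n S′ → Lat S ≐ Lat S′ → S ≡ S′
    Sub-unique (a , d , b) (a′ , d′ , b′) (eq , b<) (eq′ , b′<) (f , g) = Lat-unique
      {{factor-nonZeroˡ a eq}} {{factor-nonZeroʳ a eq}} {{factor-nonZeroˡ a′ eq′}} {{factor-nonZeroʳ a′ eq′}} b< b′< f g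

    Sub-unique₂ : ∀ S S′ → Sub n S → Sub n S′ → Lat (double S) ≐ Lat (double S′) → S ≡ S′
    Sub-unique₂ S S′ s s′ eq = Sub-unique S S′ s s′
      (≐-trans (≐-sym (Lat-double-≐ S)) (≐-trans (≐-∘ eq (λ v → v ⊕ v)) (Lat-double-≐ S′)))

    record Realisation (S : Triple) : Set where
      field
        trihex : Trihex V
        origin : Dart V
      H : HexMap (Dart V)
      H = hexMapOf trihex
      field
        base : Develop.φ³ H origin ≡ origin
        stab : Develop.Stab H origin ≐ Lat (double S)

    abstract
      realise : ∀ S → Sub n S → Realisation S
      realise (a , d , b) (eq , b<) = record
        { trihex = M.trihex ; origin = M.origin ; base = M.φ³-origin ; stab = M.Stab⇒L , M.L⇒Stab }
        where
        module M = Standard a d b V {{factor-nonZeroˡ a eq}} {{factor-nonZeroʳ a eq}} (trans V≡ (cong (4 ℕ.*_) (sym eq)))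

    classify : (H : HexMap (Dart V)) (x : Dart V) → Develop.φ³ H x ≡ x →
               ∃ λ S → Sub n S × Develop.Stab H x ≐ Lat (double S)
    classify H x base = (a , d , b) , (ℕ.*-cancelˡ-≡ (a ℕ.* d) n 4 (trans (sym V≡′) V≡) , b<d) , stab
      where open Signature (signature V H x base) renaming (V≡ to V≡′)

    module _ (S : Triple) (s : Sub n S) where

      open Realisation (realise S s)
      open Develop H

      base₁ : φ³ (HexMap.φ H origin) ≡ HexMap.φ H origin
      base₁ = cong (HexMap.φ H) base

      base₂ : φ³ (HexMap.φ H (HexMap.φ H origin)) ≡ HexMap.φ H (HexMap.φ H origin)
      base₂ = cong (HexMap.φ H) base₁

      stab₁ : Stab (HexMap.φ H origin) ≐ Lat (double S) ∘ ζ
      stab₁ = ≐-trans (Stab-φ origin , Stab-φ⁻ origin) (≐-∘ stab ζ)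

      stab₂ : Stab (HexMap.φ H (HexMap.φ H origin)) ≐ Lat (double S) ∘ ζ ∘ ζ
      stab₂ = ≐-trans (Stab-φ (HexMap.φ H origin) , Stab-φ⁻ (HexMap.φ H origin)) (≐-∘ stab₁ ζ)

    Sub? : ∀ S → Dec (Sub n S)
    Sub? (a , d , b) = (a ℕ.* d ℕ.≟ n) ×-dec (b ℕ.<? d)

    -- The normal form of ζ⁻¹M is not computed from that of M: it is read off the realised trihex,
    -- classified from the next dart of the same triangle.
    rotated : ∀ S → Sub n S → ∃ λ S′ → Sub n S′ × Lat (double S′) ≐ Lat (double S) ∘ ζ
    rotated S s = let S′ , s′ , eq = classify H (HexMap.φ H origin) (base₁ S s) in S′ , s′ , ≐-trans (≐-sym eq) (stab₁ S s)
      where open Realisation (realise S s)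

    -- Junk value S when S is not a normal form of index n.
    rotate : Triple → Triple
    rotate S with Sub? S
    ... | yes s = proj₁ (rotated S s)
    ... | no _  = S

    rotate-spec : ∀ S → Sub n S → Sub n (rotate S) × Lat (double (rotate S)) ≐ Lat (double S) ∘ ζ
    rotate-spec S s with Sub? S
    ... | yes s′ = proj₂ (rotated S s′)
    ... | no ¬s  = ⊥-elim (¬s s)

    Sub-rotate : ∀ S → Sub n S → Sub n (rotate S)
    Sub-rotate S s = proj₁ (rotate-spec S s)

    Lat₂-rotate : ∀ S → Sub n S → Lat (double (rotate S)) ≐ Lat (double S) ∘ ζ
    Lat₂-rotate S s = proj₂ (rotate-spec S s)

    Lat₂-rotate² : ∀ S → Sub n S → Lat (double (rotate (rotate S))) ≐ Lat (double S) ∘ ζ ∘ ζ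
    Lat₂-rotate² S s = ≐-trans (Lat₂-rotate (rotate S) (Sub-rotate S s)) (≐-∘ (Lat₂-rotate S s) ζ)

    Lat-rotate : ∀ S → Sub n S → Lat (rotate S) ≐ Lat S ∘ ζ
    Lat-rotate S s = ≐-trans (≐-sym (Lat-double-≐ (rotate S))) (≐-trans (≐-∘ (Lat₂-rotate S s) (λ v → v ⊕ v))
      ((λ v l → Lat-double⁻ S (ζ v) (subst (Lat (double S)) (ζ-⊕ v v) l)) ,
       (λ v l → subst (Lat (double S)) (sym (ζ-⊕ v v)) (Lat-double⁺ S (ζ v) l))))

    rotate-cube : ∀ S → Sub n S → rotate (rotate (rotate S)) ≡ S
    rotate-cube S s = Sub-unique (rotate (rotate (rotate S))) S (Sub-rotate (rotate (rotate S)) s₂) s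
      (≐-trans (Lat-rotate (rotate (rotate S)) s₂)
      (≐-trans (≐-∘ (Lat-rotate (rotate S) s₁) ζ) (≐-trans (≐-∘ (Lat-rotate S s) (ζ ∘ ζ))
      (≐-trans ((λ v → subst (Lat S) (ζ-cube v)) , (λ v → subst (Lat S) (sym (ζ-cube v)))) (Lat-⊖-≐ S)))))
      where
      s₁ : Sub n (rotate S)
      s₁ = Sub-rotate S s
      s₂ : Sub n (rotate (rotate S))
      s₂ = Sub-rotate (rotate S) s₁

    -- The image of the base dart lifts to a side and a centre. The stabiliser does not depend on
    -- the centre, and the side tells how often it is turned by ζ, so the lattices agree up to that
    -- turn.
    Iso⇒rotation : ∀ S S′ (s : Sub n S) (s′ : Sub n S′) →
      Iso (Realisation.trihex (realise S s)) (Realisation.trihex (realise S′ s′)) →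
      S ≡ S′ ⊎ S ≡ rotate S′ ⊎ S ≡ rotate (rotate S′)
    Iso⇒rotation S S′ s s′ (g , g-σ , g-α) = cases (B.lift (Inverse.to g R.origin))
      where
      module R  = Realisation (realise S s)
      module R′ = Realisation (realise S′ s′)
      module T  = Develop R.H
      module T′ = Develop R′.H
      module B  = Based R′.H R′.origin R′.base
      moved : Lat (double S) ≐ T′.Stab (Inverse.to g R.origin)
      moved = ≐-trans (≐-sym R.stab)
        ((λ v t → trans (sym (morphism-dev R.H R′.H (Inverse.to g) g-σ g-α R.origin v)) (cong (Inverse.to g) t)) ,
         (λ v t → trans (sym (Inverse.strictlyInverseʳ g _)) (trans (cong (Inverse.from g)
           (trans (morphism-dev R.H R′.H (Inverse.to g) g-σ g-α R.origin v) t)) (Inverse.strictlyInverseʳ g R.origin))))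
      Stab-P : ∀ v → T′.Stab (B.P v) ≐ Lat (double S′)
      Stab-P v = ≐-trans (T′.Stab-dev R′.origin v , T′.Stab-dev⁻ R′.origin v) R′.stab
      Stab-φ-≐ : ∀ x → T′.Stab (HexMap.φ R′.H x) ≐ T′.Stab x ∘ ζ
      Stab-φ-≐ x = T′.Stab-φ x , T′.Stab-φ⁻ x
      cases : (∃ λ t → B.π t ≡ Inverse.to g R.origin) → S ≡ S′ ⊎ S ≡ rotate S′ ⊎ S ≡ rotate (rotate S′)
      cases ((zero , v) , eq) = inj₁ (Sub-unique₂ S S′ s s′
        (≐-trans (subst (λ x → Lat (double S) ≐ T′.Stab x) (sym eq) moved) (Stab-P v)))
      cases ((suc zero , v) , eq) = inj₂ (inj₁ (Sub-unique₂ S (rotate S′) s (Sub-rotate S′ s′)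
        (≐-trans (subst (λ x → Lat (double S) ≐ T′.Stab x) (sym eq) moved)
        (≐-trans (Stab-φ-≐ (B.P v)) (≐-trans (≐-∘ (Stab-P v) ζ) (≐-sym (Lat₂-rotate S′ s′)))))))
      cases ((suc (suc zero) , v) , eq) = inj₂ (inj₂ (Sub-unique₂ S (rotate (rotate S′)) s (Sub-rotate (rotate S′) (Sub-rotate S′ s′))
        (≐-trans (subst (λ x → Lat (double S) ≐ T′.Stab x) (sym eq) moved)
        (≐-trans (Stab-φ-≐ (HexMap.φ R′.H (B.P v))) (≐-trans (≐-∘ (Stab-φ-≐ (B.P v)) ζ)
        (≐-trans (≐-∘ (≐-∘ (Stab-P v) ζ) ζ) (≐-sym (Lat₂-rotate² S′ s′))))))))

    same-stabilizer⇒Iso : (T U : Trihex V) (x y : Dart V) →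
      Develop.φ³ (hexMapOf T) x ≡ x → Develop.φ³ (hexMapOf U) y ≡ y →
      Develop.Stab (hexMapOf T) x ≐ Develop.Stab (hexMapOf U) y → Iso T U
    same-stabilizer⇒Iso T U x y bx by (f , g) = C.bijection , C.bijection-σ , C.bijection-α
      where module C = Compare (hexMapOf T) (hexMapOf U) bx by f g

    -- The realised trihex is based at `origin` or at its image under `φ` or `φ²`, whichever has the
    -- stabiliser of `x`.
    rotation⇒Iso : ∀ (T : Trihex V) x → Develop.φ³ (hexMapOf T) x ≡ x → ∀ S S′ (s′ : Sub n S′) →
      Develop.Stab (hexMapOf T) x ≐ Lat (double S) → S ≡ S′ ⊎ S ≡ rotate S′ ⊎ S ≡ rotate (rotate S′) →
      Iso T (Realisation.trihex (realise S′ s′))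
    rotation⇒Iso T x bx S S′ s′ eq (inj₁ refl) =
      same-stabilizer⇒Iso T trihex x origin bx base (≐-trans eq (≐-sym stab))
      where open Realisation (realise S′ s′)
    rotation⇒Iso T x bx S S′ s′ eq (inj₂ (inj₁ refl)) =
      same-stabilizer⇒Iso T trihex x (HexMap.φ H origin) bx (base₁ S′ s′)
        (≐-trans eq (≐-trans (Lat₂-rotate S′ s′) (≐-sym (stab₁ S′ s′))))
      where open Realisation (realise S′ s′)
    rotation⇒Iso T x bx S S′ s′ eq (inj₂ (inj₂ refl)) =
      same-stabilizer⇒Iso T trihex x (HexMap.φ H (HexMap.φ H origin)) bx (base₂ S′ s′)
        (≐-trans eq (≐-trans (Lat₂-rotate² S′ s′) (≐-sym (stab₂ S′ s′))))
      where open Realisation (realise S′ s′)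

    _≟ₜ_ : (S S′ : Triple) → Dec (S ≡ S′)
    _≟ₜ_ = ≡-dec ℕ._≟_ (≡-dec ℕ._≟_ ℕ._≟_)

    open OrderThree _≟ₜ_ rotate

    NumTrihexes-reps : ∀ {k} (c : Card (Sub n) k) (r : Representatives rotate (elements c)) → NumTrihexes V (length (reps r))
    NumTrihexes-reps c r = ts , separate , exhaust
      where
      member : ∀ i → Sub n (lookup (reps r) i)
      member i = sound c (reps-⊆ r (∈-lookup i))
      ts : Fin (length (reps r)) → Trihex V
      ts i = Realisation.trihex (realise (lookup (reps r) i) (member i))
      separate : ∀ i j → Iso (ts i) (ts j) → i ≡ j
      separate i j iso = lookup-injective (reps-unique r) i j
        (equal (Iso⇒rotation (lookup (reps r) i) (lookup (reps r) j) (member i) (member j) iso))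
        where
        equal : lookup (reps r) i ≡ lookup (reps r) j ⊎ lookup (reps r) i ≡ rotate (lookup (reps r) j)
                ⊎ lookup (reps r) i ≡ rotate (rotate (lookup (reps r) j)) → lookup (reps r) i ≡ lookup (reps r) j
        equal (inj₁ eq) = eq
        equal (inj₂ e)  = sym (reps-separate r (∈-lookup j) (∈-lookup i) e)
      exhaust : ∀ T → ∃ λ i → Iso T (ts i)
      exhaust T with triangle-dart T
      ... | x , base with classify (hexMapOf T) x base
      ... | S , s , stab with reps-meet r (complete c s)
      ... | y , y∈ , e = Any.index y∈ , rotation⇒Iso T x base S (lookup (reps r) (Any.index y∈)) (member (Any.index y∈)) stab
            (subst (λ z → S ≡ z ⊎ S ≡ rotate z ⊎ S ≡ rotate (rotate z)) (lookup-index y∈) e)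

    private
      Fixed : Triple → Set
      Fixed S = Sub n S × rotate S ≡ S

      -- The generators of c⟨e , ζ + b⟩ have coordinates `(c * e , 0)` and `(c * b , c)`, already in
      -- normal form.
      R : Triple → Triple → Set
      R (c , e , b) S = S ≡ (c , c ℕ.* e , c ℕ.* b)

      Inv⇒Fixed : ∀ t → Inv n t → ∃ λ S → Fixed S × R t S
      Inv⇒Fixed (c , e , b) (eq , b< , divides k poly≡) = S , (s , fixed-S) , refl
        where
        S : Triple
        S = c , c ℕ.* e , c ℕ.* b
        eq′ : c ℕ.* (c ℕ.* e) ≡ n
        eq′ = trans (sym (ℕ.*-assoc c c e)) eq
        s : Sub n S
        s = eq′ , ℕ.*-monoʳ-< c {{factor-nonZeroˡ c eq′}} b<
        poly≡′ : + b * + b + + b + 1ℤ ≡ + k * + e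
        poly≡′ = trans (sym (pos-poly b)) (trans (cong +_ poly≡) (pos-* k e))
        e₁ : ∀ c e b k t u → - (c * t) ≡
          c * b * (b * t + e * u + t) + c * e * (- (k * t) + - (b * u)) + (k * e + - (b * b + b + 1ℤ)) * (c * t)
        e₁ = solve-∀
        e₂ : ∀ c e b t u → c * b * t + c * e * u + c * t ≡ c * (b * t + e * u + t)
        e₂ = solve-∀
        e₃ : ∀ z p x → z + (p + - p) * x ≡ z
        e₃ = solve-∀
        closed-ζ : ∀ v → Lat S v → Lat S (ζ v)
        closed-ζ _ (t , u , refl , refl) = t′ , u′ , first , second
          where
          open ≡-Reasoning
          -- `t′` is the height of the image divided by `c`. Then `u′` is forced, and
          -- `poly b = k * e` is what makes it integral.
          t′ u′ : ℤ
          t′ = + b * t + + e * u + t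
          u′ = - (+ k * t) + - (+ b * u)
          first : - (+ c * t) ≡ + (c ℕ.* b) * t′ + + (c ℕ.* e) * u′
          first = begin
            - (+ c * t)                                     ≡⟨ e₁ (+ c) (+ e) (+ b) (+ k) t u ⟩
            + c * + b * t′ + + c * + e * u′ + (+ k * + e + - (+ b * + b + + b + 1ℤ)) * (+ c * t)
              ≡⟨ cong (λ p → + c * + b * t′ + + c * + e * u′ + (+ k * + e + - p) * (+ c * t)) poly≡′ ⟩
            + c * + b * t′ + + c * + e * u′ + (+ k * + e + - (+ k * + e)) * (+ c * t)
              ≡⟨ e₃ (+ c * + b * t′ + + c * + e * u′) (+ k * + e) (+ c * t) ⟩
            + c * + b * t′ + + c * + e * u′                 ≡⟨ cong₂ (λ x y → x * t′ + y * u′) (pos-* c b) (pos-* c e) ⟨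
            + (c ℕ.* b) * t′ + + (c ℕ.* e) * u′             ∎
          second : + (c ℕ.* b) * t + + (c ℕ.* e) * u + + c * t ≡ + c * t′
          second = trans (cong₂ (λ x y → x * t + y * u + + c * t) (pos-* c b) (pos-* c e)) (e₂ (+ c) (+ e) (+ b) t u)
        fixed-S : rotate S ≡ S
        fixed-S = Sub-unique (rotate S) S (Sub-rotate S s) s (≐-trans (Lat-rotate S s) (ζ-closed⇒≐ S closed-ζ))

      -- Apply ζ to both generators: membership of `(0 , d)` makes `a` divide `d` and `b`, and
      -- membership of `(- a , b + a)` gives the congruence for the quotient of `b` by `a`.
      Fixed⇒Inv : ∀ S → Fixed S → ∃ λ t → Inv n t × R t S
      Fixed⇒Inv (a , d , b) (s@(eq , b<) , fixed-S) =
        let d≡ , b≡ = quotients flat in divide d≡ b≡ diag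
        where
        instance
          a≢0 : NonZero a
          a≢0 = factor-nonZeroˡ a eq
          d≢0 : NonZero d
          d≢0 = factor-nonZeroʳ a eq
        closed-ζ : ∀ v → Lat (a , d , b) v → Lat (a , d , b) (ζ v)
        closed-ζ v l = proj₁ (Lat-rotate (a , d , b) s) v (subst (λ S → Lat S v) (sym fixed-S) l)
        o₁ : ∀ b d → d ≡ b * 0ℤ + d * 1ℤ
        o₁ = solve-∀
        o₂ : ∀ b d → b ≡ b * 1ℤ + d * 0ℤ
        o₂ = solve-∀
        o₃ : ∀ a → a ≡ a * 1ℤ
        o₃ = solve-∀
        flat : Lat (a , d , b) (0ℤ , + d + 0ℤ)
        flat = closed-ζ (+ d , 0ℤ) (0ℤ , 1ℤ , o₁ (+ b) (+ d) , sym (*-zeroʳ (+ a)))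
        diag : Lat (a , d , b) (- + a , + b + + a)
        diag = closed-ζ (+ b , + a) (1ℤ , 0ℤ , o₂ (+ b) (+ d) , o₃ (+ a))
        quotients : Lat (a , d , b) (0ℤ , + d + 0ℤ) → (∃ λ e → d ≡ a ℕ.* e) × (∃ λ b′ → b ≡ a ℕ.* b′)
        quotients (t , u , ex , ey) = quotientℕ t d≡t , quotientℕ (- u) b≡u
          where
          open ≡-Reasoning
          p₁ : ∀ d → d ≡ d + 0ℤ
          p₁ = solve-∀
          q₁ : ∀ a t b d u → a * t * b ≡ a * (b * t + d * u) + d * (a * - u)
          q₁ = solve-∀
          q₂ : ∀ a z → a * 0ℤ + z ≡ z
          q₂ = solve-∀
          d≡t : + d ≡ + a * t
          d≡t = trans (p₁ (+ d)) ey
          -- The first coordinate gives 0 = bt + du. Multiplied by `a`, with at = d, it becomes db =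
          -- -adu, and `d` cancels.
          b≡u : + b ≡ + a * - u
          b≡u = *-cancelˡ-≡ (+ d) (+ b) (+ a * - u) (begin
            + d * + b                                      ≡⟨ cong (λ z → z * + b) d≡t ⟩
            + a * t * + b                                  ≡⟨ q₁ (+ a) t (+ b) (+ d) u ⟩
            + a * (+ b * t + + d * u) + + d * (+ a * - u)  ≡⟨ cong (λ z → + a * z + + d * (+ a * - u)) ex ⟨
            + a * 0ℤ + + d * (+ a * - u)                   ≡⟨ q₂ (+ a) (+ d * (+ a * - u)) ⟩
            + d * (+ a * - u)                              ∎)
          quotientℕ : ∀ {m} z → + m ≡ + a * z → ∃ λ q → m ≡ a ℕ.* q
          quotientℕ z eq = ∣ z ∣ , trans (cong ∣_∣ eq) (abs-* (+ a) z)
        divide : (∃ λ e → d ≡ a ℕ.* e) → (∃ λ b′ → b ≡ a ℕ.* b′) → Lat (a , d , b) (- + a , + b + + a) →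
                 ∃ λ t → Inv n t × R t (a , d , b)
        divide (e , de) (b′ , be) (t , u , ex , ey) = (a , e , b′) ,
          (trans (ℕ.*-assoc a a e) (trans (cong (a ℕ.*_) (sym de)) eq) ,
           ℕ.*-cancelˡ-< a b′ e (subst₂ _<_ be de b<) ,
           divides ∣ - u ∣ (trans poly≡ (ℕ.*-comm e ∣ - u ∣))) ,
          cong₂ (λ x y → a , x , y) de be
          where
          open ≡-Reasoning
          b≡a* : + b ≡ + a * + b′
          b≡a* = trans (cong +_ be) (pos-* a b′)
          d≡a* : + d ≡ + a * + e
          d≡a* = trans (cong +_ de) (pos-* a e)
          r₁ : ∀ a b → a * (b + 1ℤ) ≡ a * b + a
          r₁ = solve-∀
          r₂ : ∀ a b → a * (b * b + b + 1ℤ) ≡ a * b * (b + 1ℤ) + - - a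
          r₂ = solve-∀
          r₃ : ∀ a b e u → a * b * (b + 1ℤ) + - (a * b * (b + 1ℤ) + a * e * u) ≡ a * (e * - u)
          r₃ = solve-∀
          t≡ : + b′ + 1ℤ ≡ t
          t≡ = *-cancelˡ-≡ (+ a) (+ b′ + 1ℤ) t (trans (r₁ (+ a) (+ b′)) (trans (cong (λ z → z + + a) (sym b≡a*)) ey))
          polyℤ : + b′ * + b′ + + b′ + 1ℤ ≡ + e * - u
          polyℤ = *-cancelˡ-≡ (+ a) (+ b′ * + b′ + + b′ + 1ℤ) (+ e * - u) (begin
            + a * (+ b′ * + b′ + + b′ + 1ℤ)
              ≡⟨ r₂ (+ a) (+ b′) ⟩
            + a * + b′ * (+ b′ + 1ℤ) + - - + a
              ≡⟨ cong (λ z → + a * + b′ * (+ b′ + 1ℤ) + - z) ex ⟩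
            + a * + b′ * (+ b′ + 1ℤ) + - (+ b * t + + d * u)
              ≡⟨ cong (λ z → + a * + b′ * (+ b′ + 1ℤ) + - (+ b * z + + d * u)) (sym t≡) ⟩
            + a * + b′ * (+ b′ + 1ℤ) + - (+ b * (+ b′ + 1ℤ) + + d * u)
              ≡⟨ cong₂ (λ y z → + a * + b′ * (+ b′ + 1ℤ) + - (y * (+ b′ + 1ℤ) + z * u)) b≡a* d≡a* ⟩
            + a * + b′ * (+ b′ + 1ℤ) + - (+ a * + b′ * (+ b′ + 1ℤ) + + a * + e * u)
              ≡⟨ r₃ (+ a) (+ b′) (+ e) u ⟩
            + a * (+ e * - u) ∎)
          poly≡ : poly b′ ≡ e ℕ.* ∣ - u ∣
          poly≡ = trans (cong ∣_∣ (trans (pos-poly b′) polyℤ)) (abs-* (+ e) (- u))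

    Card-Fixed : ∀ {k} → Card (Inv n) k → Card (λ S → Sub n S × rotate S ≡ S) k
    Card-Fixed = Card-bij R Inv⇒Fixed Fixed⇒Inv (λ { _ _ _ _ _ _ refl refl → refl }) injective
      where
      injective : ∀ t t′ S → Inv n t → Inv n t′ → Fixed S → R t S → R t′ S → t ≡ t′
      injective (c , e , b) (c′ , e′ , b′) _ (eq , _) _ _ refl r with cong proj₁ r
      ... | refl = cong₂ (λ x y → c , x , y) (ℕ.*-cancelˡ-≡ e e′ c (cong (proj₁ ∘ proj₂) r)) (ℕ.*-cancelˡ-≡ b b′ c (cong (proj₂ ∘ proj₂) r))
        where
        instance
          c≢0 : NonZero c
          c≢0 = factor-nonZeroˡ c (trans (sym (ℕ.*-assoc c c e)) eq)

    -- `Card-unique` identifies the number of fixed entries of the list, which the orbit count sees,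
    -- with the number of ideals found arithmetically.
    count-trihexes : ∀ {k l} → Card (Sub n) k → Card (Inv n) l → ∃ λ N → NumTrihexes V N × 3 ℕ.* N ≡ k ℕ.+ 2 ℕ.* l
    count-trihexes {k} {l} c i = length (reps r) , NumTrihexes-reps c r ,
      trans (proj₂ orbit-data) (cong (λ z → k ℕ.+ 2 ℕ.* z) (Card-unique (Card-fixed c) (Card-Fixed i)))
      where
      orbit-data : Σ (Representatives rotate (elements c)) λ r → 3 ℕ.* length (reps r) ≡ k ℕ.+ 2 ℕ.* fixed (elements c)
      orbit-data = orbits c (λ {S} → Sub-rotate S) (λ {S} → rotate-cube S)
      r : Representatives rotate (elements c)
      r = proj₁ orbit-data

-- Specialisation to the two parity cases.

open PrimePowerCounts using (evenness)
open Factorised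
open Classification
open import Defs
open import Data.Nat using (ℕ; _+_; _*_; _^_; _<_; NonZero; >-nonZero)
open import Data.Nat.DivMod using (_/_; _%_; m*n/n≡m)
open import Data.Nat.Divisibility using (_∣_; divides)
open import Data.Nat.Properties using (*-comm; *-identityʳ; *-zeroʳ; +-identityʳ; m*n≢0⇒m≢0)
open import Data.List using (List; map)
open import Data.List.Relation.Unary.All using (All)
open import Data.List.Relation.Unary.Any using (Any)
open import Data.Product using (_×_; _,_; proj₂; ∃)
open import Relation.Binary.PropositionalEquality using (_≡_; refl; sym; trans; cong; subst)

theorem12 : (V : ℕ) → 0 < V → 4 ∣ V →
    (m : ℕ) (ps qs : List (ℕ × ℕ)) →
    PrimePowers 1 ps → PrimePowers 2 qs →
    V / 4 ≡ 3 ^ m * powProd ps * powProd qs →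
    (Any (λ qℓ → proj₂ qℓ % 2 ≡ 1) qs →
    ∃ λ N → NumTrihexes V N × 3 * N ≡ geomQ 3 m * geomProd ps * geomProd qs)
    ×
    (All (λ qℓ → proj₂ qℓ % 2 ≡ 0) qs →
    ∃ λ N → NumTrihexes V N ×
    3 * N ≡ geomQ 3 m * geomProd ps * geomProd qs + 2 * divCount ps)
theorem12 V 0<V (divides k refl) m ps qs P Q eq =
  (λ odd → let N , num , count = trihexes in
    N , num , trans count (trans (cong (λ z → total + 2 * (divCount ps * z)) (product-evenness-odd odd))
      (trans (cong (λ z → total + 2 * z) (*-zeroʳ (divCount ps))) (+-identityʳ total)))) ,
  (λ even → let N , num , count = trihexes in
    N , num , trans count (trans (cong (λ z → total + 2 * (divCount ps * z)) (product-evenness-even even))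
      (cong (λ z → total + 2 * z) (*-identityʳ (divCount ps)))))
  where
  n total : ℕ
  n = 3 ^ m * powProd ps * powProd qs
  total = geomQ 3 m * geomProd ps * geomProd qs
  k≡n : k ≡ n
  k≡n = trans (sym (m*n/n≡m k 4)) eq
  n≢0 : NonZero n
  n≢0 = subst NonZero k≡n (m*n≢0⇒m≢0 k {4} {{>-nonZero 0<V}})
  trihexes : ∃ λ N → NumTrihexes V N × 3 * N ≡ total + 2 * (divCount ps * prodℕ (map (λ x → evenness (proj₂ x)) qs))
  trihexes = count-trihexes n V {{n≢0}} (trans (*-comm k 4) (cong (4 *_) k≡n))
    (Card-Sub m {ps} {qs} P Q) (Card-Inv m {ps} {qs} P Q)
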